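{- Let $L\ge 0$ be an integer and let $\lambda=\lambda_1\bar\Lambda_1+\lambda_2\bar\Lambda_2$ with $\lambda_1,\lambda_2\in\mathbb{Z}_{\ge 0}$. Then there exists a bijection $\Phi:\mathrm{RC}(\lambda,L)\to\mathcal{P}(\lambda,L)$ such that $$c(\nu,J)=D(\Phi(\nu,J))\quad\text{for all }(\nu,J)\in\mathrm{RC}(\lambda,L).$$ (The paper constructs $\Phi$ explicitly by iterating a box-removal procedure on rigged configurations, each step producing the leftmost tensor factor of the path.)
   Context: Weights. $\bar\Lambda_1,\bar\Lambda_2$ are the fundamental weights of $G_2$ (Bourbaki labeling: $\alpha_1$ short, $\alpha_2$ long), with $\alpha_1=2\bar\Lambda_1-\bar\Lambda_2$ and $\alpha_2=-3\bar\Lambda_1+2\bar\Lambda_2$. For $\mu=\mu_1\bar\Lambda_1+\mu_2\bar\Lambda_2$ write $\langle\alpha_i^\vee,\mu\rangle=\mu_i$. The crystal $B$ (the $G_2^{(1)}$ Kirillov–Reshetikhin crystal $B^{2,1}$, restricted to the arrows $i\in\{1,2\}$). $B=\{1,2,\dots,14,\emptyset\}$. Write $b\xrightarrow{i}b'$ for $f_ib=b'$ (equivalently $e_ib'=b$). The $1$- and $2$-arrows are exactly: $1\xrightarrow{2}2$, $2\xrightarrow{1}3$, $3\xrightarrow{1}4$, $4\xrightarrow{2}5$, $4\xrightarrow{1}6$, $5\xrightarrow{1}7$, $7\xrightarrow{1}9$, $6\xrightarrow{2}8$, $8\xrightarrow{2}10$, $9\xrightarrow{2}11$, $10\xrightarrow{1}11$,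 $11\xrightarrow{1}12$, $12\xrightarrow{1}13$, $13\xrightarrow{2}14$; all other $e_i,f_i$ ($i=1,2$) are undefined ($\emptyset$ is isolated). Let $\varepsilon_i(b)=\max\{k\ge0: e_i^kb \text{ defined}\}$, $\varphi_i(b)=\max\{k\ge0: f_i^kb\text{ defined}\}$, and $\mathrm{wt}(b)=\sum_{i=1,2}(\varphi_i(b)-\varepsilon_i(b))\bar\Lambda_i$ (so $\mathrm{wt}(1)=\bar\Lambda_2$, $\mathrm{wt}(\emptyset)=\mathrm{wt}(7)=\mathrm{wt}(8)=0$, etc.). Paths. $\mathcal{P}(\lambda,L)$ (classically restricted paths of weight $\lambda$) is the set of highest weight elements $b_1\otimes\cdots\otimes b_L\in B^{\otimes L}$ (i.e. $e_1b=e_2b=0$) of weight $\lambda$, where tensor products use the anti-Kashiwara convention $e_i(b_1\otimes b_2)=e_ib_1\otimes b_2$ if $\varphi_i(b_2)<\varepsilon_i(b_1)$ and $=b_1\otimes e_ib_2$ otherwise, and weights are additive. Equivalently, recursively: $\mathcal{P}(\lambda,0)$ consists of the empty path if $\lambda=0$ and is empty otherwise; for $L\ge1$, $b_1\otimes\cdots\otimes b_L\in\mathcal{P}(\lambda,L)$ iff $b_2\otimes\cdots\otimes b_L\in\mathcal{P}(\lambda-\mathrm{wt}(b_1),L-1)$ and $\varepsilon_i(b_1)\le\langle\alpha_i^\vee,\lambda-\mathrm{wt}(b_1)\rangle$ for $i=1,2$. Energy. Define $H:B\otimes B\to\mathbb{Z}$ by $H(\emptyset\otimes\emptyset)=-2$,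 $H(\emptyset\otimes b)=H(b\otimes\emptyset)=-1$ for $b\in\{1,\dots,14\}$, and for $i,j\in\{1,\dots,14\}$: $H(i\otimes j)=0$ if $i\otimes j\in S_0$, $-1$ if $i\otimes j\in S_1$, $-2$ otherwise, where $S_0=\{1\otimes1,14\otimes14\}\cup\{i\otimes j: i\in\{1,2\}, 2\le j\le14\}\cup\{i\otimes j: i\in\{3,4,6\}, j\in\{6,8,9,\dots,14\}\}\cup\{i\otimes j: i\in\{5,8,10\},10\le j\le14\}\cup\{i\otimes j: i\in\{7,9,11,12,13\}, j\in\{13,14\}\}$, $S_1=\{2\otimes1\}\cup\{i\otimes j: i\in\{3,4,6\}, j\in\{1,2,3,4,5,7\}\}\cup\{i\otimes j: i\in\{5,8,10\},2\le j\le9\}\cup\{i\otimes j: i\in\{7,9,11,12,13\}, j\in\{6,8,9,10,11,12\}\}\cup\{14\otimes j: 10\le j\le13\}$. The energy is $D(b_1\otimes\cdots\otimes b_L)=\sum_{j=1}^{L}j\,H(b_j\otimes b_{j+1})$ with the convention $b_{L+1}=1$. Rigged configurations. A configuration is a pair $\nu=(\nu^{(1)},\nu^{(2)})$ of partitions; $m_i^{(a)}$ denotes the number of parts of $\nu^{(a)}$ equal to $i$ ($i\ge1$). The vacancy numbers are $p_i^{(1)}=-2\sum_{j\ge1}\min(i,j)m_j^{(1)}+\sum_{j\ge1}\min(i,3j)m_j^{(2)}$, $p_i^{(2)}=L+\sum_{j\ge1}\min(3i,j)m_j^{(1)}-2\sum_{j\ge1}\min(i,j)m_j^{(2)}$.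 $\nu$ is an admissible $\lambda$-configuration if $\sum_{i\ge1}i\,m_i^{(1)}\alpha_1+\sum_{i\ge1}i\,m_i^{(2)}\alpha_2=L\bar\Lambda_2-\lambda$ (i.e. $\lambda_1=-2\sum_i i m_i^{(1)}+3\sum_i i m_i^{(2)}$ and $\lambda_2=L+\sum_i i m_i^{(1)}-2\sum_i i m_i^{(2)}$) and $p_i^{(a)}\ge0$ for all $a\in\{1,2\}$, $i\ge1$. A rigged configuration is a pair $(\nu,J)$ with $\nu$ an admissible $\lambda$-configuration and $J=(J^{(a,i)})_{a\in\{1,2\},i\ge1}$ where each $J^{(a,i)}$ is a partition contained in an $m_i^{(a)}\times p_i^{(a)}$ rectangle (at most $m_i^{(a)}$ parts, each $\le p_i^{(a)}$). $\mathrm{RC}(\lambda,L)$ is the set of these. The charge is $c(\nu,J)=c(\nu)+|J|$, where $|J|=\sum_{a,i}|J^{(a,i)}|$ and $c(\nu)=\sum_{i,j}\min(i,j)m_i^{(1)}m_j^{(1)}-\sum_{i,j}\min(i,3j)m_i^{(1)}m_j^{(2)}+\sum_{i,j}\min(i,j)m_i^{(2)}m_j^{(2)}-L\sum_j m_j^{(2)}$. -}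

module Defs where

open import Data.Bool using (Bool; true; false; if_then_else_; _∧_; _∨_)
open import Data.Nat as N using (ℕ; zero; suc; _≡ᵇ_; _⊓_; _⊔_)
open import Data.Integer as Z using (ℤ; +_; -_; _-_; _+_; _*_; _≤_)
open import Data.List using (List; []; _∷_; length; foldr; map)
open import Data.Nat.ListAction using (sum)
open import Data.List.Relation.Unary.All using (All)
open import Data.List.Relation.Unary.Linked using (Linked)
open import Data.Vec using (Vec; toList)
open import Data.Maybe using (Maybe; just; nothing)
open import Data.Product using (Σ; _×_; _,_; proj₁; proj₂)
open import Relation.Binary.PropositionalEquality using (_≡_)

-- Weights: μ = μ₁ Λ̄₁ + μ₂ Λ̄₂ is represented by the pair (μ₁ , μ₂) ∈ ℤ × ℤ,
-- so ⟨α₁^∨, μ⟩ = proj₁ μ and ⟨α₂^∨, μ⟩ = proj₂ μ.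

Weight : Set
Weight = ℤ × ℤ

_-w_ : Weight → Weight → Weight
(a , b) -w (c , d) = (a - c , b - d)

data B : Set where
  b1 b2 b3 b4 b5 b6 b7 b8 b9 b10 b11 b12 b13 b14 ∅ : B

num : B → ℕ
num b1 = 1
num b2 = 2
num b3 = 3
num b4 = 4
num b5 = 5
num b6 = 6
num b7 = 7
num b8 = 8
num b9 = 9
num b10 = 10
num b11 = 11
num b12 = 12
num b13 = 13
num b14 = 14
num ∅ = 0

_==B_ : B → B → Bool
a ==B b = num a ≡ᵇ num b

arrows : List (B × ℕ × B)
arrows =
  (b1 , 2 , b2) ∷ (b2 , 1 , b3) ∷ (b3 , 1 , b4) ∷ (b4 , 2 , b5) ∷
  (b4 , 1 , b6) ∷ (b5 , 1 , b7) ∷ (b7 , 1 , b9) ∷ (b6 , 2 , b8) ∷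
  (b8 , 2 , b10) ∷ (b9 , 2 , b11) ∷ (b10 , 1 , b11) ∷ (b11 , 1 , b12) ∷
  (b12 , 1 , b13) ∷ (b13 , 2 , b14) ∷ []

fop : ℕ → B → Maybe B
fop i b = go arrows
  where
  go : List (B × ℕ × B) → Maybe B
  go [] = nothing
  go ((s , j , t) ∷ as) = if (s ==B b) ∧ (j ≡ᵇ i) then just t else go as

eop : ℕ → B → Maybe B
eop i b = go arrows
  where
  go : List (B × ℕ × B) → Maybe B
  go [] = nothing
  go ((s , j , t) ∷ as) = if (t ==B b) ∧ (j ≡ᵇ i) then just s else go as

-- number of times an operator can be iterated (with fuel; B has 15
-- elements and the arrow graph is acyclic, so fuel 15 suffices to
-- compute max{k : op^k b defined})
iterCount : ℕ → (B → Maybe B) → B → ℕ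
iterCount zero op b = 0
iterCount (suc n) op b with op b
... | nothing = 0
... | just b' = suc (iterCount n op b')

ε : ℕ → B → ℕ
ε i b = iterCount 15 (eop i) b

φ : ℕ → B → ℕ
φ i b = iterCount 15 (fop i) b

wt : B → Weight
wt b = (+ φ 1 b - + ε 1 b , + φ 2 b - + ε 2 b)

IsPath : ∀ {L} → Weight → Vec B L → Set
IsPath μ Vec.[] = μ ≡ (+ 0 , + 0)
IsPath μ (b Vec.∷ bs) =
  IsPath (μ -w wt b) bs
  × (+ ε 1 b ≤ proj₁ (μ -w wt b))
  × (+ ε 2 b ≤ proj₂ (μ -w wt b))

Path : ℕ → ℕ → ℕ → Set
Path λ₁ λ₂ L = Σ (Vec B L) (IsPath (+ λ₁ , + λ₂))

elem : ℕ → List ℕ → Bool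
elem n [] = false
elem n (x ∷ xs) = (n ≡ᵇ x) ∨ elem n xs

range : ℕ → ℕ → List ℕ
range a b = go (suc b N.∸ a) a
  where
  go : ℕ → ℕ → List ℕ
  go zero k = []
  go (suc n) k = k ∷ go n (suc k)

inS0 : ℕ → ℕ → Bool
inS0 i j =
  ((i ≡ᵇ 1) ∧ (j ≡ᵇ 1)) ∨ ((i ≡ᵇ 14) ∧ (j ≡ᵇ 14))
  ∨ (elem i (1 ∷ 2 ∷ []) ∧ elem j (range 2 14))
  ∨ (elem i (3 ∷ 4 ∷ 6 ∷ []) ∧ elem j (6 ∷ 8 ∷ range 9 14))
  ∨ (elem i (5 ∷ 8 ∷ 10 ∷ []) ∧ elem j (range 10 14))
  ∨ (elem i (7 ∷ 9 ∷ 11 ∷ 12 ∷ 13 ∷ []) ∧ elem j (13 ∷ 14 ∷ []))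

inS1 : ℕ → ℕ → Bool
inS1 i j =
  ((i ≡ᵇ 2) ∧ (j ≡ᵇ 1))
  ∨ (elem i (3 ∷ 4 ∷ 6 ∷ []) ∧ elem j (1 ∷ 2 ∷ 3 ∷ 4 ∷ 5 ∷ 7 ∷ []))
  ∨ (elem i (5 ∷ 8 ∷ 10 ∷ []) ∧ elem j (range 2 9))
  ∨ (elem i (7 ∷ 9 ∷ 11 ∷ 12 ∷ 13 ∷ []) ∧ elem j (6 ∷ 8 ∷ 9 ∷ 10 ∷ 11 ∷ 12 ∷ []))
  ∨ ((i ≡ᵇ 14) ∧ elem j (range 10 13))

H : B → B → ℤ
H ∅ ∅ = - + 2
H ∅ b = - + 1
H b1 ∅ = - + 1
H b2 ∅ = - + 1
H b3 ∅ = - + 1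
H b4 ∅ = - + 1
H b5 ∅ = - + 1
H b6 ∅ = - + 1
H b7 ∅ = - + 1
H b8 ∅ = - + 1
H b9 ∅ = - + 1
H b10 ∅ = - + 1
H b11 ∅ = - + 1
H b12 ∅ = - + 1
H b13 ∅ = - + 1
H b14 ∅ = - + 1
H a b =
  if inS0 (num a) (num b) then + 0
  else if inS1 (num a) (num b) then - + 1
  else - + 2

-- Σ_{j ≥ k} j H(b_j ⊗ b_{j+1}) for the list b_k, b_{k+1}, …, with b_{L+1} = 1
energyFrom : ℕ → List B → ℤ
energyFrom k [] = + 0
energyFrom k (b ∷ []) = + k * H b b1
energyFrom k (b ∷ c ∷ bs) = + k * H b c + energyFrom (suc k) (c ∷ bs)

D : ∀ {L} → Vec B L → ℤ
D v = energyFrom 1 (toList v)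

IsPartition : List ℕ → Set
IsPartition xs = Linked N._≥_ xs × All (λ k → 1 N.≤ k) xs

mult : List ℕ → ℕ → ℕ
mult [] i = 0
mult (x ∷ xs) i = (if x ≡ᵇ i then 1 else 0) N.+ mult xs i

Σto : ℕ → (ℕ → ℤ) → ℤ
Σto zero f = + 0
Σto (suc n) f = Σto n f + f (suc n)

Config : Set
Config = List ℕ × List ℕ

-- a bound beyond which all multiplicities m_j^{(a)} vanish; sums over
-- j ≥ 1 are truncated at this bound (the omitted terms are all 0)
bound : Config → ℕ
bound (ν₁ , ν₂) = sum ν₁ N.+ sum ν₂

Σm : Config → List ℕ → (ℕ → ℕ) → ℤ
Σm ν part g = Σto (bound ν) (λ j → + (g j N.* mult part j))

vac1 : Config → ℕ → ℕ → ℤ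
vac1 ν L i =
  - (+ 2 * Σm ν (proj₁ ν) (λ j → i ⊓ j))
  + Σm ν (proj₂ ν) (λ j → i ⊓ (3 N.* j))

vac2 : Config → ℕ → ℕ → ℤ
vac2 ν L i =
  + L
  + Σm ν (proj₁ ν) (λ j → (3 N.* i) ⊓ j)
  - + 2 * Σm ν (proj₂ ν) (λ j → i ⊓ j)

Admissible : ℕ → ℕ → ℕ → Config → Set
Admissible λ₁ λ₂ L ν =
  IsPartition (proj₁ ν) × IsPartition (proj₂ ν)
  × (+ λ₁ ≡ - (+ 2 * Σm ν (proj₁ ν) (λ j → j)) + + 3 * Σm ν (proj₂ ν) (λ j → j))
  × (+ λ₂ ≡ + L + Σm ν (proj₁ ν) (λ j → j) - + 2 * Σm ν (proj₂ ν) (λ j → j))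
  × (∀ i → 1 N.≤ i → + 0 ≤ vac1 ν L i)
  × (∀ i → 1 N.≤ i → + 0 ≤ vac2 ν L i)

-- Riggings J^{(a)} = (J^{(a,i)})_{i ≥ 1} are stored as a list whose
-- (i-1)-th entry is J^{(a,i)}; entries beyond the end are empty partitions.
-- The list has length exactly max part of ν^{(a)} (canonical form).
Rigging : Set
Rigging = List (List ℕ) × List (List ℕ)

Jat : List (List ℕ) → ℕ → List ℕ
Jat js zero = []
Jat [] (suc i) = []
Jat (j ∷ js) (suc zero) = j
Jat (j ∷ js) (suc (suc i)) = Jat js (suc i)

maxPart : List ℕ → ℕ
maxPart = foldr _⊔_ 0

InRect : List ℕ → ℕ → ℤ → Set
InRect μ m p = IsPartition μ × length μ N.≤ m × All (λ k → + k ≤ p) μ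

RCData : Set
RCData = Config × Rigging

IsRC : ℕ → ℕ → ℕ → RCData → Set
IsRC λ₁ λ₂ L (ν , (J₁ , J₂)) =
  Admissible λ₁ λ₂ L ν
  × length J₁ ≡ maxPart (proj₁ ν)
  × length J₂ ≡ maxPart (proj₂ ν)
  × (∀ i → 1 N.≤ i → InRect (Jat J₁ i) (mult (proj₁ ν) i) (vac1 ν L i))
  × (∀ i → 1 N.≤ i → InRect (Jat J₂ i) (mult (proj₂ ν) i) (vac2 ν L i))

RC : ℕ → ℕ → ℕ → Set
RC λ₁ λ₂ L = Σ RCData (IsRC λ₁ λ₂ L)

ΣΣ : Config → List ℕ → List ℕ → (ℕ → ℕ → ℕ) → ℤ
ΣΣ ν p q g = Σto (bound ν) (λ i → Σto (bound ν) (λ j →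
               + (g i j N.* mult p i N.* mult q j)))

cconf : ℕ → Config → ℤ
cconf L ν =
  ΣΣ ν (proj₁ ν) (proj₁ ν) _⊓_
  - ΣΣ ν (proj₁ ν) (proj₂ ν) (λ i j → i ⊓ (3 N.* j))
  + ΣΣ ν (proj₂ ν) (proj₂ ν) _⊓_
  - + L * Σm ν (proj₂ ν) (λ j → 1)

sizeJ : Rigging → ℤ
sizeJ (J₁ , J₂) = + (sum (map sum J₁) N.+ sum (map sum J₂))

charge : ∀ {λ₁ λ₂ L} → RC λ₁ λ₂ L → ℤ
charge {L = L} ((ν , J) , _) = cconf L ν + sizeJ J

{-# OPTIONS --safe #-}

-- Φ removes one tensor factor at a time.  Removing a factor of B^{2,1} from a rigged
-- configuration amounts to adding a singular string of length 1 to ν⁽¹⁾, which changes no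
-- vacancy number, followed by two passes of the box removal for the seven-dimensional
-- crystal B^{1,1}.  The two final states of the passes form a column that labels an
-- element of B^{2,1}.
--
-- A pass reads the configuration in blocks consisting of the lengths 3j-2, 3j-1, 3j of
-- ν⁽¹⁾ and the length j of ν⁽²⁾.  Strings are recorded by the differences of their
-- coriggings, which a pass leaves unchanged except at the strings it touches.  Then there
-- are finitely many ways (words) to cross a block, and the word is determined by the block
-- and its neighbour, both from the configuration before the pass and from the one after it.
-- So a pass is invertible, and it remains to see that it preserves nonnegativity of the
-- riggings; this follows from the concavity of the vacancy numbers.
--
-- The charge of a configuration is minus a quadratic form in the numbers of strings minus
-- the sum of the coriggings, and one pass changes it by the number of strings of ν⁽¹⁾.
-- Hence removing a factor b changes the charge by the number of parts of ν⁽²⁾, up to a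
-- correction for b = ∅, and the local energy H(b ⊗ b') is compared with the number of parts
-- of ν⁽²⁾ lost in the removal of b.  Which pairs of states and which values of that number
-- occur is a property of two and four consecutive passes; it is decided by exploring the
-- finitely many situations at the boundary of two blocks.
module Submission where

open import Defs
open import Data.Nat using (ℕ)
open import Data.Product using (Σ; ∃; _×_; proj₁)
open import Relation.Binary.PropositionalEquality using (_≡_)
open import Data.Bool using (Bool; true; false; _∧_; _∨_; not; if_then_else_; T)
open import Data.Empty using (⊥; ⊥-elim)
open import Data.Fin using (#_)
open import Data.Integer as Z using (ℤ; +_; -_; _-_; 0ℤ; ∣_∣; +≤+) renaming (_+_ to _⊕_; _*_ to _⊛_; _≤_ to _≤ᶻ_)
open import Data.Integer.Properties as ZP using (0≤i-j⇒j≤i; i≤j⇒0≤j-i)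
open import Data.List as L using (List; []; _∷_; length; map; _++_; filterᵇ)
open import Data.List.Membership.Propositional using (_∈_)
open import Data.List.Membership.Propositional.Properties using (∈-++⁺ˡ; ∈-++⁺ʳ; ∈-map⁺; ∈-lookup)
open import Data.List.Properties using (∷-injectiveˡ; ∷-injectiveʳ)
open import Data.List.Relation.Unary.All as All using (All; []; _∷_)
open import Data.List.Relation.Unary.Any using (here; there)
open import Data.List.Relation.Unary.Linked using (Linked; []; [-]; _∷_)
open import Data.Maybe using (Maybe; just; nothing; fromMaybe)
open import Data.Nat as N using (zero; suc; _+_; _*_; _∸_; _≡ᵇ_; _≤ᵇ_; _<ᵇ_; z≤n; s≤s; _⊓_; _⊔_)
open import Data.Nat.ListAction using (sum)
open import Data.Nat.Properties as NP using (≡ᵇ⇒≡; ≡⇒≡ᵇ; ≤ᵇ⇒≤; +-cancelˡ-≡; suc-injective)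
open import Data.Product using (_,_; proj₂)
open import Data.Sum using (_⊎_; inj₁; inj₂)
open import Data.Unit using (⊤; tt)
open import Data.Vec using (Vec; []; _∷_; toList; replicate)
open import Relation.Binary.PropositionalEquality using (refl; sym; trans; cong; cong₂; subst; subst₂)
open import Relation.Nullary using (isYes)
import Data.Integer.Tactic.RingSolver as ZR
import Data.Nat.Tactic.RingSolver as NR

-- Boolean checks over finite types

-- Two factors `B^{1,1}` appear because α₁ = 2Λ₁ - Λ₂: a factor of weight Λ₂ weighs as much as two
-- of weight Λ₁ together with one more box in ν⁽¹⁾. Storing differences of coriggings makes every
-- list of naturals a legal column, so existence and uniqueness of a pass become local questions,
-- settled word by word; the global condition, nonnegativity, is kept apart in `HW`. Three obstacles
-- shape the rest. A string may lose two boxes, one on each side of a block boundary; this forces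
-- the extra state `s*` and a lookahead by one column. The vacancy numbers corrected by the pass are
-- not quite concave: the inequality may fail by one, and the failures are absorbed by tags 0 or 1
-- that telescope. Finally, `H` depends on two neighbouring factors, hence on the ends of four
-- passes, while the parts lost by ν⁽²⁾ are seen at the shortest strings. The two are linked across
-- arbitrarily many blocks by a computed invariant, a finite set of boundary situations closed under
-- adding a block.

split : ∀ a {b} → T (a ∧ b) → T a × T b
split true p = tt , p

join : ∀ a {b} → T a → T b → T (a ∧ b)
join true _ p = p

trueT : ∀ {b} → b ≡ true → T b
trueT refl = tt

implies : ∀ a {b} → T (not a ∨ b) → T a → T b
implies true p _ = p

-- Boundary states of a pass: the vertices s0, …, s6 of the crystal B^{1,1}
-- in the order of its arrows 1, 2, 1, 1, 2, 1.  The extra state s* stands for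
-- s3 reached in the middle of a string that loses two boxes at once, one on
-- each side of the block boundary.
data St : Set where
  s0 s1 s2 s3 s4 s5 s6 s* : St

code : St → ℕ
code s0 = 0
code s1 = 1
code s2 = 2
code s3 = 3
code s4 = 4
code s5 = 5
code s6 = 6
code s* = 7

decode : ℕ → St
decode 0 = s0
decode 1 = s1
decode 2 = s2
decode 3 = s3
decode 4 = s4
decode 5 = s5
decode 6 = s6
decode _ = s*

decode-code : ∀ s → decode (code s) ≡ s
decode-code s0 = refl
decode-code s1 = refl
decode-code s2 = refl
decode-code s3 = refl
decode-code s4 = refl
decode-code s5 = refl
decode-code s6 = refl
decode-code s* = refl

_≡ˢ_ : St → St → Bool
s ≡ˢ t = code s ≡ᵇ code t

≡ˢ-sound : ∀ s t → T (s ≡ˢ t) → s ≡ t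
≡ˢ-sound s t p = trans (sym (decode-code s)) (trans (cong decode (≡ᵇ⇒≡ (code s) (code t) p)) (decode-code t))

≡ˢ-refl : ∀ s → T (s ≡ˢ s)
≡ˢ-refl s = ≡⇒≡ᵇ (code s) (code s) refl

all∈ : {A : Set} → (A → Bool) → List A → Bool
all∈ f [] = true
all∈ f (x ∷ xs) = f x ∧ all∈ f xs

all∈-sound : {A : Set} (f : A → Bool) {xs : List A} → T (all∈ f xs) → ∀ {x} → x ∈ xs → T (f x)
all∈-sound f {x ∷ xs} p (here refl) = proj₁ (split (f x) p)
all∈-sound f {x ∷ xs} p (there i) = all∈-sound f (proj₂ (split (f x) p)) i

states : List St
states = s0 ∷ s1 ∷ s2 ∷ s3 ∷ s4 ∷ s5 ∷ s6 ∷ s* ∷ []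

opaque
  allSt : (St → Bool) → Bool
  allSt f = all∈ f states

  allSt-sound : ∀ f → T (allSt f) → ∀ s → T (f s)
  allSt-sound f p s0 = all∈-sound f {states} p (here refl)
  allSt-sound f p s1 = all∈-sound f {states} p (there (here refl))
  allSt-sound f p s2 = all∈-sound f {states} p (there (there (here refl)))
  allSt-sound f p s3 = all∈-sound f {states} p (there (there (there (here refl))))
  allSt-sound f p s4 = all∈-sound f {states} p (there (there (there (there (here refl)))))
  allSt-sound f p s5 = all∈-sound f {states} p (there (there (there (there (there (here refl))))))
  allSt-sound f p s6 = all∈-sound f {states} p (there (there (there (there (there (there (here refl)))))))
  allSt-sound f p s* = all∈-sound f {states} p (there (there (there (there (there (there (there (here refl))))))))

  allBool : (Bool → Bool) → Bool
  allBool f = f true ∧ f false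

  allBool-sound : ∀ f → T (allBool f) → ∀ b → T (f b)
  allBool-sound f p true  = proj₁ (split (f true) p)
  allBool-sound f p false = proj₂ (split (f true) p)

∈-filterᵇ⁻ : {A : Set} (f : A → Bool) {xs : List A} {x : A} → x ∈ filterᵇ f xs → x ∈ xs × T (f x)
∈-filterᵇ⁻ f {y ∷ ys} i with f y in eq
∈-filterᵇ⁻ f {y ∷ ys} (here refl) | true = here refl , subst T (sym eq) tt
∈-filterᵇ⁻ f {y ∷ ys} (there i) | true with ∈-filterᵇ⁻ f i
... | j , p = there j , p
∈-filterᵇ⁻ f {y ∷ ys} i | false with ∈-filterᵇ⁻ f i
... | j , p = there j , p

∈-filterᵇ⁺ : {A : Set} (f : A → Bool) {xs : List A} {x : A} → x ∈ xs → T (f x) → x ∈ filterᵇ f xs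
∈-filterᵇ⁺ f {y ∷ ys} (here refl) p with f y
... | true = here refl
∈-filterᵇ⁺ f {y ∷ ys} (there i) p with f y
... | true = there (∈-filterᵇ⁺ f i p)
... | false = ∈-filterᵇ⁺ f i p

single : {A : Set} → List A → Bool
single (_ ∷ []) = true
single _ = false

single-sound : {A : Set} {xs : List A} → T (single xs) → ∃ λ x → x ∈ xs × (∀ {y} → y ∈ xs → y ≡ x)
single-sound {xs = x ∷ []} _ = x , here refl , λ { (here refl) → refl }

-- Columns.  The strings of one length are recorded by their coriggings
-- (vacancy number minus rigging) in increasing order, and these by their
-- successive differences; so every list of naturals is a legal column.

Column : Set
Column = List ℕ

shift : ℕ → Column → Column
shift r [] = []
shift r (x ∷ xs) = r + x ∷ xs

-- How a column is split into the coriggings touched by a pass and the rest.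
data Side : Set where
  any ge1 ge2 pop0 pop0ge1 pop00 pop1 : Side

infixr 5 _▷_
_▷_ : Side → Column → Column
any     ▷ X = X
ge1     ▷ X = shift 1 X
ge2     ▷ X = shift 2 X
pop0    ▷ X = 0 ∷ X
pop0ge1 ▷ X = 0 ∷ shift 1 X
pop00   ▷ X = 0 ∷ 0 ∷ X
pop1    ▷ X = 1 ∷ X

shift-injective : ∀ r {X Y} → shift r X ≡ shift r Y → X ≡ Y
shift-injective r {[]} {[]} _ = refl
shift-injective r {x ∷ X} {y ∷ Y} e = cong₂ _∷_ (+-cancelˡ-≡ r x y (∷-injectiveˡ e)) (∷-injectiveʳ e)

▷-injective : ∀ S {X Y} → S ▷ X ≡ S ▷ Y → X ≡ Y
▷-injective any e = e
▷-injective ge1 e = shift-injective 1 e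
▷-injective ge2 e = shift-injective 2 e
▷-injective pop0 e = ∷-injectiveʳ e
▷-injective pop0ge1 e = shift-injective 1 (∷-injectiveʳ e)
▷-injective pop00 e = ∷-injectiveʳ (∷-injectiveʳ e)
▷-injective pop1 e = ∷-injectiveʳ e

-- Sides compare only the first two entries of a column with 0, 1 and 2, so four classes suffice.
-- The empty column counts as `big`: it has no string that could violate a lower bound, and none to
-- take.
data Letter : Set where
  zz z1 one big : Letter

letter : Column → Letter
letter [] = big
letter (0 ∷ []) = z1
letter (0 ∷ 0 ∷ _) = zz
letter (0 ∷ suc _ ∷ _) = z1
letter (1 ∷ _) = one
letter (suc (suc _) ∷ _) = big

isZero : Letter → Bool
isZero zz = true
isZero z1 = true
isZero _ = false

fits : Side → Letter → Bool
fits any _ = true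
fits ge1 one = true
fits ge1 big = true
fits ge2 big = true
fits pop0 l = isZero l
fits pop0ge1 z1 = true
fits pop00 zz = true
fits pop1 one = true
fits _ _ = false

fits-▷ : ∀ S X → T (fits S (letter (S ▷ X)))
fits-▷ any X = tt
fits-▷ ge1 [] = tt
fits-▷ ge1 (0 ∷ _) = tt
fits-▷ ge1 (suc _ ∷ _) = tt
fits-▷ ge2 [] = tt
fits-▷ ge2 (_ ∷ _) = tt
fits-▷ pop0 [] = tt
fits-▷ pop0 (0 ∷ _) = tt
fits-▷ pop0 (suc _ ∷ _) = tt
fits-▷ pop0ge1 [] = tt
fits-▷ pop0ge1 (_ ∷ _) = tt
fits-▷ pop00 X = tt
fits-▷ pop1 X = tt

fits-sound : ∀ S C → T (fits S (letter C)) → ∃ λ X → S ▷ X ≡ C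
fits-sound any C _ = C , refl
fits-sound ge1 [] _ = [] , refl
fits-sound ge1 (0 ∷ []) ()
fits-sound ge1 (0 ∷ 0 ∷ _) ()
fits-sound ge1 (0 ∷ suc _ ∷ _) ()
fits-sound ge1 (1 ∷ C) _ = 0 ∷ C , refl
fits-sound ge1 (suc (suc x) ∷ C) _ = suc x ∷ C , refl
fits-sound ge2 [] _ = [] , refl
fits-sound ge2 (0 ∷ []) ()
fits-sound ge2 (0 ∷ 0 ∷ _) ()
fits-sound ge2 (0 ∷ suc _ ∷ _) ()
fits-sound ge2 (1 ∷ C) ()
fits-sound ge2 (suc (suc x) ∷ C) _ = x ∷ C , refl
fits-sound pop0 [] ()
fits-sound pop0 (0 ∷ C) _ = C , refl
fits-sound pop0 (1 ∷ C) ()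
fits-sound pop0 (suc (suc x) ∷ C) ()
fits-sound pop0ge1 [] ()
fits-sound pop0ge1 (0 ∷ []) _ = [] , refl
fits-sound pop0ge1 (0 ∷ 0 ∷ _) ()
fits-sound pop0ge1 (0 ∷ suc x ∷ C) _ = x ∷ C , refl
fits-sound pop0ge1 (1 ∷ C) ()
fits-sound pop0ge1 (suc (suc x) ∷ C) ()
fits-sound pop00 [] ()
fits-sound pop00 (0 ∷ []) ()
fits-sound pop00 (0 ∷ 0 ∷ C) _ = C , refl
fits-sound pop00 (0 ∷ suc x ∷ C) ()
fits-sound pop00 (1 ∷ C) ()
fits-sound pop00 (suc (suc x) ∷ C) ()
fits-sound pop1 [] ()
fits-sound pop1 (0 ∷ []) ()
fits-sound pop1 (0 ∷ 0 ∷ _) ()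
fits-sound pop1 (0 ∷ suc _ ∷ _) ()
fits-sound pop1 (1 ∷ C) _ = C , refl
fits-sound pop1 (suc (suc x) ∷ C) ()

letters : List Letter
letters = zz ∷ z1 ∷ one ∷ big ∷ []

opaque
  allLetter : (Letter → Bool) → Bool
  allLetter f = all∈ f letters

  allLetter-sound : ∀ f → T (allLetter f) → ∀ l → T (f l)
  allLetter-sound f p zz = all∈-sound f {letters} p (here refl)
  allLetter-sound f p z1 = all∈-sound f {letters} p (there (here refl))
  allLetter-sound f p one = all∈-sound f {letters} p (there (there (here refl)))
  allLetter-sound f p big = all∈-sound f {letters} p (there (there (there (here refl))))

-- Words: the ways a pass can cross one block

-- Boxes removed so far from ν⁽¹⁾ and ν⁽²⁾.
RS QS : St → ℕ
RS s0 = 0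
RS s1 = 1
RS s2 = 1
RS s3 = 2
RS s4 = 3
RS s5 = 3
RS s6 = 4
RS s* = 2
QS s0 = 0
QS s1 = 0
QS s2 = 1
QS s3 = 1
QS s4 = 1
QS s5 = 2
QS s6 = 2
QS s* = 1

-- A block j covers the lengths 3j-2, 3j-1, 3j of ν⁽¹⁾ and the length j of ν⁽²⁾.
-- A word records the states at its two ends and the numbers r₁ and r₂ of boxes
-- removed from ν⁽¹⁾ in the columns up to 3j-2 and 3j-1.
record Word : Set where
  constructor word
  field
    src tgt : St
    r₁ r₂ : ℕ

open Word public

opaque
  -- Completeness and unambiguity of the list are computed: `checkedF` and `checkedB` find exactly
  -- one word for each admissible combination of state, letters and lookahead. It is opaque so that
  -- it unfolds only inside such checks.
  words : List Word
  words =
    word s0 s0 0 0 ∷ word s0 s1 0 0 ∷ word s0 s1 0 1 ∷ word s0 s1 1 1 ∷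
    word s0 s2 1 1 ∷ word s0 s3 1 1 ∷ word s0 s* 1 1 ∷ word s0 s3 1 2 ∷
    word s0 s4 1 2 ∷ word s0 s5 1 2 ∷ word s0 s6 1 2 ∷ word s0 s6 1 3 ∷
    word s0 s6 2 3 ∷ word s1 s1 1 1 ∷ word s1 s2 1 1 ∷ word s1 s3 1 1 ∷
    word s1 s* 1 1 ∷ word s1 s3 1 2 ∷ word s1 s4 1 2 ∷ word s1 s6 2 3 ∷
    word s2 s2 1 1 ∷ word s2 s3 1 1 ∷ word s2 s* 1 1 ∷ word s2 s3 1 2 ∷
    word s2 s4 1 2 ∷ word s2 s3 2 2 ∷ word s2 s4 2 2 ∷ word s2 s4 2 3 ∷
    word s2 s5 2 3 ∷ word s2 s6 2 3 ∷ word s3 s3 2 2 ∷ word s3 s4 2 2 ∷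
    word s3 s4 2 3 ∷ word s3 s5 2 3 ∷ word s3 s6 2 3 ∷ word s3 s4 3 3 ∷
    word s* s4 3 3 ∷ word s3 s5 3 3 ∷ word s* s5 3 3 ∷ word s3 s6 3 3 ∷
    word s* s6 3 3 ∷ word s4 s4 3 3 ∷ word s4 s5 3 3 ∷ word s4 s6 3 3 ∷
    word s5 s5 3 3 ∷ word s5 s6 3 3 ∷ word s5 s6 3 4 ∷ word s5 s6 4 4 ∷
    word s6 s6 4 4 ∷ []

r₀ r₃ δ₁ δ₂ δ₃ a x₀ x₁ x₂ x₃ : Word → ℕ
r₀ w = RS (src w)
r₃ w = RS (tgt w)
δ₁ w = r₁ w ∸ r₀ w
δ₂ w = r₂ w ∸ r₁ w
δ₃ w = r₃ w ∸ r₂ w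
a w = QS (tgt w) ∸ QS (src w)
x₀ w = 3 * QS (src w)
x₁ w = x₀ w + a w
x₂ w = x₁ w + a w
x₃ w = 3 * QS (tgt w)

atS3 : ℕ → ℕ → Bool
atS3 r x = (r ≡ᵇ 2) ∧ (x ≡ᵇ 3)

-- When r boxes have been removed from ν⁽¹⁾ up to the column at hand and x is
-- three times the number of boxes removed from ν⁽²⁾ there (a box of ν⁽²⁾ counts
-- gradually over its block), the vacancy number drops by 1 + x - 2r = g - h.
-- The values g and h generalise φ₁ and ε₁.
g h v : ℕ → ℕ → ℕ
g r x = if atS3 r x then 1 else (1 + x) ∸ 2 * r
h r x = if atS3 r x then 1 else (2 * r) ∸ (1 + x)
v r x = if atS3 r x then 1 else 0

gK hK : St → ℕ
gK s = RS s ∸ 2 * QS s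
hK s = 2 * QS s ∸ RS s

-- k coriggings equal to c, all others at least b; the remaining combinations do not occur.
side : (k c b : ℕ) → Side
side 0 _ 0 = any
side 0 _ 1 = ge1
side 0 _ 2 = ge2
side 1 0 0 = pop0
side 1 0 1 = pop0ge1
side 2 0 0 = pop00
side 1 1 1 = pop1
side _ _ _ = any

-- The sides `f` describe lengths 3j-2, 3j-1, 3j of ν⁽¹⁾ and j of ν⁽²⁾ before the pass; the sides
-- `b` describe lengths 3j-3, 3j-2, 3j-1 and j-1 after it. A string losing boxes in two adjacent
-- columns only travels through the middle length, hence the truncated differences of the δ. Across
-- a block boundary this happens exactly at `s*`, where length 3j neither gives nor receives a
-- string.
f₁ f₂ f₃ fK b₀ b₁ b₂ bK : Word → Side
f₁ w = side (δ₁ w ∸ δ₂ w) (v (r₁ w) (x₁ w)) (g (r₁ w) (x₁ w))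
f₂ w = side (δ₂ w ∸ δ₃ w) (v (r₂ w) (x₂ w)) (g (r₂ w) (x₂ w))
f₃ w = if tgt w ≡ˢ s* then ge2 else side (δ₃ w) (v (r₃ w) (x₃ w)) (g (r₃ w) (x₃ w))
fK w = side (a w) 0 (gK (tgt w))
b₀ w = if src w ≡ˢ s* then ge2 else side (δ₁ w) (v (r₀ w) (x₀ w)) (h (r₀ w) (x₀ w))
b₁ w = side (δ₂ w ∸ δ₁ w) (v (r₁ w) (x₁ w)) (h (r₁ w) (x₁ w))
b₂ w = side (δ₃ w ∸ δ₂ w) (v (r₂ w) (x₂ w)) (h (r₂ w) (x₂ w))
bK w = side (a w) 0 (hK (src w))

-- At the far end nothing is pushed back.
e₃ eK : St → Side
e₃ s = side 0 0 (h (RS s) (3 * QS s))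
eK s = side 0 0 (hK s)

plain : St → Bool
plain s = not (s ≡ˢ s*)

-- The ambiguity resolved by the lookahead. If length 3j+1 has a corigging 0, a pass that would
-- cross the boundary in `s2` takes the boxes 3j and 3j+1 of such a string instead, which is `s*`.
-- That string comes out with length 3j-1 and corigging 0, so in the inverse pass `s*` competes with
-- `s4` and the column before the boundary decides.
okF : St → Bool → Bool
okF s2 z = not z
okF s* z = z
okF _  _ = true

okB : St → Bool → Bool
okB s4 y = not y
okB s* y = y
okB _  _ = true

okF-plain : ∀ s → T (okF s false) → T (plain s)
okF-plain s0 _ = tt
okF-plain s1 _ = tt
okF-plain s2 _ = tt
okF-plain s3 _ = tt
okF-plain s4 _ = tt
okF-plain s5 _ = tt
okF-plain s6 _ = tt

plain-okF : ∀ s → T (plain s) → T (okF s false)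
plain-okF s0 _ = tt
plain-okF s1 _ = tt
plain-okF s2 _ = tt
plain-okF s3 _ = tt
plain-okF s4 _ = tt
plain-okF s5 _ = tt
plain-okF s6 _ = tt

plain-okB : ∀ s → T (plain s) → T (okB s false)
plain-okB s0 _ = tt
plain-okB s1 _ = tt
plain-okB s2 _ = tt
plain-okB s3 _ = tt
plain-okB s4 _ = tt
plain-okB s5 _ = tt
plain-okB s6 _ = tt

-- The candidates are filtered one condition after another so that partial
-- results are shared when the check is evaluated.
module Choose (end : Word → St) (S₁ S₂ S₃ S₄ : Word → Side) (far : Bool → Word → Bool) (ok : St → Bool → Bool) where

  keep₀ : St → List Word → List Word
  keep₀ s = filterᵇ (λ w → end w ≡ˢ s)

  keep : (Word → Side) → Letter → List Word → List Word
  keep S l = filterᵇ (λ w → fits (S w) l)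

  keepZ : Bool → List Word → List Word
  keepZ z = filterᵇ (far z)

  check₅ check₄ check₃ check₂ : Bool → List Word → Bool
  check₅ o W = allBool λ z → not o ∨ single (keepZ z W)
  check₄ o W = allLetter λ l → check₅ o (keep S₄ l W)
  check₃ o W = allLetter λ l → check₄ o (keep S₃ l W)
  check₂ o W = allLetter λ l → check₃ o (keep S₂ l W)

  check₁ : St → List Word → Bool
  check₁ s W = allLetter λ l → check₂ (ok s (isZero l)) (keep S₁ l W)

  check : List Word → Bool
  check W = allSt λ s → check₁ s (keep₀ s W)

  Fits : St → (l₁ l₂ l₃ l₄ : Letter) → Bool → Word → Set
  Fits s l₁ l₂ l₃ l₄ z w = end w ≡ s × T (fits (S₁ w) l₁) × T (fits (S₂ w) l₂) × T (fits (S₃ w) l₃) × T (fits (S₄ w) l₄) × T (far z w)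

  module _ {W : List Word} (c : T (check W)) (s : St) (l₁ l₂ l₃ l₄ : Letter) (z : Bool) (o : T (ok s (isZero l₁))) where
    private
      W₀ = keep₀ s W
      W₁ = keep S₁ l₁ W₀
      W₂ = keep S₂ l₂ W₁
      W₃ = keep S₃ l₃ W₂
      W₄ = keep S₄ l₄ W₃
      o' = ok s (isZero l₁)
      sole : T (single (keepZ z W₄))
      sole = implies o' (allBool-sound (λ z → not o' ∨ single (keepZ z W₄))
        (allLetter-sound (λ l → check₅ o' (keep S₄ l W₃))
        (allLetter-sound (λ l → check₄ o' (keep S₃ l W₂))
        (allLetter-sound (λ l → check₃ o' (keep S₂ l W₁))
        (allLetter-sound (λ l → check₂ (ok s (isZero l)) (keep S₁ l W₀))
        (allSt-sound (λ s → check₁ s (keep₀ s W)) c s) l₁) l₂) l₃) l₄) z) o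
      member : ∀ {w} → w ∈ W → Fits s l₁ l₂ l₃ l₄ z w → w ∈ keepZ z W₄
      member {w} i (refl , m₁ , m₂ , m₃ , m₄ , m₅) =
        ∈-filterᵇ⁺ (far z) (∈-filterᵇ⁺ _ (∈-filterᵇ⁺ _ (∈-filterᵇ⁺ _ (∈-filterᵇ⁺ _ (∈-filterᵇ⁺ (λ w → end w ≡ˢ s) i
          (≡ˢ-refl (end w))) m₁) m₂) m₃) m₄) m₅

    choose : ∃ λ w → w ∈ W × Fits s l₁ l₂ l₃ l₄ z w
    choose with single-sound sole
    ... | w , i₅ , _ with ∈-filterᵇ⁻ (far z) {W₄} i₅
    ... | i₄ , m₅ with ∈-filterᵇ⁻ (λ w → fits (S₄ w) l₄) {W₃} i₄
    ... | i₃ , m₄ with ∈-filterᵇ⁻ (λ w → fits (S₃ w) l₃) {W₂} i₃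
    ... | i₂ , m₃ with ∈-filterᵇ⁻ (λ w → fits (S₂ w) l₂) {W₁} i₂
    ... | i₁ , m₂ with ∈-filterᵇ⁻ (λ w → fits (S₁ w) l₁) {W₀} i₁
    ... | i₀ , m₁ with ∈-filterᵇ⁻ (λ w → end w ≡ˢ s) {W} i₀
    ... | i , m₀ = w , i , ≡ˢ-sound (end w) s m₀ , m₁ , m₂ , m₃ , m₄ , m₅

    same : ∀ {w w'} → w ∈ W → w' ∈ W → Fits s l₁ l₂ l₃ l₄ z w → Fits s l₁ l₂ l₃ l₄ z w' → w ≡ w'
    same i i' m m' = trans (proj₂ (proj₂ u) (member i m)) (sym (proj₂ (proj₂ u) (member i' m')))
      where u = single-sound sole

module CF = Choose src f₁ f₂ f₃ fK (λ z w → okF (tgt w) z) okF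
module CB = Choose tgt b₂ b₁ b₀ bK (λ y w → okB (src w) y) okB

opaque
  unfolding words allSt allBool allLetter

  checkedF : CF.check words ≡ true
  checkedF = refl

  checkedB : CB.check words ≡ true
  checkedB = refl

  -- The lookahead condition is already enforced by the side on which the following word starts;
  -- therefore `Trace` does not have to record it.
  startsF : ∀ {w} → w ∈ words → ∀ l → T (fits (f₁ w) l) → T (okF (src w) (isZero l))
  startsF {w} i l = implies (fits (f₁ w) l)
    (allLetter-sound (λ l → not (fits (f₁ w) l) ∨ okF (src w) (isZero l))
      (all∈-sound (λ w → allLetter λ l → not (fits (f₁ w) l) ∨ okF (src w) (isZero l)) {words} (trueT refl) i) l)

  startsB : ∀ {w} → w ∈ words → ∀ l → T (fits (b₂ w) l) → T (okB (tgt w) (isZero l))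
  startsB {w} i l = implies (fits (b₂ w) l)
    (allLetter-sound (λ l → not (fits (b₂ w) l) ∨ okB (tgt w) (isZero l))
      (all∈-sound (λ w → allLetter λ l → not (fits (b₂ w) l) ∨ okB (tgt w) (isZero l)) {words} (trueT refl) i) l)

  -- Every vertex of `B^{1,1}` other than `s0` has ε₁ or ε₂ positive, and this excludes zeros among
  -- the untouched coriggings. Two zeros are required because `pop0ge1` tolerates one.
  bottomB : ∀ {w} → w ∈ words → T (fits (b₀ w) zz) → T (fits (bK w) zz) → src w ≡ s0
  bottomB {w} i p q = ≡ˢ-sound (src w) s0 (implies (fits (b₀ w) zz ∧ fits (bK w) zz)
    (all∈-sound (λ w → not (fits (b₀ w) zz ∧ fits (bK w) zz) ∨ (src w ≡ˢ s0)) {words} (trueT refl) i) (join (fits (b₀ w) zz) p q))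

  bottomF : ∀ {w} → w ∈ words → src w ≡ s0 → T (fits (b₀ w) zz) × T (fits (bK w) zz)
  bottomF {w} i e = split (fits (b₀ w) zz) (implies (src w ≡ˢ s0)
    (all∈-sound (λ w → not (src w ≡ˢ s0) ∨ (fits (b₀ w) zz ∧ fits (bK w) zz)) {words} (trueT refl) i)
    (subst (λ s → T (s ≡ˢ s0)) (sym e) tt))

-- Passes

record Block : Set where
  constructor blk
  field
    c₁ c₂ c₃ cK : Column

open Block public

Conf : ℕ → Set
Conf M = Vec Block M

-- The `X` and `Y` are the untouched strings, common to both configurations; `inp` and `out` are two
-- readings of the same trace, so the pass and its inverse are treated alike. What lengths 3j and j
-- receive is decided only by the following word, hence `hd₃` and `hdK`.
data Trace (t : St) : St → ℕ → Set where
  done : T (plain t) → Trace t t 0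
  step : ∀ {s M} (w : Word) → w ∈ words → src w ≡ s → (X₁ X₂ X₃ Y₃ : Column) → Trace t (tgt w) M → Trace t s (suc M)

inp : ∀ {t s M} → Trace t s M → Conf M
inp (done _) = []
inp (step w _ _ X₁ X₂ X₃ Y₃ τ) = blk (f₁ w ▷ X₁) (f₂ w ▷ X₂) (f₃ w ▷ X₃) (fK w ▷ Y₃) ∷ inp τ

hd₃ hdK : ∀ {t s M} → Trace t s M → Side
hd₃ {t} (done _) = e₃ t
hd₃ (step w _ _ _ _ _ _ _) = b₀ w
hdK {t} (done _) = eK t
hdK (step w _ _ _ _ _ _ _) = bK w

out : ∀ {t s M} → Trace t s M → Conf M
out (done _) = []
out (step w _ _ X₁ X₂ X₃ Y₃ τ) = blk (b₁ w ▷ X₁) (b₂ w ▷ X₂) (hd₃ τ ▷ X₃) (hdK τ ▷ Y₃) ∷ out τ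

startsWithZero : ∀ {M} → Conf M → Bool
startsWithZero [] = false
startsWithZero (b ∷ _) = isZero (letter (c₁ b))

okF-inp : ∀ {t s M} (τ : Trace t s M) → T (okF s (startsWithZero (inp τ)))
okF-inp {t} (done p) = plain-okF t p
okF-inp (step w i refl X₁ _ _ _ _) = startsF i (letter (f₁ w ▷ X₁)) (fits-▷ (f₁ w) X₁)

fitsF : ∀ {t M w s} → src w ≡ s → ∀ X₁ X₂ X₃ Y₃ (τ : Trace t (tgt w) M) →
  CF.Fits s (letter (f₁ w ▷ X₁)) (letter (f₂ w ▷ X₂)) (letter (f₃ w ▷ X₃)) (letter (fK w ▷ Y₃)) (startsWithZero (inp τ)) w
fitsF {w = w} e X₁ X₂ X₃ Y₃ τ =
  e , fits-▷ (f₁ w) X₁ , fits-▷ (f₂ w) X₂ , fits-▷ (f₃ w) X₃ , fits-▷ (fK w) Y₃ , okF-inp τ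

∷-inj : ∀ {A : Set} {n} {x y : A} {xs ys : Vec A n} → (x ∷ xs) ≡ (y ∷ ys) → x ≡ y × xs ≡ ys
∷-inj refl = refl , refl

forward-unique : ∀ {t t' s M} (τ : Trace t s M) (τ' : Trace t' s M) → inp τ ≡ inp τ' →
  t ≡ t' × hd₃ τ ≡ hd₃ τ' × hdK τ ≡ hdK τ' × out τ ≡ out τ'
forward-unique (done _) (done _) _ = refl , refl , refl , refl
forward-unique {s = s} (step w i e X₁ X₂ X₃ Y₃ τ) (step w' i' e' X₁' X₂' X₃' Y₃' τ') eq =
  go w≡w' τ τ' (cong c₁ eb) (cong c₂ eb) (cong c₃ eb) (cong cK eb) (proj₂ (∷-inj eq))
  where
  eb = proj₁ (∷-inj eq)
  z = startsWithZero (inp τ)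
  L₁ = letter (f₁ w ▷ X₁)
  L₂ = letter (f₂ w ▷ X₂)
  L₃ = letter (f₃ w ▷ X₃)
  LK = letter (fK w ▷ Y₃)
  p' : CF.Fits s L₁ L₂ L₃ LK z w'
  p' = subst (λ c → CF.Fits s (letter (c₁ c)) (letter (c₂ c)) (letter (c₃ c)) (letter (cK c)) z w') (sym eb)
       (subst (λ C → CF.Fits s _ _ _ _ (startsWithZero C) w') (sym (proj₂ (∷-inj eq))) (fitsF {w = w'} e' X₁' X₂' X₃' Y₃' τ'))
  ok : T (okF s (isZero L₁))
  ok = subst (λ s → T (okF s (isZero L₁))) e (startsF i L₁ (fits-▷ (f₁ w) X₁))
  w≡w' : w ≡ w'
  w≡w' = CF.same (trueT checkedF) s L₁ L₂ L₃ LK z ok i i' (fitsF {w = w} e X₁ X₂ X₃ Y₃ τ) p'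
  go : w ≡ w' → (τ : Trace _ (tgt w) _) (τ' : Trace _ (tgt w') _) →
    f₁ w ▷ X₁ ≡ f₁ w' ▷ X₁' → f₂ w ▷ X₂ ≡ f₂ w' ▷ X₂' → f₃ w ▷ X₃ ≡ f₃ w' ▷ X₃' → fK w ▷ Y₃ ≡ fK w' ▷ Y₃' →
    inp τ ≡ inp τ' →
    _ ≡ _ × b₀ w ≡ b₀ w' × bK w ≡ bK w' ×
    blk (b₁ w ▷ X₁) (b₂ w ▷ X₂) (hd₃ τ ▷ X₃) (hdK τ ▷ Y₃) ∷ out τ
      ≡ blk (b₁ w' ▷ X₁') (b₂ w' ▷ X₂') (hd₃ τ' ▷ X₃') (hdK τ' ▷ Y₃') ∷ out τ'
  go refl τ τ' q₁ q₂ q₃ qK q with ▷-injective (f₁ w) q₁ | ▷-injective (f₂ w) q₂ | ▷-injective (f₃ w) q₃ | ▷-injective (fK w) qK | forward-unique τ τ' q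
  ... | refl | refl | refl | refl | eₜ , e₃' , eK' , eo =
    eₜ , refl , refl , cong₂ _∷_ (cong₂ (blk _ _) (cong (_▷ X₃) e₃') (cong (_▷ Y₃) eK')) eo

forward : ∀ {M} s (C : Conf M) → T (okF s (startsWithZero C)) → ∃ λ t → Σ (Trace t s M) λ τ → inp τ ≡ C
forward s [] ok = s , done (okF-plain s ok) , refl
forward s (blk C₁ C₂ C₃ CK ∷ C) ok
  with CF.choose (trueT checkedF) s (letter C₁) (letter C₂) (letter C₃) (letter CK) (startsWithZero C) ok
... | w , j , m₀ , m₁ , m₂ , m₃ , m₄ , m₅ with fits-sound (f₁ w) C₁ m₁ | fits-sound (f₂ w) C₂ m₂ | fits-sound (f₃ w) C₃ m₃ | fits-sound (fK w) CK m₄ | forward (tgt w) C m₅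
... | X₁ , refl | X₂ , refl | X₃ , refl | Y₃ , refl | t , τ , refl =
  t , step w j m₀ X₁ X₂ X₃ Y₃ τ , refl

fitsB : ∀ {w s} → tgt w ≡ s → ∀ X₀ Y₀ X₁ X₂ y → T (okB (src w) y) →
  CB.Fits s (letter (b₂ w ▷ X₂)) (letter (b₁ w ▷ X₁)) (letter (b₀ w ▷ X₀)) (letter (bK w ▷ Y₀)) y w
fitsB {w = w} e X₀ Y₀ X₁ X₂ y ok =
  e , fits-▷ (b₂ w) X₂ , fits-▷ (b₁ w) X₁ , fits-▷ (b₀ w) X₀ , fits-▷ (bK w) Y₀ , ok

backward-unique : ∀ {t s s' M} (τ : Trace t s M) (τ' : Trace t s' M) y X₀ Y₀ X₀' Y₀' →
  T (okB s y) → T (okB s' y) → hd₃ τ ▷ X₀ ≡ hd₃ τ' ▷ X₀' → hdK τ ▷ Y₀ ≡ hdK τ' ▷ Y₀' → out τ ≡ out τ' →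
  s ≡ s' × X₀ ≡ X₀' × Y₀ ≡ Y₀' × inp τ ≡ inp τ'
backward-unique {t} (done _) (done _) y X₀ Y₀ X₀' Y₀' _ _ e eK' _ = refl , ▷-injective (e₃ t) e , ▷-injective (eK t) eK' , refl
backward-unique (step w i refl X₁ X₂ X₃ Y₃ τ) (step w' i' refl X₁' X₂' X₃' Y₃' τ') y X₀ Y₀ X₀' Y₀' ok ok' e eK' eo
  with ∷-inj eo
... | eb , eo' = go w≡w' τ τ' (cong c₁ eb) (cong c₂ eb) (proj₁ (proj₂ rec)) (proj₁ (proj₂ (proj₂ rec))) (proj₂ (proj₂ (proj₂ rec))) e eK'
  where
  y' = isZero (letter (b₂ w ▷ X₂))
  rec = backward-unique τ τ' y' X₃ Y₃ X₃' Y₃'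
    (startsB i _ (fits-▷ (b₂ w) X₂))
    (subst (λ c → T (okB (tgt w') (isZero (letter (c₂ c))))) (sym eb) (startsB i' _ (fits-▷ (b₂ w') X₂')))
    (cong c₃ eb) (cong cK eb) eo'
  L₀ = letter (b₀ w ▷ X₀)
  L₁ = letter (b₁ w ▷ X₁)
  L₂ = letter (b₂ w ▷ X₂)
  LK = letter (bK w ▷ Y₀)
  p' : CB.Fits (tgt w) L₂ L₁ L₀ LK y w'
  p' = subst (λ c → CB.Fits (tgt w) (letter (c₂ c)) (letter (c₁ c)) L₀ LK y w') (sym eb)
       (subst (λ c → CB.Fits (tgt w) _ _ (letter c) LK y w') (sym e)
       (subst (λ c → CB.Fits (tgt w) _ _ _ (letter c) y w') (sym eK') (fitsB {w'} (sym (proj₁ rec)) X₀' Y₀' X₁' X₂' y ok')))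
  w≡w' : w ≡ w'
  w≡w' = CB.same (trueT checkedB) (tgt w) L₂ L₁ L₀ LK y (startsB i L₂ (fits-▷ (b₂ w) X₂)) i i' (fitsB {w} refl X₀ Y₀ X₁ X₂ y ok) p'
  go : w ≡ w' → (τ : Trace _ (tgt w) _) (τ' : Trace _ (tgt w') _) →
    b₁ w ▷ X₁ ≡ b₁ w' ▷ X₁' → b₂ w ▷ X₂ ≡ b₂ w' ▷ X₂' → X₃ ≡ X₃' → Y₃ ≡ Y₃' → inp τ ≡ inp τ' →
    b₀ w ▷ X₀ ≡ b₀ w' ▷ X₀' → bK w ▷ Y₀ ≡ bK w' ▷ Y₀' →
    src w ≡ src w' × X₀ ≡ X₀' × Y₀ ≡ Y₀' ×
    blk (f₁ w ▷ X₁) (f₂ w ▷ X₂) (f₃ w ▷ X₃) (fK w ▷ Y₃) ∷ inp τ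
      ≡ blk (f₁ w' ▷ X₁') (f₂ w' ▷ X₂') (f₃ w' ▷ X₃') (fK w' ▷ Y₃') ∷ inp τ'
  go refl τ τ' q₁ q₂ refl refl q q₀ qK with ▷-injective (b₁ w) q₁ | ▷-injective (b₂ w) q₂
  ... | refl | refl = refl , ▷-injective (b₀ w) q₀ , ▷-injective (bK w) qK , cong (_ ∷_) q

-- An inverse pass may start in any plain state at the far end only if the last block is empty: the
-- sides `e₃` and `eK` are mere lower bounds, and the empty column meets every lower bound.
LastEmpty : ∀ {M} → Block → Conf M → Set
LastEmpty b [] = b ≡ blk [] [] [] []
LastEmpty _ (b ∷ C) = LastEmpty b C

backward : ∀ {M t} → T (plain t) → (b : Block) (C : Conf M) → LastEmpty b C → ∃ λ s → Σ (Trace t s M) λ τ →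
  (∃ λ X₀ → hd₃ τ ▷ X₀ ≡ c₃ b) × (∃ λ Y₀ → hdK τ ▷ Y₀ ≡ cK b) × out τ ≡ C × T (okB s (isZero (letter (c₂ b))))
backward {t = t} pl b [] refl = t , done pl , ([] , ▷-[] (e₃ t) (e₃-pop t)) , ([] , ▷-[] (eK t) (eK-pop t)) , refl , plain-okB t pl
  where
  rest : Side → Bool
  rest any = true
  rest ge1 = true
  rest ge2 = true
  rest _ = false
  opaque
    unfolding allSt
    e₃-pop : ∀ t → T (rest (e₃ t))
    e₃-pop = allSt-sound (λ t → rest (e₃ t)) tt
    eK-pop : ∀ t → T (rest (eK t))
    eK-pop = allSt-sound (λ t → rest (eK t)) tt
  ▷-[] : ∀ S → T (rest S) → S ▷ [] ≡ []
  ▷-[] any _ = refl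
  ▷-[] ge1 _ = refl
  ▷-[] ge2 _ = refl
backward {t = t} pl (blk _ C₂ C₃ CK) (blk D₁ D₂ D₃ DK ∷ C) le
  with backward pl (blk D₁ D₂ D₃ DK) C le
... | s , τ , (X₃ , q₃) , (Y₃ , qK) , eo , ok
  with CB.choose (trueT checkedB) s (letter D₂) (letter D₁) (letter C₃) (letter CK) (isZero (letter C₂)) ok
... | w , j , m₀ , m₃ , m₂ , m₁ , m₄ , m₅ with fits-sound (b₀ w) C₃ m₁ | fits-sound (b₁ w) D₁ m₂ | fits-sound (b₂ w) D₂ m₃ | fits-sound (bK w) CK m₄ | m₀
... | X₀ , refl | X₁ , refl | X₂ , refl | Y₀ , refl | refl =
  src w , step w j refl X₁ X₂ X₃ Y₃ τ , (X₀ , refl) , (Y₀ , refl) ,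
  cong₂ _∷_ (cong₂ (blk _ _) q₃ qK) eo , m₅

fromBottom : ∀ {t s M} (τ : Trace t s (suc M)) X₀ Y₀ → letter (hd₃ τ ▷ X₀) ≡ zz → letter (hdK τ ▷ Y₀) ≡ zz →
  Σ (Trace t s0 (suc M)) λ τ' → out τ' ≡ out τ
fromBottom (step w i e X₁ X₂ X₃ Y₃ τ) X₀ Y₀ p q =
  step w i (bottomB i (subst (λ l → T (fits (b₀ w) l)) p (fits-▷ (b₀ w) X₀))
                      (subst (λ l → T (fits (bK w) l)) q (fits-▷ (bK w) Y₀))) X₁ X₂ X₃ Y₃ τ , refl

backward₀ : ∀ {M t} → T (plain t) → (b : Block) (C : Conf M) → LastEmpty b C → Σ (Trace t s0 (suc M)) λ τ → out τ ≡ b ∷ C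
-- An imaginary block below the configuration, with two coriggings 0 at length 0 of both partitions;
-- by `bottomB` the inverse pass must then arrive in `s0`.
backward₀ {M} {t} pl b C le = go (blk [] [] (0 ∷ 0 ∷ []) (0 ∷ 0 ∷ [])) refl refl
  where
  go : ∀ z → letter (c₃ z) ≡ zz → letter (cK z) ≡ zz → Σ (Trace t s0 (suc M)) λ τ → out τ ≡ b ∷ C
  go z e₁ e₂ =
    let (_ , τ , (X₀ , q₀) , (Y₀ , qK) , o , _) = backward pl z (b ∷ C) le
        (τ' , o') = fromBottom τ X₀ Y₀ (trans (cong letter q₀) e₁) (trans (cong letter qK) e₂)
    in τ' , trans o' o

bottom : ∀ {M t} (τ : Trace t s0 M) → (∃ λ X₀ → hd₃ τ ▷ X₀ ≡ 0 ∷ 0 ∷ []) × (∃ λ Y₀ → hdK τ ▷ Y₀ ≡ 0 ∷ 0 ∷ [])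
bottom (done _) = (_ , refl) , (_ , refl)
bottom (step w i e _ _ _ _ _) = fits-sound (b₀ w) _ (proj₁ (bottomF i e)) , fits-sound (bK w) _ (proj₂ (bottomF i e))

backward₀-unique : ∀ {t M} (τ τ' : Trace t s0 M) → out τ ≡ out τ' → inp τ ≡ inp τ'
backward₀-unique τ τ' e with bottom τ | bottom τ'
... | (X₀ , q) | (X₀' , q') = proj₂ (proj₂ (proj₂ (backward-unique τ τ' true (proj₁ X₀) (proj₁ q) (proj₁ X₀') (proj₁ q') tt tt
      (trans (proj₂ X₀) (sym (proj₂ X₀'))) (trans (proj₂ q) (sym (proj₂ q'))) e)))


-- Numerical data of sides and words

np pv bs : Side → ℕ
np any = 0
np ge1 = 0
np ge2 = 0
np pop0 = 1
np pop0ge1 = 1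
np pop00 = 2
np pop1 = 1
pv pop1 = 1
pv _ = 0
bs any = 0
bs ge1 = 1
bs ge2 = 2
bs pop0 = 0
bs pop0ge1 = 1
bs pop00 = 0
bs pop1 = 1

length-shift : ∀ r X → length (shift r X) ≡ length X
length-shift r [] = refl
length-shift r (x ∷ X) = refl

length-▷ : ∀ S X → length (S ▷ X) ≡ np S + length X
length-▷ any X = refl
length-▷ ge1 X = length-shift 1 X
length-▷ ge2 X = length-shift 2 X
length-▷ pop0 X = refl
length-▷ pop0ge1 X = cong suc (length-shift 1 X)
length-▷ pop00 X = refl
length-▷ pop1 X = refl

-- The sum of a column is its last corigging. Without untouched strings it is `pv`, the largest
-- corigging taken; otherwise it is counted from `bs`, the value relative to which `X` is recorded.
sum-▷-[] : ∀ S → sum (S ▷ []) ≡ pv S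
sum-▷-[] any = refl
sum-▷-[] ge1 = refl
sum-▷-[] ge2 = refl
sum-▷-[] pop0 = refl
sum-▷-[] pop0ge1 = refl
sum-▷-[] pop00 = refl
sum-▷-[] pop1 = refl

sum-▷-∷ : ∀ S x X → sum (S ▷ x ∷ X) ≡ bs S + sum (x ∷ X)
sum-▷-∷ any x X = refl
sum-▷-∷ ge1 x X = refl
sum-▷-∷ ge2 x X = refl
sum-▷-∷ pop0 x X = refl
sum-▷-∷ pop0ge1 x X = refl
sum-▷-∷ pop00 x X = refl
sum-▷-∷ pop1 x X = refl

gS hS st : St → ℕ
gS s = g (RS s) (3 * QS s)
hS s = h (RS s) (3 * QS s)
st s* = 1
st _ = 0

G₁ G₂ H₁ H₂ : Word → ℕ
G₁ w = g (r₁ w) (x₁ w)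
G₂ w = g (r₂ w) (x₂ w)
H₁ w = h (r₁ w) (x₁ w)
H₂ w = h (r₂ w) (x₂ w)

eqn : (l r : Word → ℕ) {ws : List Word} → all∈ (λ w → l w ≡ᵇ r w) ws ≡ true → ∀ {w} → w ∈ ws → l w ≡ r w
eqn l r c {w} i = ≡ᵇ⇒≡ (l w) (r w) (all∈-sound (λ w → l w ≡ᵇ r w) (trueT c) i)

leq : (l r : Word → ℕ) {ws : List Word} → all∈ (λ w → l w ≤ᵇ r w) ws ≡ true → ∀ {w} → w ∈ ws → l w N.≤ r w
leq l r c {w} i = ≤ᵇ⇒≤ (l w) (r w) (all∈-sound (λ w → l w ≤ᵇ r w) (trueT c) i)

eqnSt : (l r : St → ℕ) → allSt (λ s → l s ≡ᵇ r s) ≡ true → ∀ s → l s ≡ r s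
eqnSt l r c s = ≡ᵇ⇒≡ (l s) (r s) (allSt-sound (λ s → l s ≡ᵇ r s) (trueT c) s)

leqSt : (l r : St → ℕ) → allSt (λ s → l s ≤ᵇ r s) ≡ true → ∀ s → l s N.≤ r s
leqSt l r c s = ≤ᵇ⇒≤ (l s) (r s) (allSt-sound (λ s → l s ≤ᵇ r s) (trueT c) s)

opaque
  unfolding words allSt

  np₁ : ∀ {w} → w ∈ words → np (f₁ w) + δ₂ w ≡ np (b₁ w) + δ₁ w
  np₁ = eqn (λ w → np (f₁ w) + δ₂ w) (λ w → np (b₁ w) + δ₁ w) {words} refl
  np₂ : ∀ {w} → w ∈ words → np (f₂ w) + δ₃ w ≡ np (b₂ w) + δ₂ w
  np₂ = eqn (λ w → np (f₂ w) + δ₃ w) (λ w → np (b₂ w) + δ₂ w) {words} refl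
  np₃ : ∀ {w} → w ∈ words → np (f₃ w) + st (tgt w) ≡ δ₃ w
  np₃ = eqn (λ w → np (f₃ w) + st (tgt w)) δ₃ {words} refl
  np₀ : ∀ {w} → w ∈ words → np (b₀ w) + st (src w) ≡ δ₁ w
  np₀ = eqn (λ w → np (b₀ w) + st (src w)) δ₁ {words} refl
  np-fK : ∀ {w} → w ∈ words → np (fK w) ≡ a w
  np-fK = eqn (λ w → np (fK w)) a {words} refl
  np-bK : ∀ {w} → w ∈ words → np (bK w) ≡ a w
  np-bK = eqn (λ w → np (bK w)) a {words} refl

  -- The drop of the vacancy number is g - h = 1 + x - 2r; from one column to the next, x grows by a
  -- and r by δ. For ν⁽²⁾ the drop is `RS` - 2 `QS`, which gives `ghK`.
  gh₁ : ∀ {w} → w ∈ words → G₁ w + hS (src w) + (δ₁ w + δ₁ w) ≡ H₁ w + gS (src w) + a w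
  gh₁ = eqn (λ w → G₁ w + hS (src w) + (δ₁ w + δ₁ w)) (λ w → H₁ w + gS (src w) + a w) {words} refl
  gh₂ : ∀ {w} → w ∈ words → G₂ w + H₁ w + (δ₂ w + δ₂ w) ≡ H₂ w + G₁ w + a w
  gh₂ = eqn (λ w → G₂ w + H₁ w + (δ₂ w + δ₂ w)) (λ w → H₂ w + G₁ w + a w) {words} refl
  gh₃ : ∀ {w} → w ∈ words → gS (tgt w) + H₂ w + (δ₃ w + δ₃ w) ≡ hS (tgt w) + G₂ w + a w
  gh₃ = eqn (λ w → gS (tgt w) + H₂ w + (δ₃ w + δ₃ w)) (λ w → hS (tgt w) + G₂ w + a w) {words} refl
  ghK : ∀ {w} → w ∈ words → gK (tgt w) + hK (src w) + (a w + a w) ≡ hK (tgt w) + gK (src w) + (δ₁ w + (δ₂ w + δ₃ w))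
  ghK = eqn (λ w → gK (tgt w) + hK (src w) + (a w + a w)) (λ w → hK (tgt w) + gK (src w) + (δ₁ w + (δ₂ w + δ₃ w))) {words} refl

  bs-f₁ : ∀ {w} → w ∈ words → bs (f₁ w) ≡ G₁ w
  bs-f₁ = eqn (λ w → bs (f₁ w)) G₁ {words} refl
  bs-b₁ : ∀ {w} → w ∈ words → bs (b₁ w) ≡ H₁ w
  bs-b₁ = eqn (λ w → bs (b₁ w)) H₁ {words} refl
  bs-f₂ : ∀ {w} → w ∈ words → bs (f₂ w) ≡ G₂ w
  bs-f₂ = eqn (λ w → bs (f₂ w)) G₂ {words} refl
  bs-b₂ : ∀ {w} → w ∈ words → bs (b₂ w) ≡ H₂ w
  bs-b₂ = eqn (λ w → bs (b₂ w)) H₂ {words} refl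
  bs-f₃ : ∀ {w} → w ∈ words → bs (f₃ w) ≡ gS (tgt w) + st (tgt w)
  bs-f₃ = eqn (λ w → bs (f₃ w)) (λ w → gS (tgt w) + st (tgt w)) {words} refl
  bs-b₀ : ∀ {w} → w ∈ words → bs (b₀ w) ≡ hS (src w) + st (src w)
  bs-b₀ = eqn (λ w → bs (b₀ w)) (λ w → hS (src w) + st (src w)) {words} refl
  bs-fK : ∀ {w} → w ∈ words → bs (fK w) ≡ gK (tgt w)
  bs-fK = eqn (λ w → bs (fK w)) (λ w → gK (tgt w)) {words} refl
  bs-bK : ∀ {w} → w ∈ words → bs (bK w) ≡ hK (src w)
  bs-bK = eqn (λ w → bs (bK w)) (λ w → hK (src w)) {words} refl

  pv-f₁ : ∀ {w} → w ∈ words → pv (f₁ w) N.≤ G₁ w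
  pv-f₁ = leq (λ w → pv (f₁ w)) G₁ {words} refl
  pv-b₁ : ∀ {w} → w ∈ words → pv (b₁ w) N.≤ H₁ w
  pv-b₁ = leq (λ w → pv (b₁ w)) H₁ {words} refl
  pv-f₂ : ∀ {w} → w ∈ words → pv (f₂ w) N.≤ G₂ w
  pv-f₂ = leq (λ w → pv (f₂ w)) G₂ {words} refl
  pv-b₂ : ∀ {w} → w ∈ words → pv (b₂ w) N.≤ H₂ w
  pv-b₂ = leq (λ w → pv (b₂ w)) H₂ {words} refl
  pv-f₃ : ∀ {w} → w ∈ words → pv (f₃ w) N.≤ gS (tgt w)
  pv-f₃ = leq (λ w → pv (f₃ w)) (λ w → gS (tgt w)) {words} refl
  pv-b₀ : ∀ {w} → w ∈ words → pv (b₀ w) N.≤ hS (src w)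
  pv-b₀ = leq (λ w → pv (b₀ w)) (λ w → hS (src w)) {words} refl
  pv-fK : ∀ {w} → w ∈ words → pv (fK w) N.≤ gK (tgt w)
  pv-fK = leq (λ w → pv (fK w)) (λ w → gK (tgt w)) {words} refl
  pv-bK : ∀ {w} → w ∈ words → pv (bK w) N.≤ hK (src w)
  pv-bK = leq (λ w → pv (bK w)) (λ w → hK (src w)) {words} refl

  np-e₃ : ∀ s → np (e₃ s) ≡ 0
  np-e₃ = eqnSt (λ s → np (e₃ s)) (λ _ → 0) refl
  np-eK : ∀ s → np (eK s) ≡ 0
  np-eK = eqnSt (λ s → np (eK s)) (λ _ → 0) refl
  bs-e₃ : ∀ s → bs (e₃ s) ≡ hS s
  bs-e₃ = eqnSt (λ s → bs (e₃ s)) hS refl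
  bs-eK : ∀ s → bs (eK s) ≡ hK s
  bs-eK = eqnSt (λ s → bs (eK s)) hK refl
  pv-e₃ : ∀ s → pv (e₃ s) N.≤ hS s
  pv-e₃ = leqSt (λ s → pv (e₃ s)) hS refl
  pv-eK : ∀ s → pv (eK s) N.≤ hK s
  pv-eK = leqSt (λ s → pv (eK s)) hK refl

st-plain : ∀ s → T (plain s) → st s ≡ 0
st-plain s0 _ = refl
st-plain s1 _ = refl
st-plain s2 _ = refl
st-plain s3 _ = refl
st-plain s4 _ = refl
st-plain s5 _ = refl
st-plain s6 _ = refl

dτ aτ : ∀ {t s M} → Trace t s M → ℕ
dτ (done _) = 0
dτ (step w _ _ _ _ _ _ _) = δ₁ w
aτ (done _) = 0
aτ (step w _ _ _ _ _ _ _) = a w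

np-hd₃ : ∀ {t s M} (τ : Trace t s M) → np (hd₃ τ) + st s ≡ dτ τ
np-hd₃ {t} (done p) = cong₂ _+_ (np-e₃ t) (st-plain t p)
np-hd₃ (step w i refl _ _ _ _ _) = np₀ i

np-hdK : ∀ {t s M} (τ : Trace t s M) → np (hdK τ) ≡ aτ τ
np-hdK {t} (done p) = np-eK t
np-hdK (step w i refl _ _ _ _ _) = np-bK i

bs-hd₃ : ∀ {t s M} (τ : Trace t s M) → bs (hd₃ τ) ≡ hS s + st s
bs-hd₃ {t} (done p) = trans (bs-e₃ t) (trans (sym (NP.+-identityʳ (hS t))) (cong (hS t N.+_) (sym (st-plain t p))))
bs-hd₃ (step w i refl _ _ _ _ _) = bs-b₀ i

bs-hdK : ∀ {t s M} (τ : Trace t s M) → bs (hdK τ) ≡ hK s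
bs-hdK {t} (done p) = bs-eK t
bs-hdK (step w i refl _ _ _ _ _) = bs-bK i

pv-hd₃ : ∀ {t s M} (τ : Trace t s M) → pv (hd₃ τ) N.≤ hS s
pv-hd₃ {t} (done p) = pv-e₃ t
pv-hd₃ (step w i refl _ _ _ _ _) = pv-b₀ i

pv-hdK : ∀ {t s M} (τ : Trace t s M) → pv (hdK τ) N.≤ hK s
pv-hdK {t} (done p) = pv-eK t
pv-hdK (step w i refl _ _ _ _ _) = pv-bK i

-- Numbers of strings

#₁ #K : ∀ {M} → Conf M → ℕ
#₁ [] = 0
#₁ (b ∷ C) = length (c₁ b) + (length (c₂ b) + (length (c₃ b) + #₁ C))
#K [] = 0
#K (b ∷ C) = length (cK b) + #K C

lemma₃ : ∀ np nq s d e x n m → np + s ≡ d → nq + s ≡ e → n ≡ m + e → np + x + n ≡ (nq + x + m) + d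
lemma₃ np nq s _ _ x _ m refl refl refl = eq np nq s x m
  where
  eq : ∀ np nq s x m → np + x + (m + (nq + s)) ≡ (nq + x + m) + (np + s)
  eq = NR.solve-∀

lemma₁ : ∀ np nq d e x n m → np + e ≡ nq + d → n ≡ m + e → np + x + n ≡ (nq + x + m) + d
lemma₁ np nq d e x _ m p refl = trans (eq₁ np x m e) (trans (cong (λ k → k + (x + m)) p) (eq₂ nq x m d))
  where
  eq₁ : ∀ np x m e → np + x + (m + e) ≡ np + e + (x + m)
  eq₁ = NR.solve-∀
  eq₂ : ∀ nq x m d → nq + d + (x + m) ≡ (nq + x + m) + d
  eq₂ = NR.solve-∀

count₃ : ∀ {t M} {w : Word} → w ∈ words → (X₃ : Column) (τ : Trace t (tgt w) M) → #₁ (inp τ) ≡ #₁ (out τ) + dτ τ →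
  length (f₃ w ▷ X₃) + #₁ (inp τ) ≡ (length (hd₃ τ ▷ X₃) + #₁ (out τ)) + δ₃ w
count₃ {w = w} i X₃ τ e rewrite length-▷ (f₃ w) X₃ | length-▷ (hd₃ τ) X₃ =
  lemma₃ (np (f₃ w)) (np (hd₃ τ)) (st (tgt w)) (δ₃ w) (dτ τ) (length X₃) _ _ (np₃ i) (np-hd₃ τ) e

count₂ : ∀ {w : Word} → w ∈ words → (X₂ : Column) {n m : ℕ} → n ≡ m + δ₃ w →
  length (f₂ w ▷ X₂) + n ≡ (length (b₂ w ▷ X₂) + m) + δ₂ w
count₂ {w} i X₂ e rewrite length-▷ (f₂ w) X₂ | length-▷ (b₂ w) X₂ =
  lemma₁ (np (f₂ w)) (np (b₂ w)) (δ₂ w) (δ₃ w) (length X₂) _ _ (np₂ i) e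

count₁ : ∀ {w : Word} → w ∈ words → (X₁ : Column) {n m : ℕ} → n ≡ m + δ₂ w →
  length (f₁ w ▷ X₁) + n ≡ (length (b₁ w ▷ X₁) + m) + δ₁ w
count₁ {w} i X₁ e rewrite length-▷ (f₁ w) X₁ | length-▷ (b₁ w) X₁ =
  lemma₁ (np (f₁ w)) (np (b₁ w)) (δ₁ w) (δ₂ w) (length X₁) _ _ (np₁ i) e

#₁-out : ∀ {t s M} (τ : Trace t s M) → #₁ (inp τ) ≡ #₁ (out τ) + dτ τ
#₁-out (done _) = refl
#₁-out (step w i refl X₁ X₂ X₃ Y₃ τ) = count₁ i X₁ (count₂ i X₂ (count₃ i X₃ τ (#₁-out τ)))

#K-out : ∀ {t s M} (τ : Trace t s M) → #K (inp τ) ≡ #K (out τ) + aτ τ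
#K-out (done _) = refl
#K-out (step w i refl X₁ X₂ X₃ Y₃ τ) rewrite length-▷ (fK w) Y₃ | length-▷ (hdK τ) Y₃ | np-fK i | np-hdK τ =
  trans (cong (λ k → a w + length Y₃ + k) (#K-out τ)) (eq (a w) (length Y₃) (#K (out τ)) (aτ τ))
  where
  eq : ∀ a y m b → a + y + (m + b) ≡ b + y + m + a
  eq = NR.solve-∀

-- Vacancy numbers and highest weight configurations

dn : ℤ → ℕ → ℕ → ℤ
dn p n N = p - + (n + n) ⊕ + N

-- The vacancy numbers are computed by their increments, which involve only the numbers of strings
-- at least as long as the length in question. All three lengths of a block see the same number
-- `NK`, since a string y of ν⁽²⁾ enters as one of length 3y.
module Vac (b : Block) (n N : ℕ) where
  NK m₁ m₂ m₃ : ℕ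
  NK = length (cK b) + N
  m₃ = length (c₃ b) + n
  m₂ = length (c₂ b) + m₃
  m₁ = length (c₁ b) + m₂
  v₁ v₂ v₃ vK : ℤ → ℤ
  v₁ p = dn p m₁ NK
  v₂ p = dn (v₁ p) m₂ NK
  v₃ p = dn (v₂ p) m₃ NK
  vK P = P ⊕ + (m₁ + (m₂ + m₃)) - + (NK + NK)

-- All riggings are nonnegative: the last corigging of a column is the sum of its
-- differences.  For an empty column this says that the vacancy number is.
HW : ∀ {M} → ℤ → ℤ → Conf M → ℤ → ℤ → Set
HW p P [] l₁ l₂ = p ≡ l₁ × P ≡ l₂
HW p P (b ∷ C) l₁ l₂ =
  (+ sum (c₁ b) ≤ᶻ v₁ p) × (+ sum (c₂ b) ≤ᶻ v₂ p) × (+ sum (c₃ b) ≤ᶻ v₃ p) × (+ sum (cK b) ≤ᶻ vK P) × HW (v₃ p) (vK P) C l₁ l₂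
  where open Vac b (#₁ C) (#K C)

≤-via : ∀ {x y} d → 0ℤ ≤ᶻ d → y - x ≡ d → x ≤ᶻ y
≤-via d p e = 0≤i-j⇒j≤i (subst (0ℤ ≤ᶻ_) (sym e) p)

-- p' + g ≡ p + h says that p' is the vacancy number p after the pass.
≤-move : ∀ {p p' : ℤ} {g h : ℕ} → p' ⊕ + g ≡ p ⊕ + h → + g ≤ᶻ p → + h ≤ᶻ p'
≤-move {p} {p'} {g} {h} e q = ≤-via (p - + g) (i≤j⇒0≤j-i q) (trans (eq₁ p' (+ g) (+ h)) (trans (cong (λ x → x - (+ g ⊕ + h)) e) (eq₂ p (+ g) (+ h))))
  where
  eq₁ : ∀ p' g h → p' - h ≡ (p' ⊕ g) - (g ⊕ h)
  eq₁ = ZR.solve-∀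
  eq₂ : ∀ p g h → (p ⊕ h) - (g ⊕ h) ≡ p - g
  eq₂ = ZR.solve-∀

-- Untouched strings keep their riggings, because the vacancy number and the base of their
-- coriggings both change by h - g. If there are none, the bound must come from the room g ≤ p,
-- which turns into h ≤ p' and dominates the strings pushed back.
transfer : ∀ S S' X {p p' : ℤ} {g h s : ℕ} → p' ⊕ + g ≡ p ⊕ + h → + g ≤ᶻ p →
  bs S ≡ g + s → bs S' ≡ h + s → pv S' N.≤ h → + sum (S ▷ X) ≤ᶻ p → + sum (S' ▷ X) ≤ᶻ p'
transfer S S' [] {h = h} e q _ _ pv≤ _ = ZP.≤-trans (+≤+ (subst (N._≤ h) (sym (sum-▷-[] S')) pv≤)) (≤-move e q)
transfer S S' (x ∷ X) {p} {p'} {g} {h} {s} e q bS bS' _ q' =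
  subst (λ k → + k ≤ᶻ p') (sym (trans (sum-▷-∷ S' x X) (cong (_+ k) bS')))
    (≤-via (p - (+ g ⊕ + s ⊕ + k)) (i≤j⇒0≤j-i (subst (λ k → + k ≤ᶻ p) (trans (sum-▷-∷ S x X) (cong (_+ k) bS)) q'))
      (trans (eq₁ p' (+ g) (+ h) (+ s) (+ k)) (trans (cong (λ y → y - (+ g ⊕ + h ⊕ + s ⊕ + k)) e) (eq₂ p (+ g) (+ h) (+ s) (+ k)))))
  where
  k = sum (x ∷ X)
  eq₁ : ∀ p' g h s k → p' - (h ⊕ s ⊕ k) ≡ (p' ⊕ g) - (g ⊕ h ⊕ s ⊕ k)
  eq₁ = ZR.solve-∀
  eq₂ : ∀ p g h s k → (p ⊕ h) - (g ⊕ h ⊕ s ⊕ k) ≡ p - (g ⊕ s ⊕ k)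
  eq₂ = ZR.solve-∀


≡-via : ∀ {x y : ℤ} → x - y ≡ 0ℤ → x ≡ y
≡-via {x} {y} e = ZP.i-j≡0⇒i≡j x y e

vmove : ∀ (p p' : ℤ) (g h G H δ a n n' N N' : ℕ) → p' ⊕ + g ≡ p ⊕ + h → n ≡ n' + δ → N ≡ N' + a →
  G + h + (δ + δ) ≡ H + g + a → dn p' n' N' ⊕ + G ≡ dn p n N ⊕ + H
vmove p p' g h G H δ a _ n' _ N' e refl refl e' = ≡-via
  (trans (eq p p' (+ g) (+ h) (+ G) (+ H) (+ δ) (+ a) (+ n') (+ N'))
  (cong₂ _⊕_ (ZP.i≡j⇒i-j≡0 e) (ZP.i≡j⇒i-j≡0 (cong +_ e'))))
  where
  eq : ∀ p p' g h G H δ a n' N' →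
    (p' - (n' ⊕ n') ⊕ N' ⊕ G) - (p - ((n' ⊕ δ) ⊕ (n' ⊕ δ)) ⊕ (N' ⊕ a) ⊕ H)
    ≡ ((p' ⊕ g) - (p ⊕ h)) ⊕ ((G ⊕ h ⊕ (δ ⊕ δ)) - (H ⊕ g ⊕ a))
  eq = ZR.solve-∀

vmoveK : ∀ (P P' : ℤ) (g h G H δ₁ δ₂ δ₃ a n₁ n₂ n₃ n₁' n₂' n₃' N N' : ℕ) → P' ⊕ + g ≡ P ⊕ + h →
  n₁ ≡ n₁' + δ₁ → n₂ ≡ n₂' + δ₂ → n₃ ≡ n₃' + δ₃ → N ≡ N' + a → G + h + (a + a) ≡ H + g + (δ₁ + (δ₂ + δ₃)) →
  (P' ⊕ + (n₁' + (n₂' + n₃')) - + (N' + N')) ⊕ + G ≡ (P ⊕ + (n₁ + (n₂ + n₃)) - + (N + N)) ⊕ + H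
vmoveK P P' g h G H δ₁ δ₂ δ₃ a _ _ _ n₁' n₂' n₃' _ N' e refl refl refl refl e' = ≡-via
  (trans (eq P P' (+ g) (+ h) (+ G) (+ H) (+ δ₁) (+ δ₂) (+ δ₃) (+ a) (+ n₁') (+ n₂') (+ n₃') (+ N'))
  (cong₂ _⊕_ (ZP.i≡j⇒i-j≡0 e) (ZP.i≡j⇒i-j≡0 (cong +_ e'))))
  where
  eq : ∀ P P' g h G H δ₁ δ₂ δ₃ a n₁' n₂' n₃' N' →
    ((P' ⊕ (n₁' ⊕ (n₂' ⊕ n₃')) - (N' ⊕ N')) ⊕ G)
      - ((P ⊕ ((n₁' ⊕ δ₁) ⊕ ((n₂' ⊕ δ₂) ⊕ (n₃' ⊕ δ₃))) - ((N' ⊕ a) ⊕ (N' ⊕ a))) ⊕ H)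
    ≡ ((P' ⊕ g) - (P ⊕ h)) ⊕ ((G ⊕ h ⊕ (a ⊕ a)) - (H ⊕ g ⊕ (δ₁ ⊕ (δ₂ ⊕ δ₃))))
  eq = ZR.solve-∀

module Crossing {t M} (w : Word) (i : w ∈ words) (X₁ X₂ X₃ Y₃ : Column) (τ : Trace t (tgt w) M) where
  module I = Vac (blk (f₁ w ▷ X₁) (f₂ w ▷ X₂) (f₃ w ▷ X₃) (fK w ▷ Y₃)) (#₁ (inp τ)) (#K (inp τ))
  module O = Vac (blk (b₁ w ▷ X₁) (b₂ w ▷ X₂) (hd₃ τ ▷ X₃) (hdK τ ▷ Y₃)) (#₁ (out τ)) (#K (out τ))

  n₃ : I.m₃ ≡ O.m₃ + δ₃ w
  n₃ = count₃ i X₃ τ (#₁-out τ)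
  n₂ : I.m₂ ≡ O.m₂ + δ₂ w
  n₂ = count₂ i X₂ n₃
  n₁ : I.m₁ ≡ O.m₁ + δ₁ w
  n₁ = count₁ i X₁ n₂
  nK : I.NK ≡ O.NK + a w
  nK = #K-out (step w i refl X₁ X₂ X₃ Y₃ τ)

  module _ {p p' : ℤ} (e : p' ⊕ + gS (src w) ≡ p ⊕ + hS (src w)) where
    rel₁ : O.v₁ p' ⊕ + G₁ w ≡ I.v₁ p ⊕ + H₁ w
    rel₁ = vmove p p' (gS (src w)) (hS (src w)) (G₁ w) (H₁ w) (δ₁ w) (a w) I.m₁ O.m₁ I.NK O.NK e n₁ nK (gh₁ i)
    rel₂ : O.v₂ p' ⊕ + G₂ w ≡ I.v₂ p ⊕ + H₂ w
    rel₂ = vmove (I.v₁ p) (O.v₁ p') (G₁ w) (H₁ w) (G₂ w) (H₂ w) (δ₂ w) (a w) I.m₂ O.m₂ I.NK O.NK rel₁ n₂ nK (gh₂ i)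
    rel₃ : O.v₃ p' ⊕ + gS (tgt w) ≡ I.v₃ p ⊕ + hS (tgt w)
    rel₃ = vmove (I.v₂ p) (O.v₂ p') (G₂ w) (H₂ w) (gS (tgt w)) (hS (tgt w)) (δ₃ w) (a w) I.m₃ O.m₃ I.NK O.NK rel₂ n₃ nK (gh₃ i)

  relK : ∀ {P P' : ℤ} → P' ⊕ + gK (src w) ≡ P ⊕ + hK (src w) → O.vK P' ⊕ + gK (tgt w) ≡ I.vK P ⊕ + hK (tgt w)
  relK {P} {P'} e = vmoveK P P' (gK (src w)) (hK (src w)) (gK (tgt w)) (hK (tgt w)) (δ₁ w) (δ₂ w) (δ₃ w) (a w) I.m₁ I.m₂ I.m₃ O.m₁ O.m₂ O.m₃ I.NK O.NK e n₁ n₂ n₃ nK (ghK i)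

-- The two versions of the statement that every column leaves room for the pass.
RoomI RoomO : ∀ {t s M} → Trace t s M → ℤ → ℤ → Set
RoomI {t} (done _) p P = (+ gS t ≤ᶻ p) × (+ gK t ≤ᶻ P)
RoomI (step w i _ X₁ X₂ X₃ Y₃ τ) p P =
  (+ G₁ w ≤ᶻ I.v₁ p) × (+ G₂ w ≤ᶻ I.v₂ p) × (+ gS (tgt w) ≤ᶻ I.v₃ p) × (+ gK (tgt w) ≤ᶻ I.vK P) × RoomI τ (I.v₃ p) (I.vK P)
  where open Crossing w i X₁ X₂ X₃ Y₃ τ
RoomO {t} (done _) p P = (+ hS t ≤ᶻ p) × (+ hK t ≤ᶻ P)
RoomO (step w i _ X₁ X₂ X₃ Y₃ τ) p P =
  (+ H₁ w ≤ᶻ O.v₁ p) × (+ H₂ w ≤ᶻ O.v₂ p) × (+ hS (tgt w) ≤ᶻ O.v₃ p) × (+ hK (tgt w) ≤ᶻ O.vK P) × RoomO τ (O.v₃ p) (O.vK P)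
  where open Crossing w i X₁ X₂ X₃ Y₃ τ

⊕-cancel : ∀ {x y : ℤ} z → x ⊕ z ≡ y ⊕ z → x ≡ y
⊕-cancel {x} {y} z e = ≡-via (trans (eq x y z) (ZP.i≡j⇒i-j≡0 e))
  where
  eq : ∀ x y z → x - y ≡ (x ⊕ z) - (y ⊕ z)
  eq = ZR.solve-∀

+0 : ∀ {m n} → m ≡ n → m ≡ n + 0
+0 {n = n} e = trans e (sym (NP.+-identityʳ n))

module _ {t : St} where

  HW-out : ∀ {s M} (τ : Trace t s M) {p p' P P' l₁ l₂ l₁' l₂' : ℤ} →
    p' ⊕ + gS s ≡ p ⊕ + hS s → P' ⊕ + gK s ≡ P ⊕ + hK s → l₁' ⊕ + gS t ≡ l₁ ⊕ + hS t → l₂' ⊕ + gK t ≡ l₂ ⊕ + hK t →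
    RoomI τ p P → HW p P (inp τ) l₁ l₂ → HW p' P' (out τ) l₁' l₂' × (+ hS t ≤ᶻ l₁') × (+ hK t ≤ᶻ l₂')
  HW-out (done _) e eK eₗ eₗ' (q , q') (refl , refl) =
    (⊕-cancel (+ gS t) (trans e (sym eₗ)) , ⊕-cancel (+ gK t) (trans eK (sym eₗ'))) , ≤-move eₗ q , ≤-move eₗ' q'
  HW-out (step w i refl X₁ X₂ X₃ Y₃ τ) {p} {p'} {P} {P'} e eK eₗ eₗ' (q₁ , q₂ , q₃ , qK , room) (c₁ , c₂ , c₃ , cK , hw) =
    (transfer (f₁ w) (b₁ w) X₁ (rel₁ {p} {p'} e) q₁ (+0 (bs-f₁ i)) (+0 (bs-b₁ i)) (pv-b₁ i) c₁ ,
     transfer (f₂ w) (b₂ w) X₂ (rel₂ {p} {p'} e) q₂ (+0 (bs-f₂ i)) (+0 (bs-b₂ i)) (pv-b₂ i) c₂ ,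
     transfer (f₃ w) (hd₃ τ) X₃ (rel₃ {p} {p'} e) q₃ (bs-f₃ i) (bs-hd₃ τ) (pv-hd₃ τ) c₃ ,
     transfer (fK w) (hdK τ) Y₃ (relK {P} {P'} eK) qK (+0 (bs-fK i)) (+0 (bs-hdK τ)) (pv-hdK τ) cK ,
     proj₁ rec) , proj₂ rec
    where
    open Crossing w i X₁ X₂ X₃ Y₃ τ
    rec = HW-out τ (rel₃ {p} {p'} e) (relK {P} {P'} eK) eₗ eₗ' room hw

  HW-inp : ∀ {s M} (τ : Trace t s M) {p p' P P' l₁ l₂ l₁' l₂' : ℤ} →
    p' ⊕ + gS s ≡ p ⊕ + hS s → P' ⊕ + gK s ≡ P ⊕ + hK s → l₁' ⊕ + gS t ≡ l₁ ⊕ + hS t → l₂' ⊕ + gK t ≡ l₂ ⊕ + hK t →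
    RoomO τ p' P' → HW p' P' (out τ) l₁' l₂' → HW p P (inp τ) l₁ l₂
  HW-inp (done _) e eK eₗ eₗ' _ (refl , refl) =
    ⊕-cancel (+ hS t) (trans (sym e) eₗ) , ⊕-cancel (+ hK t) (trans (sym eK) eₗ')
  HW-inp (step w i refl X₁ X₂ X₃ Y₃ τ) {p} {p'} {P} {P'} e eK eₗ eₗ' (q₁ , q₂ , q₃ , qK , room) (c₁ , c₂ , c₃ , cK , hw) =
    transfer (b₁ w) (f₁ w) X₁ (sym (rel₁ {p} {p'} e)) q₁ (+0 (bs-b₁ i)) (+0 (bs-f₁ i)) (pv-f₁ i) c₁ ,
    transfer (b₂ w) (f₂ w) X₂ (sym (rel₂ {p} {p'} e)) q₂ (+0 (bs-b₂ i)) (+0 (bs-f₂ i)) (pv-f₂ i) c₂ ,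
    transfer (hd₃ τ) (f₃ w) X₃ (sym (rel₃ {p} {p'} e)) q₃ (bs-hd₃ τ) (bs-f₃ i) (pv-f₃ i) c₃ ,
    transfer (hdK τ) (fK w) Y₃ (sym (relK {P} {P'} eK)) qK (+0 (bs-hdK τ)) (+0 (bs-fK i)) (pv-fK i) cK ,
    HW-inp τ (rel₃ {p} {p'} e) (relK {P} {P'} eK) eₗ eₗ' room hw
    where
    open Crossing w i X₁ X₂ X₃ Y₃ τ


-- A discrete minimum principle

Entry : Set
Entry = ℤ × ℕ

Positive Small : List Entry → Set
Positive = All (λ e → 0ℤ ≤ᶻ proj₁ e)
Small = All (λ e → proj₂ e N.≤ 1)

-- Concavity at u up to a correction by the tags.
Bent : (a u v : ℤ) (ρ ρ' : ℕ) → Set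
Bent a u v ρ ρ' = 0ℤ ≤ᶻ (u ⊕ u) - a - v ⊕ (+ ρ - + ρ')

0≤⊕ : ∀ {x y} → 0ℤ ≤ᶻ x → 0ℤ ≤ᶻ y → 0ℤ ≤ᶻ x ⊕ y
0≤⊕ = ZP.+-mono-≤

negative : ∀ {x} → 0ℤ ≤ᶻ x → 0ℤ ≤ᶻ - + 1 - x → ⊥
negative {x} p q with subst (0ℤ ≤ᶻ_) (eq x) (0≤⊕ p q)
  where
  eq : ∀ x → x ⊕ (- + 1 - x) ≡ - + 1
  eq = ZR.solve-∀
... | ()

sign : ∀ x → (0ℤ ≤ᶻ x) ⊎ (0ℤ ≤ᶻ - + 1 - x)
sign (+ n) = inj₁ (+≤+ z≤n)
sign (Z.-[1+ zero ]) = inj₂ (+≤+ z≤n)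
sign (Z.-[1+ suc n ]) = inj₂ (+≤+ z≤n)

Concave : ℤ → List Entry → Set
Concave a [] = ⊤
Concave a ((u , ρ) ∷ []) = (0ℤ ≤ᶻ u) ⊎ (+ 1 ≤ᶻ u - a ⊕ + ρ)
Concave a ((u , ρ) ∷ (v , ρ') ∷ es) = ((0ℤ ≤ᶻ u) ⊎ Bent a u v ρ ρ') × Concave u ((v , ρ') ∷ es)

-- A negative value reached by a descent of at least its tag is followed by another one: in `Bent`
-- the old tag cancels and the new one takes its place. The clause of `Concave` for the last entry
-- rules out such a descent.
falling : ∀ a u ρ es → 0ℤ ≤ᶻ - + 1 - u → 0ℤ ≤ᶻ a - u - + ρ → Concave a ((u , ρ) ∷ es) → ⊥
falling a u ρ [] n s (inj₁ p) = negative p n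
falling a u ρ [] n s (inj₂ p) with subst (0ℤ ≤ᶻ_) (eq a u (+ ρ)) (0≤⊕ s (i≤j⇒0≤j-i p))
  where
  eq : ∀ a u ρ → (a - u - ρ) ⊕ ((u - a ⊕ ρ) - + 1) ≡ - + 1
  eq = ZR.solve-∀
... | ()
falling a u ρ ((v , ρ') ∷ es) n s (inj₁ p , _) = negative p n
falling a u ρ ((v , ρ') ∷ es) n s (inj₂ b , c) = falling u v ρ' es
  (subst (0ℤ ≤ᶻ_) (eq₂ u v (+ ρ')) (0≤⊕ (0≤⊕ n s') (+≤+ z≤n))) s' c
  where
  eq₁ : ∀ a u v ρ ρ' → (a - u - ρ) ⊕ ((u ⊕ u) - a - v ⊕ (ρ - ρ')) ≡ u - v - ρ'
  eq₁ = ZR.solve-∀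
  s' = subst (0ℤ ≤ᶻ_) (eq₁ a u v (+ ρ) (+ ρ')) (0≤⊕ s b)
  eq₂ : ∀ u v ρ' → ((- + 1 - u) ⊕ (u - v - ρ')) ⊕ ρ' ≡ - + 1 - v
  eq₂ = ZR.solve-∀

drop≤ : ∀ {ρ} → ρ N.≤ 1 → 0ℤ ≤ᶻ + 1 - + ρ
drop≤ p = i≤j⇒0≤j-i (+≤+ p)

concave-positive : ∀ a es → 0ℤ ≤ᶻ a → Small es → Concave a es → Positive es
concave-positive a [] _ _ _ = []
concave-positive a ((u , ρ) ∷ es) pa (r ∷ rs) c with sign u
-- At the first negative value the descent from a ≥ 0 to u ≤ -1 is at least 1, which covers any tag.
... | inj₂ n = ⊥-elim (falling a u ρ es n (subst (0ℤ ≤ᶻ_) (eq a u (+ ρ)) (0≤⊕ (0≤⊕ pa n) (drop≤ r))) c)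
  where
  eq : ∀ a u ρ → (a ⊕ (- + 1 - u)) ⊕ (+ 1 - ρ) ≡ a - u - ρ
  eq = ZR.solve-∀
concave-positive a ((u , ρ) ∷ []) pa (r ∷ rs) c | inj₁ p = p ∷ []
concave-positive a ((u , ρ) ∷ e ∷ es) pa (r ∷ rs) (_ , c) | inj₁ p = p ∷ concave-positive u (e ∷ es) p rs c

-- The same read from right to left, with value 0 beyond the right end.
head₀ : List Entry → ℤ
head₀ [] = 0ℤ
head₀ ((u , _) ∷ _) = u

ConcaveR : Entry → List Entry → Set
ConcaveR _ [] = ⊤
ConcaveR (a , ρ') ((u , ρ) ∷ es) = ((0ℤ ≤ᶻ u) ⊎ Bent (head₀ es) u a ρ ρ') × ConcaveR (u , ρ) es

Rising : List Entry → Set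
Rising [] = ⊥
Rising ((u , ρ) ∷ es) = (0ℤ ≤ᶻ - + 1 - u) × (0ℤ ≤ᶻ head₀ es - u - + ρ)

rise : ∀ a ρ' es → ConcaveR (a , ρ') es → Rising es → (0ℤ ≤ᶻ - + 1 - a) × (0ℤ ≤ᶻ head₀ es - a - + ρ')
rise a ρ' ((u , ρ) ∷ es) (inj₁ p , _) (n , s) = ⊥-elim (negative p n)
rise a ρ' ((u , ρ) ∷ es) (inj₂ b , _) (n , s) = subst (0ℤ ≤ᶻ_) (eq₂ u a (+ ρ')) (0≤⊕ (0≤⊕ n s') (+≤+ z≤n)) , s'
  where
  eq₁ : ∀ z u a ρ ρ' → (z - u - ρ) ⊕ ((u ⊕ u) - z - a ⊕ (ρ - ρ')) ≡ u - a - ρ'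
  eq₁ = ZR.solve-∀
  s' = subst (0ℤ ≤ᶻ_) (eq₁ (head₀ es) u a (+ ρ) (+ ρ')) (0≤⊕ s b)
  eq₂ : ∀ u a ρ' → ((- + 1 - u) ⊕ (u - a - ρ')) ⊕ ρ' ≡ - + 1 - a
  eq₂ = ZR.solve-∀

head-positive : ∀ es → Positive es → 0ℤ ≤ᶻ head₀ es
head-positive [] [] = +≤+ z≤n
head-positive (_ ∷ _) (p ∷ _) = p

positive-or-rising : ∀ e es → Small es → ConcaveR e es → Positive es ⊎ Rising es
positive-or-rising e [] [] c = inj₁ []
positive-or-rising e ((u , ρ) ∷ es) (r ∷ rs) (_ , c) with positive-or-rising (u , ρ) es rs c
... | inj₂ b = inj₂ (rise u ρ es c b)
... | inj₁ ps with sign u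
... | inj₁ p = inj₁ (p ∷ ps)
... | inj₂ n = inj₂ (n , subst (0ℤ ≤ᶻ_) (eq (head₀ es) u (+ ρ)) (0≤⊕ (0≤⊕ (head-positive es ps) n) (drop≤ r)))
  where
  eq : ∀ z u ρ → (z ⊕ (- + 1 - u)) ⊕ (+ 1 - ρ) ≡ z - u - ρ
  eq = ZR.solve-∀

concaveR-positive : ∀ a ρ es → 0ℤ ≤ᶻ a → Small es → ConcaveR (a , ρ) es → Positive es
concaveR-positive a ρ es pa rs c with positive-or-rising (a , ρ) es rs c
... | inj₁ ps = ps
... | inj₂ b = ⊥-elim (negative pa (proj₁ (rise a ρ es c b)))

-- Concavity of the vacancy numbers

np≤length : ∀ S X → np S N.≤ length (S ▷ X)
np≤length S X = subst (np S N.≤_) (sym (length-▷ S X)) (NP.m≤m+n (np S) (length X))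

-- Where the column has untouched strings, or its popped strings are long
-- enough, the vacancy number is large by itself.
free : ∀ S X {p : ℤ} {g s : ℕ} → bs S ≡ g + s → + sum (S ▷ X) ≤ᶻ p →
  (0ℤ ≤ᶻ p - + g) ⊎ (length (S ▷ X) ≡ np S × (g N.≤ pv S → 0ℤ ≤ᶻ p - + g))
free S [] {p} {g} b q = inj₂ (trans (length-▷ S []) (NP.+-identityʳ (np S)) ,
  λ k → i≤j⇒0≤j-i (ZP.≤-trans (+≤+ (subst (g N.≤_) (sym (sum-▷-[] S)) k)) q))
free S (x ∷ X) {p} {g} {s} b q = inj₁ (i≤j⇒0≤j-i (ZP.≤-trans
  (+≤+ (subst (g N.≤_) (sym (trans (sum-▷-∷ S x X) (cong (_+ sum (x ∷ X)) b))) (NP.≤-trans (NP.m≤m+n g s) (NP.m≤m+n (g + s) _)))) q))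

-- lo ≤ hi is the bound that makes the sequence bent.
test : Side → (g lo hi : ℕ) → Bool
test S g lo hi = (g ≤ᵇ pv S) ∨ (lo ≤ᵇ hi)

test-sound : ∀ S g lo hi → T (test S g lo hi) → (g N.≤ pv S) ⊎ (lo N.≤ hi)
test-sound S g lo hi p with g ≤ᵇ pv S in eq
... | true = inj₁ (≤ᵇ⇒≤ g (pv S) (subst T (sym eq) tt))
... | false = inj₂ (≤ᵇ⇒≤ lo hi p)

bent₁ : ∀ S X (q : ℤ) (n N N' k K g₋ g g₊ s ρ ρ' : ℕ) → N ≡ k + N' → K N.≤ k → bs S ≡ g + s →
  (let p = dn q (length (S ▷ X) + n) N) →
  + sum (S ▷ X) ≤ᶻ p → T (test S g ((np S + np S) + (g + g) + ρ') (K + g₊ + g₋ + ρ)) →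
  (0ℤ ≤ᶻ p - + g) ⊎ Bent (q - + g₋) (p - + g) (dn p n N' - + g₊) ρ ρ'
bent₁ S X q n _ N' k K g₋ g g₊ s ρ ρ' refl K≤k b c t
  with free S X b c | test-sound S g ((np S + np S) + (g + g) + ρ') (K + g₊ + g₋ + ρ) t
... | inj₁ p | _ = inj₁ p
... | inj₂ (_ , auto) | inj₁ le = inj₁ (auto le)
... | inj₂ (len , _) | inj₂ le rewrite len = inj₂ (subst (0ℤ ≤ᶻ_)
    (eq q (+ n) (+ N') (+ k) (+ K) (+ np S) (+ g₋) (+ g) (+ g₊) (+ ρ) (+ ρ'))
    (0≤⊕ (i≤j⇒0≤j-i (+≤+ le)) (i≤j⇒0≤j-i (+≤+ K≤k))))
  where
  eq : ∀ q n N' k K m g₋ g g₊ ρ ρ' →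
    ((K ⊕ g₊ ⊕ g₋ ⊕ ρ) - ((m ⊕ m) ⊕ (g ⊕ g) ⊕ ρ')) ⊕ (k - K) ≡
    (let p = q - ((m ⊕ n) ⊕ (m ⊕ n)) ⊕ (k ⊕ N') in
     ((p - g) ⊕ (p - g)) - (q - g₋) - ((p - (n ⊕ n) ⊕ N') - g₊) ⊕ (ρ - ρ'))
  eq = ZR.solve-∀

-- The same for ν⁽²⁾, where the positive contribution d comes from the strings of ν⁽¹⁾ near length
-- 3j and is bounded below by the strings known to be there.
bentK : ∀ S Y (Q : ℤ) (m m' d D N' g₋ g g₊ s ρ ρ' : ℕ) → m ≡ m' + d → D N.≤ d → bs S ≡ g + s →
  (let N = length (S ▷ Y) + N' ; P = Q ⊕ + m - + (N + N)) →
  + sum (S ▷ Y) ≤ᶻ P → T (test S g ((np S + np S) + (g + g) + ρ') (D + g₊ + g₋ + ρ)) →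
  (0ℤ ≤ᶻ P - + g) ⊎ Bent (Q - + g₋) (P - + g) ((P ⊕ + m' - + (N' + N')) - + g₊) ρ ρ'
bentK S Y Q _ m' d D N' g₋ g g₊ s ρ ρ' refl D≤d b c t
  with free S Y b c | test-sound S g ((np S + np S) + (g + g) + ρ') (D + g₊ + g₋ + ρ) t
... | inj₁ p | _ = inj₁ p
... | inj₂ (_ , auto) | inj₁ le = inj₁ (auto le)
... | inj₂ (len , _) | inj₂ le rewrite len = inj₂ (subst (0ℤ ≤ᶻ_)
    (eq Q (+ m') (+ d) (+ D) (+ N') (+ np S) (+ g₋) (+ g) (+ g₊) (+ ρ) (+ ρ'))
    (0≤⊕ (i≤j⇒0≤j-i (+≤+ le)) (i≤j⇒0≤j-i (+≤+ D≤d))))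
  where
  eq : ∀ Q m' d D N' k g₋ g g₊ ρ ρ' →
    ((D ⊕ g₊ ⊕ g₋ ⊕ ρ) - ((k ⊕ k) ⊕ (g ⊕ g) ⊕ ρ')) ⊕ (d - D) ≡
    (let P = Q ⊕ (m' ⊕ d) - ((k ⊕ N') ⊕ (k ⊕ N')) in
     ((P - g) ⊕ (P - g)) - (Q - g₋) - ((P ⊕ m' - (N' ⊕ N')) - g₊) ⊕ (ρ - ρ'))
  eq = ZR.solve-∀

-- The tags: r', x' belong to the column before (after, for tagO) the column r, x.
bit : Bool → ℕ
bit b = if b then 0 else 1

bit≤1 : ∀ b → bit b N.≤ 1
bit≤1 true = z≤n
bit≤1 false = s≤s z≤n

tagI tagO : (r' x' r x : ℕ) → ℕ
tagI r' x' r x = bit ((g r x ≡ᵇ 0) ∨ (atS3 r x ∧ (r' <ᵇ r)) ∨ ((r' ≡ᵇ 1) ∧ (x' ≡ᵇ 3) ∧ (r ≡ᵇ 2) ∧ (x ≡ᵇ 4)))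
tagO r' x' r x = bit ((h r x ≡ᵇ 0) ∨ (atS3 r x ∧ (r <ᵇ r')) ∨ ((r' ≡ᵇ 3) ∧ (x' ≡ᵇ 3) ∧ (r ≡ᵇ 2) ∧ (x ≡ᵇ 2)))

I₁ I₂ I₃ O₀ O₁ O₂ : Word → ℕ
I₁ w = tagI (r₀ w) (x₀ w) (r₁ w) (x₁ w)
I₂ w = tagI (r₁ w) (x₁ w) (r₂ w) (x₂ w)
I₃ w = tagI (r₂ w) (x₂ w) (r₃ w) (x₃ w)
O₀ w = tagO (r₁ w) (x₁ w) (r₀ w) (x₀ w)
O₁ w = tagO (r₂ w) (x₂ w) (r₁ w) (x₁ w)
O₂ w = tagO (r₃ w) (x₃ w) (r₂ w) (x₂ w)

tag : ℕ → ℕ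
tag k = bit (k ≡ᵇ 0)

pairwise : (Word → Word → Bool) → List Word → Bool
pairwise f ws = all∈ (λ w → all∈ (λ v → not (src v ≡ˢ tgt w) ∨ f w v) ws) ws

pairwise-sound : ∀ f ws → pairwise f ws ≡ true → ∀ {w v} → w ∈ ws → v ∈ ws → src v ≡ tgt w → T (f w v)
pairwise-sound f ws c {w} {v} i j e = implies (src v ≡ˢ tgt w)
  (all∈-sound (λ v → not (src v ≡ˢ tgt w) ∨ f w v) (all∈-sound (λ w → all∈ (λ v → not (src v ≡ˢ tgt w) ∨ f w v) ws) (trueT c) i) j)
  (subst (λ s → T (src v ≡ˢ s)) e (≡ˢ-refl (src v)))

-- The weights 1, 2, 3, 2, 1 on lengths 3j-2, ..., 3j+2 are the second difference of min(3j, ·) in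
-- j. Only the strings that the words take or push are counted. `dI'` is for the last block, after
-- which nothing is known to follow.
dI dI' dO : Word → Word → ℕ
dI' w v = np (f₁ w) + (np (f₂ w) + np (f₂ w)) + (np (f₃ w) + np (f₃ w) + np (f₃ w))
dI w v = dI' w v + (np (f₁ v) + np (f₁ v)) + np (f₂ v)
dO w v = np (b₁ w) + (np (b₂ w) + np (b₂ w)) + (np (b₀ v) + np (b₀ v) + np (b₀ v)) + (np (b₁ v) + np (b₁ v)) + np (b₂ v)

testI₁ testI₂ testI₃ testIK testO₁ testO₂ : Word → Bool
testI₁ w = test (f₁ w) (G₁ w) ((np (f₁ w) + np (f₁ w)) + (G₁ w + G₁ w) + I₂ w) (0 + G₂ w + gS (src w) + I₁ w)
testI₂ w = test (f₂ w) (G₂ w) ((np (f₂ w) + np (f₂ w)) + (G₂ w + G₂ w) + I₃ w) (0 + gS (tgt w) + G₁ w + I₂ w)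
testI₃ w = test (f₃ w) (gS (tgt w)) ((np (f₃ w) + np (f₃ w)) + (gS (tgt w) + gS (tgt w)) + tag (gS (tgt w))) (np (fK w) + gS (tgt w) + G₂ w + I₃ w)
testIK w = test (fK w) (gK (tgt w)) ((np (fK w) + np (fK w)) + (gK (tgt w) + gK (tgt w)) + tag (gK (tgt w))) (dI' w w + gK (tgt w) + gK (src w) + tag (gK (tgt w)))
testO₁ w = test (b₁ w) (H₁ w) ((np (b₁ w) + np (b₁ w)) + (H₁ w + H₁ w) + O₀ w) (0 + H₂ w + hS (src w) + O₁ w)
testO₂ w = test (b₂ w) (H₂ w) ((np (b₂ w) + np (b₂ w)) + (H₂ w + H₂ w) + O₁ w) (0 + hS (tgt w) + H₁ w + O₂ w)

nextI₃ nextIK nextO₃ nextOK : Word → Word → Bool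
nextI₃ w v = test (f₃ w) (gS (tgt w)) ((np (f₃ w) + np (f₃ w)) + (gS (tgt w) + gS (tgt w)) + I₁ v) (np (fK w) + G₁ v + G₂ w + I₃ w)
nextIK w v = test (fK w) (gK (tgt w)) ((np (fK w) + np (fK w)) + (gK (tgt w) + gK (tgt w)) + tag (gK (tgt v))) (dI w v + gK (tgt v) + gK (src w) + tag (gK (tgt w)))
nextO₃ w v = test (b₀ v) (hS (tgt w)) ((np (b₀ v) + np (b₀ v)) + (hS (tgt w) + hS (tgt w)) + O₂ w) (np (bK v) + H₁ v + H₂ w + O₀ v)
nextOK w v = test (bK v) (hK (tgt w)) ((np (bK v) + np (bK v)) + (hK (tgt w) + hK (tgt w)) + tag (hK (src w))) (dO w v + hK (tgt v) + hK (src w) + tag (hK (tgt w)))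

opaque
  unfolding words

  okI₁ : ∀ {w} → w ∈ words → T (testI₁ w)
  okI₁ = all∈-sound testI₁ {words} (trueT refl)
  okI₂ : ∀ {w} → w ∈ words → T (testI₂ w)
  okI₂ = all∈-sound testI₂ {words} (trueT refl)
  okI₃ : ∀ {w} → w ∈ words → T (testI₃ w)
  okI₃ = all∈-sound testI₃ {words} (trueT refl)
  okIK : ∀ {w} → w ∈ words → T (testIK w)
  okIK = all∈-sound testIK {words} (trueT refl)
  okO₁ : ∀ {w} → w ∈ words → T (testO₁ w)
  okO₁ = all∈-sound testO₁ {words} (trueT refl)
  okO₂ : ∀ {w} → w ∈ words → T (testO₂ w)
  okO₂ = all∈-sound testO₂ {words} (trueT refl)
  okI₃' : ∀ {w v} → w ∈ words → v ∈ words → src v ≡ tgt w → T (nextI₃ w v)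
  okI₃' = pairwise-sound nextI₃ words refl
  okIK' : ∀ {w v} → w ∈ words → v ∈ words → src v ≡ tgt w → T (nextIK w v)
  okIK' = pairwise-sound nextIK words refl
  okO₃' : ∀ {w v} → w ∈ words → v ∈ words → src v ≡ tgt w → T (nextO₃ w v)
  okO₃' = pairwise-sound nextO₃ words refl
  okOK' : ∀ {w v} → w ∈ words → v ∈ words → src v ≡ tgt w → T (nextOK w v)
  okOK' = pairwise-sound nextOK words refl

colsI KI : ∀ {t s M} → Trace t s M → ℤ → List Entry
colsI {t} (done _) p = (dn p 0 0 - + gS t , tag (gS t)) ∷ []
colsI (step w i _ X₁ X₂ X₃ Y₃ τ) p = (I.v₁ p - + G₁ w , I₁ w) ∷ (I.v₂ p - + G₂ w , I₂ w) ∷ (I.v₃ p - + gS (tgt w) , I₃ w) ∷ colsI τ (I.v₃ p)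
  where open Crossing w i X₁ X₂ X₃ Y₃ τ
KI {t} (done _) P = ((P ⊕ + 0 - + 0) - + gK t , tag (gK t)) ∷ []
KI (step w i _ X₁ X₂ X₃ Y₃ τ) P = (I.vK P - + gK (tgt w) , tag (gK (tgt w))) ∷ KI τ (I.vK P)
  where open Crossing w i X₁ X₂ X₃ Y₃ τ

-- Before the pass the weight is only known to be nonnegative, while the room at the end asks for at
-- least `gS t` and `gK t`. Beyond the last block the vacancy number is constant, so a repeated last
-- value closes the sequence: with k = 0 it is nonnegative, and with tag 1 it contradicts a descent.
last-entry : ∀ (p u : ℤ) k → u ≡ p → 0ℤ ≤ᶻ p → (0ℤ ≤ᶻ u - + k) ⊎ (+ 1 ≤ᶻ (u - + k) - (p - + k) ⊕ + tag k)
last-entry p u zero refl q = inj₁ (subst (0ℤ ≤ᶻ_) (sym (ZP.+-identityʳ p)) q)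
last-entry p u (suc k) refl q = inj₂ (ZP.≤-reflexive (eq p (+ suc k)))
  where
  eq : ∀ p k → + 1 ≡ (p - k) - (p - k) ⊕ + 1
  eq = ZR.solve-∀

dn-0 : ∀ p → p - + 0 ⊕ + 0 ≡ p
dn-0 = ZR.solve-∀

dnK-0 : ∀ p → p ⊕ + 0 - + 0 ≡ p
dnK-0 = ZR.solve-∀

-- The total number of strings of length at least 3j-2, 3j-1, 3j, and how it
-- changes from one block to the next.
spread : ∀ L₁ L₂ L₃ J₁ J₂ m →
  (L₁ + (L₂ + (L₃ + (J₁ + (J₂ + m))))) + ((L₂ + (L₃ + (J₁ + (J₂ + m)))) + (L₃ + (J₁ + (J₂ + m))))
  ≡ ((J₁ + (J₂ + m)) + ((J₂ + m) + m)) + (L₁ + (L₂ + L₂) + (L₃ + L₃ + L₃) + (J₁ + J₁) + J₂)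
spread = NR.solve-∀

spread₀ : ∀ L₁ L₂ L₃ → (L₁ + (L₂ + (L₃ + 0))) + ((L₂ + (L₃ + 0)) + (L₃ + 0)) ≡ 0 + (L₁ + (L₂ + L₂) + (L₃ + L₃ + L₃))
spread₀ = NR.solve-∀

mono₃ : ∀ {a a' b b' c c'} → a N.≤ a' → b N.≤ b' → c N.≤ c' → a + (b + b) + (c + c + c) N.≤ a' + (b' + b') + (c' + c' + c')
mono₃ p q r = NP.+-mono-≤ (NP.+-mono-≤ p (NP.+-mono-≤ q q)) (NP.+-mono-≤ (NP.+-mono-≤ r r) r)

mono₅ : ∀ {a a' b b' c c' d d' e e'} → a N.≤ a' → b N.≤ b' → c N.≤ c' → d N.≤ d' → e N.≤ e' →
  a + (b + b) + (c + c + c) + (d + d) + e N.≤ a' + (b' + b') + (c' + c' + c') + (d' + d') + e'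
mono₅ p q r s t = NP.+-mono-≤ (NP.+-mono-≤ (mono₃ p q r) (NP.+-mono-≤ s s)) t

module _ {t : St} where

  concaveI : ∀ {s M} (τ : Trace t s M) {p P l₁ l₂ : ℤ} → 0ℤ ≤ᶻ l₁ → HW p P (inp τ) l₁ l₂ → Concave (p - + gS s) (colsI τ p)
  concaveI (done _) {p} pos (refl , _) = last-entry p _ (gS t) (dn-0 p) pos
  concaveI (step w i refl X₁ X₂ X₃ Y₃ τ) {p} pos (q₁ , q₂ , q₃ , _ , hw) =
    bent₁ (f₁ w) X₁ p I.m₂ I.NK I.NK 0 0 (gS (src w)) (G₁ w) (G₂ w) 0 (I₁ w) (I₂ w) refl z≤n (+0 (bs-f₁ i)) q₁ (okI₁ i) ,
    bent₁ (f₂ w) X₂ (I.v₁ p) I.m₃ I.NK I.NK 0 0 (G₁ w) (G₂ w) (gS (tgt w)) 0 (I₂ w) (I₃ w) refl z≤n (+0 (bs-f₂ i)) q₂ (okI₂ i) ,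
    third τ q₃ (concaveI τ pos hw)
    where
    open Crossing w i X₁ X₂ X₃ Y₃ τ
    third : ∀ {M} (τ : Trace t (tgt w) M) →
      (let open Crossing w i X₁ X₂ X₃ Y₃ τ using () renaming (module I to I')) →
      + sum (f₃ w ▷ X₃) ≤ᶻ I'.v₃ p → Concave (I'.v₃ p - + gS (tgt w)) (colsI τ (I'.v₃ p)) →
      Concave (I'.v₂ p - + G₂ w) ((I'.v₃ p - + gS (tgt w) , I₃ w) ∷ colsI τ (I'.v₃ p))
    third τ@(done _) q c =
      bent₁ (f₃ w) X₃ (I'.v₂ p) 0 I'.NK 0 (length (fK w ▷ Y₃)) (np (fK w)) (G₂ w) (gS (tgt w)) (gS (tgt w)) (st (tgt w)) (I₃ w) (tag (gS (tgt w)))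
        refl (np≤length (fK w) Y₃) (bs-f₃ i) q (okI₃ i) , c
      where open Crossing w i X₁ X₂ X₃ Y₃ τ using () renaming (module I to I')
    third τ@(step v j e Z₁ Z₂ Z₃ W₃ σ) q c =
      bent₁ (f₃ w) X₃ (I'.v₂ p) (#₁ (inp τ)) I'.NK (#K (inp τ)) (length (fK w ▷ Y₃)) (np (fK w)) (G₂ w) (gS (tgt w)) (G₁ v) (st (tgt w)) (I₃ w) (I₁ v)
        refl (np≤length (fK w) Y₃) (bs-f₃ i) q (okI₃' i j e) , c
      where open Crossing w i X₁ X₂ X₃ Y₃ τ using () renaming (module I to I')

  concaveKI : ∀ {s M} (τ : Trace t s M) {p P l₁ l₂ : ℤ} → 0ℤ ≤ᶻ l₂ → HW p P (inp τ) l₁ l₂ → Concave (P - + gK s) (KI τ P)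
  concaveKI (done _) {P = P} pos (_ , refl) = last-entry P _ (gK t) (dnK-0 P) pos
  concaveKI (step w i refl X₁ X₂ X₃ Y₃ τ) {P = P} pos (_ , _ , _ , qK , hw) = third τ qK (concaveKI τ pos hw)
    where
    third : ∀ {M} (τ : Trace t (tgt w) M) →
      (let open Crossing w i X₁ X₂ X₃ Y₃ τ using (module I)) →
      + sum (fK w ▷ Y₃) ≤ᶻ I.vK P → Concave (I.vK P - + gK (tgt w)) (KI τ (I.vK P)) →
      Concave (P - + gK (src w)) ((I.vK P - + gK (tgt w) , tag (gK (tgt w))) ∷ KI τ (I.vK P))
    third τ@(done _) q c =
      bentK (fK w) Y₃ P (I.m₁ + (I.m₂ + I.m₃)) 0 _ (dI' w w) 0 (gK (src w)) (gK (tgt w)) (gK (tgt w)) 0 (tag (gK (tgt w))) (tag (gK (tgt w)))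
        (spread₀ (length (f₁ w ▷ X₁)) (length (f₂ w ▷ X₂)) (length (f₃ w ▷ X₃)))
        (mono₃ (np≤length (f₁ w) X₁) (np≤length (f₂ w) X₂) (np≤length (f₃ w) X₃)) (+0 (bs-fK i)) q (okIK i) , c
      where open Crossing w i X₁ X₂ X₃ Y₃ τ using (module I)
    third τ@(step v j e Z₁ Z₂ Z₃ W₃ σ) q c =
      bentK (fK w) Y₃ P (I.m₁ + (I.m₂ + I.m₃)) (J.m₁ + (J.m₂ + J.m₃)) _ (dI w v) J.NK (gK (src w)) (gK (tgt w)) (gK (tgt v)) 0
        (tag (gK (tgt w))) (tag (gK (tgt v)))
        (spread (length (f₁ w ▷ X₁)) (length (f₂ w ▷ X₂)) (length (f₃ w ▷ X₃)) (length (f₁ v ▷ Z₁)) (length (f₂ v ▷ Z₂)) J.m₃)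
        (mono₅ (np≤length (f₁ w) X₁) (np≤length (f₂ w) X₂) (np≤length (f₃ w) X₃) (np≤length (f₁ v) Z₁) (np≤length (f₂ v) Z₂))
        (+0 (bs-fK i)) q (okIK' i j e) , c
      where
      open Crossing w i X₁ X₂ X₃ Y₃ τ using (module I)
      open Crossing v j Z₁ Z₂ Z₃ W₃ σ using () renaming (module I to J)

  smallI : ∀ {s M} (τ : Trace t s M) p → Small (colsI τ p)
  smallI (done _) p = bit≤1 _ ∷ []
  smallI (step w i refl X₁ X₂ X₃ Y₃ τ) p = bit≤1 _ ∷ bit≤1 _ ∷ bit≤1 _ ∷ smallI τ _

  smallKI : ∀ {s M} (τ : Trace t s M) p → Small (KI τ p)
  smallKI (done _) p = bit≤1 _ ∷ []
  smallKI (step w i refl X₁ X₂ X₃ Y₃ τ) p = bit≤1 _ ∷ smallKI τ _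

  positive-roomI : ∀ {s M} (τ : Trace t s M) {p P} → + gS s ≤ᶻ p → + gK s ≤ᶻ P → Positive (colsI τ p) → Positive (KI τ P) → RoomI τ p P
  positive-roomI (done _) q qK _ _ = q , qK
  positive-roomI (step w i refl X₁ X₂ X₃ Y₃ τ) q qK (p₁ ∷ p₂ ∷ p₃ ∷ ps) (pK ∷ pKs) =
    0≤i-j⇒j≤i p₁ , 0≤i-j⇒j≤i p₂ , 0≤i-j⇒j≤i p₃ , 0≤i-j⇒j≤i pK , positive-roomI τ (0≤i-j⇒j≤i p₃) (0≤i-j⇒j≤i pK) ps pKs

  roomI : ∀ {s M} (τ : Trace t s M) {p P l₁ l₂ : ℤ} → + gS s ≤ᶻ p → + gK s ≤ᶻ P → 0ℤ ≤ᶻ l₁ → 0ℤ ≤ᶻ l₂ →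
    HW p P (inp τ) l₁ l₂ → RoomI τ p P
  roomI τ {p} {P} q qK pos pos' hw = positive-roomI τ q qK
    (concave-positive _ _ (i≤j⇒0≤j-i q) (smallI τ p) (concaveI τ pos hw))
    (concave-positive _ _ (i≤j⇒0≤j-i qK) (smallKI τ P) (concaveKI τ pos' hw))

tagHd : ∀ {t s M} → Trace t s M → ℕ
tagHd (done _) = 0
tagHd (step w _ _ _ _ _ _ _) = O₀ w

colsO KO : ∀ {t s M} → Trace t s M → ℤ → List Entry
colsO (done _) p = []
colsO (step w i _ X₁ X₂ X₃ Y₃ τ) p = (O.v₁ p - + H₁ w , O₁ w) ∷ (O.v₂ p - + H₂ w , O₂ w) ∷ (O.v₃ p - + hS (tgt w) , tagHd τ) ∷ colsO τ (O.v₃ p)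
  where open Crossing w i X₁ X₂ X₃ Y₃ τ
KO (done _) P = []
KO (step w i _ X₁ X₂ X₃ Y₃ τ) P = (O.vK P - + hK (tgt w) , tag (hK (tgt w))) ∷ KO τ (O.vK P)
  where open Crossing w i X₁ X₂ X₃ Y₃ τ

swapped : ∀ {A : Set} (a u v : ℤ) (ρ ρ' : ℕ) → A ⊎ Bent a u v ρ ρ' → A ⊎ Bent v u a ρ ρ'
swapped a u v ρ ρ' (inj₁ p) = inj₁ p
swapped a u v ρ ρ' (inj₂ b) = inj₂ (subst (0ℤ ≤ᶻ_) (eq a u v (+ ρ) (+ ρ')) b)
  where
  eq : ∀ a u v ρ ρ' → (u ⊕ u) - a - v ⊕ (ρ - ρ') ≡ (u ⊕ u) - v - a ⊕ (ρ - ρ')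
  eq = ZR.solve-∀

module _ {t : St} where

  -- After the pass the value at the far end is controlled by the ε-condition on the path, so the
  -- tags are arranged to telescope from right to left and no extra entry is added.
  concaveO : ∀ {s M} (τ : Trace t s M) {p P l₁ l₂ : ℤ} → + hS t ≤ᶻ l₁ → HW p P (out τ) l₁ l₂ → ConcaveR (p - + hS s , tagHd τ) (colsO τ p)
  concaveO (done _) _ _ = tt
  concaveO (step w i refl X₁ X₂ X₃ Y₃ τ) {p} ε (q₁ , q₂ , q₃ , _ , hw) =
    swapped (p - + hS (src w)) (O.v₁ p - + H₁ w) (O.v₂ p - + H₂ w) (O₁ w) (O₀ w)
      (bent₁ (b₁ w) X₁ p O.m₂ O.NK O.NK 0 0 (hS (src w)) (H₁ w) (H₂ w) 0 (O₁ w) (O₀ w) refl z≤n (+0 (bs-b₁ i)) q₁ (okO₁ i)) ,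
    swapped (O.v₁ p - + H₁ w) (O.v₂ p - + H₂ w) (O.v₃ p - + hS (tgt w)) (O₂ w) (O₁ w)
      (bent₁ (b₂ w) X₂ (O.v₁ p) O.m₃ O.NK O.NK 0 0 (H₁ w) (H₂ w) (hS (tgt w)) 0 (O₂ w) (O₁ w) refl z≤n (+0 (bs-b₂ i)) q₂ (okO₂ i)) ,
    third τ q₃ hw , concaveO τ ε hw
    where
    open Crossing w i X₁ X₂ X₃ Y₃ τ
    third : ∀ {M} (τ : Trace t (tgt w) M) {P l₂ : ℤ} →
      (let open Crossing w i X₁ X₂ X₃ Y₃ τ using () renaming (module O to O')) →
      + sum (hd₃ τ ▷ X₃) ≤ᶻ O'.v₃ p → HW (O'.v₃ p) P (out τ) _ l₂ →
      (0ℤ ≤ᶻ O'.v₃ p - + hS (tgt w)) ⊎ Bent (head₀ (colsO τ (O'.v₃ p))) (O'.v₃ p - + hS (tgt w)) (O'.v₂ p - + H₂ w) (tagHd τ) (O₂ w)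
    third (done _) q (refl , _) = inj₁ (i≤j⇒0≤j-i ε)
    third τ@(step v j e Z₁ Z₂ Z₃ W₃ σ) q _ =
      swapped (O'.v₂ p - + H₂ w) (O'.v₃ p - + hS (tgt w)) (head₀ (colsO τ (O'.v₃ p))) (O₀ v) (O₂ w)
        (bent₁ (b₀ v) X₃ (O'.v₂ p) (#₁ (out τ)) O'.NK (#K (out τ)) (length (bK v ▷ Y₃)) (np (bK v)) (H₂ w) (hS (tgt w)) (H₁ v) (st (tgt w))
        (O₀ v) (O₂ w) refl (np≤length (bK v) Y₃) (bs-hd₃ τ) q (okO₃' i j e))
      where open Crossing w i X₁ X₂ X₃ Y₃ τ using () renaming (module O to O')

  concaveKO : ∀ {s M} (τ : Trace t s M) {p P l₁ l₂ : ℤ} → + hK t ≤ᶻ l₂ → HW p P (out τ) l₁ l₂ → ConcaveR (P - + hK s , tag (hK s)) (KO τ P)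
  concaveKO (done _) _ _ = tt
  concaveKO (step w i refl X₁ X₂ X₃ Y₃ τ) {P = P} ε (_ , _ , _ , qK , hw) = third τ qK hw , concaveKO τ ε hw
    where
    third : ∀ {M} (τ : Trace t (tgt w) M) {p l₁ : ℤ} →
      (let open Crossing w i X₁ X₂ X₃ Y₃ τ using (module O)) →
      + sum (hdK τ ▷ Y₃) ≤ᶻ O.vK P → HW p (O.vK P) (out τ) l₁ _ →
      (0ℤ ≤ᶻ O.vK P - + hK (tgt w)) ⊎ Bent (head₀ (KO τ (O.vK P))) (O.vK P - + hK (tgt w)) (P - + hK (src w)) (tag (hK (tgt w))) (tag (hK (src w)))
    third (done _) q (_ , refl) = inj₁ (i≤j⇒0≤j-i ε)
    third τ@(step v j e Z₁ Z₂ Z₃ W₃ σ) q _ =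
      swapped (P - + hK (src w)) (O.vK P - + hK (tgt w)) (head₀ (KO τ (O.vK P))) (tag (hK (tgt w))) (tag (hK (src w)))
        (bentK (bK v) Y₃ P (O.m₁ + (O.m₂ + O.m₃)) (J.m₁ + (J.m₂ + J.m₃)) _ (dO w v) J.NK (hK (src w)) (hK (tgt w)) (hK (tgt v)) 0
        (tag (hK (tgt w))) (tag (hK (src w)))
        (spread (length (b₁ w ▷ X₁)) (length (b₂ w ▷ X₂)) (length (b₀ v ▷ X₃)) (length (b₁ v ▷ Z₁)) (length (b₂ v ▷ Z₂)) J.m₃)
        (mono₅ (np≤length (b₁ w) X₁) (np≤length (b₂ w) X₂) (np≤length (b₀ v) X₃) (np≤length (b₁ v) Z₁) (np≤length (b₂ v) Z₂))
        (+0 (bs-hdK τ)) q (okOK' i j e))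
      where
      open Crossing w i X₁ X₂ X₃ Y₃ τ using (module O)
      open Crossing v j Z₁ Z₂ Z₃ W₃ σ using () renaming (module O to J)

  tagHd≤1 : ∀ {s M} (τ : Trace t s M) → tagHd τ N.≤ 1
  tagHd≤1 (done _) = z≤n
  tagHd≤1 (step w _ _ _ _ _ _ _) = bit≤1 _

  smallO : ∀ {s M} (τ : Trace t s M) p → Small (colsO τ p)
  smallO (done _) p = []
  smallO (step w i refl X₁ X₂ X₃ Y₃ τ) p = bit≤1 _ ∷ bit≤1 _ ∷ tagHd≤1 τ ∷ smallO τ _

  smallKO : ∀ {s M} (τ : Trace t s M) p → Small (KO τ p)
  smallKO (done _) p = []
  smallKO (step w i refl X₁ X₂ X₃ Y₃ τ) p = bit≤1 _ ∷ smallKO τ _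

  positive-roomO : ∀ {s M} (τ : Trace t s M) {p P} → + hS s ≤ᶻ p → + hK s ≤ᶻ P → Positive (colsO τ p) → Positive (KO τ P) → RoomO τ p P
  positive-roomO (done _) q qK _ _ = q , qK
  positive-roomO (step w i refl X₁ X₂ X₃ Y₃ τ) q qK (p₁ ∷ p₂ ∷ p₃ ∷ ps) (pK ∷ pKs) =
    0≤i-j⇒j≤i p₁ , 0≤i-j⇒j≤i p₂ , 0≤i-j⇒j≤i p₃ , 0≤i-j⇒j≤i pK , positive-roomO τ (0≤i-j⇒j≤i p₃) (0≤i-j⇒j≤i pK) ps pKs

  roomO : ∀ {s M} (τ : Trace t s M) {p P l₁ l₂ : ℤ} → + hS s ≤ᶻ p → + hK s ≤ᶻ P → + hS t ≤ᶻ l₁ → + hK t ≤ᶻ l₂ →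
    HW p P (out τ) l₁ l₂ → RoomO τ p P
  roomO τ {p} {P} q qK ε ε' hw = positive-roomO τ q qK
    (concaveR-positive _ _ _ (i≤j⇒0≤j-i q) (smallO τ p) (concaveO τ ε hw))
    (concaveR-positive _ _ _ (i≤j⇒0≤j-i qK) (smallKO τ P) (concaveKO τ ε' hw))


-- Exploring several consecutive passes at once

-- pat xs r stands for the columns that start with xs and continue with an
-- arbitrary column shifted by r.
data Pattern : Set where
  pat : List ℕ → ℕ → Pattern

In : Pattern → Column → Set
In (pat xs r) c = ∃ λ X → c ≡ xs ++ shift r X

-- An overapproximation: what a pattern cannot express is forgotten, and `nothing` is returned only
-- where no column of the pattern has the required form. Soundness in this one direction suffices,
-- since the search only has to exclude situations.
cut : Side → Pattern → Maybe Pattern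
cut any A = just A
cut ge1 (pat [] r) = just (pat [] (r ∸ 1))
cut ge1 (pat (0 ∷ _) r) = nothing
cut ge1 (pat (suc x ∷ xs) r) = just (pat (x ∷ xs) r)
cut ge2 (pat [] r) = just (pat [] (r ∸ 2))
cut ge2 (pat (0 ∷ _) r) = nothing
cut ge2 (pat (1 ∷ _) r) = nothing
cut ge2 (pat (suc (suc x) ∷ xs) r) = just (pat (x ∷ xs) r)
cut pop0 (pat [] 0) = just (pat [] 0)
cut pop0 (pat [] (suc _)) = nothing
cut pop0 (pat (0 ∷ xs) r) = just (pat xs r)
cut pop0 (pat (suc _ ∷ _) r) = nothing
cut pop0ge1 (pat [] 0) = just (pat [] 0)
cut pop0ge1 (pat [] (suc _)) = nothing
cut pop0ge1 (pat (0 ∷ []) r) = just (pat [] (r ∸ 1))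
cut pop0ge1 (pat (0 ∷ 0 ∷ _) r) = nothing
cut pop0ge1 (pat (0 ∷ suc x ∷ xs) r) = just (pat (x ∷ xs) r)
cut pop0ge1 (pat (suc _ ∷ _) r) = nothing
cut pop00 (pat [] 0) = just (pat [] 0)
cut pop00 (pat [] (suc _)) = nothing
cut pop00 (pat (0 ∷ []) 0) = just (pat [] 0)
cut pop00 (pat (0 ∷ []) (suc _)) = nothing
cut pop00 (pat (0 ∷ 0 ∷ xs) r) = just (pat xs r)
cut pop00 (pat (0 ∷ suc _ ∷ _) r) = nothing
cut pop00 (pat (suc _ ∷ _) r) = nothing
cut pop1 (pat [] 0) = just (pat [] 0)
cut pop1 (pat [] 1) = just (pat [] 0)
cut pop1 (pat [] (suc (suc _))) = nothing
cut pop1 (pat (0 ∷ _) r) = nothing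
cut pop1 (pat (1 ∷ xs) r) = just (pat xs r)
cut pop1 (pat (suc (suc _) ∷ _) r) = nothing

put : Side → Pattern → Pattern
put any A = A
put ge1 (pat [] r) = pat [] (1 + r)
put ge1 (pat (x ∷ xs) r) = pat (1 + x ∷ xs) r
put ge2 (pat [] r) = pat [] (2 + r)
put ge2 (pat (x ∷ xs) r) = pat (2 + x ∷ xs) r
put pop0 (pat xs r) = pat (0 ∷ xs) r
put pop0ge1 (pat [] r) = pat (0 ∷ []) (1 + r)
put pop0ge1 (pat (x ∷ xs) r) = pat (0 ∷ 1 + x ∷ xs) r
put pop00 (pat xs r) = pat (0 ∷ 0 ∷ xs) r
put pop1 (pat xs r) = pat (1 ∷ xs) r

shift-0 : ∀ X → shift 0 X ≡ X
shift-0 [] = refl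
shift-0 (_ ∷ _) = refl

shift-shift : ∀ k r X → shift k (shift r X) ≡ shift (k + r) X
shift-shift k r [] = refl
shift-shift zero r (x ∷ X) = refl
shift-shift (suc k) r (x ∷ X) = cong (λ c → suc c ∷ X) (∷-injectiveˡ (shift-shift k r (x ∷ X)))

put-sound : ∀ S A {Y} → In A Y → In (put S A) (S ▷ Y)
put-sound any A i = i
put-sound ge1 (pat [] r) (X , refl) = X , shift-shift 1 r X
put-sound ge1 (pat (_ ∷ _) r) (X , refl) = X , refl
put-sound ge2 (pat [] r) (X , refl) = X , shift-shift 2 r X
put-sound ge2 (pat (_ ∷ _) r) (X , refl) = X , refl
put-sound pop0 (pat xs r) (X , refl) = X , refl
put-sound pop0ge1 (pat [] r) (X , refl) = X , cong (0 ∷_) (shift-shift 1 r X)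
put-sound pop0ge1 (pat (_ ∷ _) r) (X , refl) = X , refl
put-sound pop00 (pat xs r) (X , refl) = X , refl
put-sound pop1 (pat xs r) (X , refl) = X , refl

unshift : ∀ k r X Y → shift k Y ≡ shift r X → ∃ λ Z → Y ≡ shift (r ∸ k) Z
unshift zero r X Y e = X , trans (sym (shift-0 Y)) e
unshift (suc k) zero X Y e = Y , sym (shift-0 Y)
unshift (suc k) (suc r) [] [] e = [] , refl
unshift (suc k) (suc r) (x ∷ X) (y ∷ Y) e =
  unshift k r (x ∷ X) (y ∷ Y) (cong₂ _∷_ (suc-injective (∷-injectiveˡ e)) (∷-injectiveʳ e))

anything : ∀ Y → In (pat [] 0) Y
anything Y = Y , sym (shift-0 Y)

cut-sound : ∀ S A Y → In A (S ▷ Y) → ∃ λ A' → cut S A ≡ just A' × In A' Y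
cut-sound any A Y i = A , refl , i
cut-sound ge1 (pat [] r) Y (X , e) = _ , refl , unshift 1 r X Y e
cut-sound ge1 (pat (0 ∷ xs) r) [] (X , ())
cut-sound ge1 (pat (0 ∷ xs) r) (y ∷ Y) (X , ())
cut-sound ge1 (pat (suc x ∷ xs) r) (y ∷ Y) (X , refl) = _ , refl , X , refl
cut-sound ge2 (pat [] r) Y (X , e) = _ , refl , unshift 2 r X Y e
cut-sound ge2 (pat (0 ∷ xs) r) [] (X , ())
cut-sound ge2 (pat (0 ∷ xs) r) (y ∷ Y) (X , ())
cut-sound ge2 (pat (1 ∷ xs) r) [] (X , ())
cut-sound ge2 (pat (1 ∷ xs) r) (y ∷ Y) (X , ())
cut-sound ge2 (pat (suc (suc x) ∷ xs) r) (y ∷ Y) (X , refl) = _ , refl , X , refl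
cut-sound pop0 (pat [] 0) Y i = _ , refl , anything Y
cut-sound pop0 (pat [] (suc r)) Y (_ ∷ _ , ())
cut-sound pop0 (pat (0 ∷ xs) r) Y (X , refl) = _ , refl , X , refl
cut-sound pop0 (pat (suc _ ∷ xs) r) Y (X , ())
cut-sound pop0ge1 (pat [] 0) Y i = _ , refl , anything Y
cut-sound pop0ge1 (pat [] (suc r)) Y (_ ∷ _ , ())
cut-sound pop0ge1 (pat (0 ∷ []) r) Y (X , e) = _ , refl , unshift 1 r X Y (∷-injectiveʳ e)
cut-sound pop0ge1 (pat (0 ∷ 0 ∷ xs) r) [] (X , ())
cut-sound pop0ge1 (pat (0 ∷ 0 ∷ xs) r) (y ∷ Y) (X , ())
cut-sound pop0ge1 (pat (0 ∷ suc x ∷ xs) r) (y ∷ Y) (X , refl) = _ , refl , X , refl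
cut-sound pop0ge1 (pat (suc _ ∷ xs) r) Y (X , ())
cut-sound pop00 (pat [] 0) Y i = _ , refl , anything Y
cut-sound pop00 (pat [] (suc r)) Y (_ ∷ _ , ())
cut-sound pop00 (pat (0 ∷ []) 0) Y i = _ , refl , anything Y
cut-sound pop00 (pat (0 ∷ []) (suc r)) Y ([] , ())
cut-sound pop00 (pat (0 ∷ []) (suc r)) Y (_ ∷ _ , ())
cut-sound pop00 (pat (0 ∷ 0 ∷ xs) r) Y (X , refl) = _ , refl , X , refl
cut-sound pop00 (pat (0 ∷ suc _ ∷ xs) r) Y (X , ())
cut-sound pop00 (pat (suc _ ∷ xs) r) Y (X , ())
cut-sound pop1 (pat [] 0) Y i = _ , refl , anything Y
cut-sound pop1 (pat [] 1) Y i = _ , refl , anything Y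
cut-sound pop1 (pat [] (suc (suc r))) Y (_ ∷ _ , ())
cut-sound pop1 (pat (0 ∷ xs) r) Y (X , ())
cut-sound pop1 (pat (1 ∷ xs) r) Y (X , refl) = _ , refl , X , refl
cut-sound pop1 (pat (suc (suc _) ∷ xs) r) Y (X , ())

-- What a word leaves behind at its far boundary.
record Bound : Set where
  constructor edge
  field
    at : St
    side₃ sideK : Side

bnd : Word → Bound
bnd w = edge (tgt w) (f₃ w) (fK w)

sideCode : Side → ℕ
sideCode any = 0
sideCode ge1 = 1
sideCode ge2 = 2
sideCode pop0 = 3
sideCode pop0ge1 = 4
sideCode pop00 = 5
sideCode pop1 = 6

sideDecode : ℕ → Side
sideDecode 0 = any
sideDecode 1 = ge1
sideDecode 2 = ge2
sideDecode 3 = pop0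
sideDecode 4 = pop0ge1
sideDecode 5 = pop00
sideDecode _ = pop1

sideDecode-code : ∀ S → sideDecode (sideCode S) ≡ S
sideDecode-code any = refl
sideDecode-code ge1 = refl
sideDecode-code ge2 = refl
sideDecode-code pop0 = refl
sideDecode-code pop0ge1 = refl
sideDecode-code pop00 = refl
sideDecode-code pop1 = refl

_≡ᵈ_ : Side → Side → Bool
S ≡ᵈ S' = sideCode S ≡ᵇ sideCode S'

≡ᵈ-sound : ∀ S S' → T (S ≡ᵈ S') → S ≡ S'
≡ᵈ-sound S S' p = trans (sym (sideDecode-code S))
  (trans (cong sideDecode (≡ᵇ⇒≡ (sideCode S) (sideCode S') p)) (sideDecode-code S'))

_≡ᵍ_ : Bound → Bound → Bool
edge s S K ≡ᵍ edge s' S' K' = (s ≡ˢ s') ∧ (S ≡ᵈ S') ∧ (K ≡ᵈ K')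

≡ᵍ-sound : ∀ b b' → T (b ≡ᵍ b') → b ≡ b'
≡ᵍ-sound (edge s S K) (edge s' S' K') p with split (s ≡ˢ s') p
... | p₁ , p with split (S ≡ᵈ S') p
... | p₂ , p₃ with ≡ˢ-sound s s' p₁ | ≡ᵈ-sound S S' p₂ | ≡ᵈ-sound K K' p₃
... | refl | refl | refl = refl

record Row : Set where
  constructor row
  field
    F₁ F₂ B₀ B₁ B₂ BK : Side
    far : Bound
    aR δR : ℕ

open Row public

toRow : Word → Row
toRow w = row (f₁ w) (f₂ w) (b₀ w) (b₁ w) (b₂ w) (bK w) (bnd w) (a w) (δ₁ w)

-- Continuation style evaluates the table once, before it is used.
force : ∀ {A : Set} → Side → (Side → A) → A
force any k = k any
force ge1 k = k ge1
force ge2 k = k ge2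
force pop0 k = k pop0
force pop0ge1 k = k pop0ge1
force pop00 k = k pop00
force pop1 k = k pop1

force-≡ : ∀ {A : Set} S (k : Side → A) → force S k ≡ k S
force-≡ any k = refl
force-≡ ge1 k = refl
force-≡ ge2 k = refl
force-≡ pop0 k = refl
force-≡ pop0ge1 k = refl
force-≡ pop00 k = refl
force-≡ pop1 k = refl

forceRow : ∀ {A : Set} → Row → (Row → A) → A
forceRow (row F₁ F₂ B₀ B₁ B₂ BK (edge s S₃ SK) x y) k =
  force F₁ λ F₁ → force F₂ λ F₂ → force B₀ λ B₀ → force B₁ λ B₁ → force B₂ λ B₂ → force BK λ BK →
  force S₃ λ S₃ → force SK λ SK → k (row F₁ F₂ B₀ B₁ B₂ BK (edge s S₃ SK) x y)

forceRow-≡ : ∀ {A : Set} r (k : Row → A) → forceRow r k ≡ k r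
forceRow-≡ (row F₁ F₂ B₀ B₁ B₂ BK (edge s S₃ SK) x y) k =
  trans (force-≡ F₁ _) (trans (force-≡ F₂ _) (trans (force-≡ B₀ _) (trans (force-≡ B₁ _) (trans (force-≡ B₂ _)
  (trans (force-≡ BK _) (trans (force-≡ S₃ _) (force-≡ SK _)))))))

Table : Set
Table = List (List Row)

rowsK : ∀ {A : Set} → List Word → (List Row → A) → A
rowsK [] k = k []
rowsK (w ∷ ws) k = forceRow (toRow w) λ r → rowsK ws λ rs → k (r ∷ rs)

rowsK-≡ : ∀ {A : Set} ws (k : List Row → A) → rowsK ws k ≡ k (map toRow ws)
rowsK-≡ [] k = refl
rowsK-≡ (w ∷ ws) k = trans (forceRow-≡ (toRow w) (λ r → rowsK ws λ rs → k (r ∷ rs))) (rowsK-≡ ws (λ rs → k (toRow w ∷ rs)))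

tableK : ∀ {A : Set} → List St → List Word → (Table → A) → A
tableK [] ws k = k []
tableK (s ∷ ss) ws k = rowsK (filterᵇ (λ w → src w ≡ˢ s) ws) λ rs → tableK ss ws λ t → k (rs ∷ t)

table : List St → List Word → Table
table ss ws = map (λ s → map toRow (filterᵇ (λ w → src w ≡ˢ s) ws)) ss

tableK-≡ : ∀ {A : Set} ss ws (k : Table → A) → tableK ss ws k ≡ k (table ss ws)
tableK-≡ [] ws k = refl
tableK-≡ (s ∷ ss) ws k = trans (rowsK-≡ W (λ rs → tableK ss ws λ t → k (rs ∷ t))) (tableK-≡ ss ws (λ t → k (map toRow W ∷ t)))
  where W = filterᵇ (λ w → src w ≡ˢ s) ws

get : Table → ℕ → List Row
get [] _ = []
get (t ∷ ts) 0 = t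
get (t ∷ ts) (suc n) = get ts n

get-table : ∀ s ws → get (table states ws) (code s) ≡ map toRow (filterᵇ (λ w → src w ≡ˢ s) ws)
get-table s0 ws = refl
get-table s1 ws = refl
get-table s2 ws = refl
get-table s3 ws = refl
get-table s4 ws = refl
get-table s5 ws = refl
get-table s6 ws = refl
get-table s* ws = refl

∈-get : ∀ {w} ws → w ∈ ws → toRow w ∈ get (table states ws) (code (src w))
∈-get {w} ws i = subst (toRow w ∈_) (sym (get-table (src w) ws)) (∈-map⁺ toRow (∈-filterᵇ⁺ _ i (≡ˢ-refl (src w))))

-- A flag says that a corigging 0 is added to the first column before a pass.
insP : List Bool → Pattern → Pattern
insP (true ∷ _) A = put pop0 A
insP _ A = A

insC : List Bool → Column → Column
insC (true ∷ _) c = 0 ∷ c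
insC _ c = c

insP-sound : ∀ fl A {c} → In A c → In (insP fl A) (insC fl c)
insP-sound [] A i = i
insP-sound (true ∷ _) A i = put-sound pop0 A i
insP-sound (false ∷ _) A i = i

popFlag : List Bool → List Bool
popFlag [] = []
popFlag (_ ∷ fl) = fl

mutual
  -- The consecutive passes act on the same columns, so the pattern left by one pass is the pattern
  -- met by the next. `A₃` and `AK` belong to lengths 3j-3 and j-1, left open by the preceding
  -- block: there the old word takes its strings and the new word pushes its own.
  next : Table → List Bool → List Bound → (A₁ A₂ A₃ AK : Pattern) → List (List Row)
  next tb fl [] _ _ _ _ = [] ∷ []
  next tb fl (edge s S₃ SK ∷ bs) A₁ A₂ A₃ AK = cross tb fl bs A₁ A₂ (cut S₃ A₃) (cut SK AK) (get tb (code s))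

  cross : Table → List Bool → List Bound → (A₁ A₂ : Pattern) (A₃ AK : Maybe Pattern) → List Row → List (List Row)
  cross tb fl bs A₁ A₂ (just A₃) (just AK) rs = each tb fl bs (insP fl A₁) A₂ A₃ AK rs
  cross tb fl bs A₁ A₂ _ _ rs = []

  each : Table → List Bool → List Bound → (A₁ A₂ A₃ AK : Pattern) → List Row → List (List Row)
  each tb fl bs A₁ A₂ A₃ AK [] = []
  each tb fl bs A₁ A₂ A₃ AK (r ∷ rs) =
    try tb fl bs (cut (F₁ r) A₁) (cut (F₂ r) A₂) A₃ AK r ++ each tb fl bs A₁ A₂ A₃ AK rs

  try : Table → List Bool → List Bound → (A₁ A₂ : Maybe Pattern) (A₃ AK : Pattern) → Row → List (List Row)
  try tb fl bs (just A₁) (just A₂) A₃ AK r =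
    map (r ∷_) (next tb (popFlag fl) bs (put (B₁ r) A₁) (put (B₂ r) A₂) (put (B₀ r) A₃) (put (BK r) AK))
  try tb fl bs _ _ A₃ AK r = []

data Blocks : List Bound → List Bool → (c₁ c₂ p₃ pK : Column) → List Word → Set where
  [] : ∀ {fl c₁ c₂ p₃ pK} → Blocks [] fl c₁ c₂ p₃ pK []
  cons : ∀ {s S₃ SK bs fl c₁ c₂ p₃ pK w ws} → w ∈ words → src w ≡ s → (X₁ X₂ X₀ Y₀ : Column) →
    p₃ ≡ S₃ ▷ X₀ → pK ≡ SK ▷ Y₀ → insC fl c₁ ≡ f₁ w ▷ X₁ → c₂ ≡ f₂ w ▷ X₂ →
    Blocks bs (popFlag fl) (b₁ w ▷ X₁) (b₂ w ▷ X₂) (b₀ w ▷ X₀) (bK w ▷ Y₀) ws →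
    Blocks (edge s S₃ SK ∷ bs) fl c₁ c₂ p₃ pK (w ∷ ws)

next-sound : ∀ {bs fl c₁ c₂ p₃ pK ws} → Blocks bs fl c₁ c₂ p₃ pK ws → ∀ {A₁ A₂ A₃ AK} →
  In A₁ c₁ → In A₂ c₂ → In A₃ p₃ → In AK pK → map toRow ws ∈ next (table states words) fl bs A₁ A₂ A₃ AK
next-sound [] _ _ _ _ = here refl
next-sound {edge s S₃ SK ∷ bs} {fl} (cons {w = w} {ws} i refl X₁ X₂ X₀ Y₀ refl refl e₁ refl B) {A₁} {A₂} {A₃} {AK} i₁ i₂ i₃ iK
  with cut S₃ A₃ | cut-sound S₃ A₃ X₀ i₃ | cut SK AK | cut-sound SK AK Y₀ iK
... | _ | A₃' , refl , i₃' | _ | AK' , refl , iK' = go (get tb (code (src w))) (∈-get words i)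
  where
  tb = table states words
  A₁ⁱ = insP fl A₁
  i₁ⁱ = subst (In A₁ⁱ) e₁ (insP-sound fl A₁ i₁)
  found : map toRow (w ∷ ws) ∈ try tb fl bs (cut (f₁ w) A₁ⁱ) (cut (f₂ w) A₂) A₃' AK' (toRow w)
  found with cut (f₁ w) A₁ⁱ | cut-sound (f₁ w) A₁ⁱ X₁ i₁ⁱ | cut (f₂ w) A₂ | cut-sound (f₂ w) A₂ X₂ i₂
  ... | _ | A₁' , refl , i₁' | _ | A₂' , refl , i₂' = ∈-map⁺ (toRow w ∷_)
    (next-sound B (put-sound (b₁ w) A₁' i₁') (put-sound (b₂ w) A₂' i₂') (put-sound (b₀ w) A₃' i₃') (put-sound (bK w) AK' iK'))
  go : ∀ rs → toRow w ∈ rs → map toRow (w ∷ ws) ∈ each tb fl bs A₁ⁱ A₂ A₃' AK' rs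
  go (_ ∷ rs) (here refl) = ∈-++⁺ˡ found
  go (r ∷ rs) (there j) = ∈-++⁺ʳ (try tb fl bs (cut (F₁ r) A₁ⁱ) (cut (F₂ r) A₂) A₃' AK' r) (go rs j)

insB : ∀ {M} → List Bool → Conf M → Conf M
insB fl [] = []
insB fl (blk C₁ C₂ C₃ CK ∷ C) = blk (insC fl C₁) C₂ C₃ CK ∷ C

data Chain (M : ℕ) : List Bound → List Bool → (p₃ pK : Column) → Conf M → List St → Set where
  [] : ∀ {fl p₃ pK C} → Chain M [] fl p₃ pK C []
  cons : ∀ {s S₃ SK t bs fl p₃ pK C ts} (τ : Trace t s M) (X₀ Y₀ : Column) →
    p₃ ≡ S₃ ▷ X₀ → pK ≡ SK ▷ Y₀ → insB fl C ≡ inp τ →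
    Chain M bs (popFlag fl) (hd₃ τ ▷ X₀) (hdK τ ▷ Y₀) (out τ) ts →
    Chain M (edge s S₃ SK ∷ bs) fl p₃ pK C (t ∷ ts)

firsts : ∀ {M bs fl p₃ pK C ts} → Chain (suc M) bs fl p₃ pK C ts → List Word
firsts [] = []
firsts (cons (step w _ _ _ _ _ _ _) _ _ _ _ _ c) = w ∷ firsts c

-- Transposes the data: passes that each run through all blocks become blocks that are each crossed
-- by all passes.
blocks : ∀ {M bs fl p₃ pK b C ts} (c : Chain (suc M) bs fl p₃ pK (b ∷ C) ts) →
  Blocks bs fl (c₁ b) (c₂ b) p₃ pK (firsts c) × Chain M (map bnd (firsts c)) [] (c₃ b) (cK b) C ts
blocks [] = [] , []
blocks {fl = fl} {b = b} {C} (cons (step w i e X₁ X₂ X₃ Y₃ τ) X₀ Y₀ e₃ eK eC c) with blocks c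
... | B , D = cons i e X₁ X₂ X₀ Y₀ e₃ eK (cong c₁ eb) (cong c₂ eb) B
            , cons τ X₃ Y₃ (cong c₃ eb) (cong cK eb) (trans (nothingIns C) (proj₂ (∷-inj eC))) D
  where
  eb = proj₁ (∷-inj eC)
  nothingIns : ∀ {M} (C : Conf M) → insB [] C ≡ C
  nothingIns [] = refl
  nothingIns (_ ∷ _) = refl

≡ᵍ-refl : ∀ b → T (b ≡ᵍ b)
≡ᵍ-refl (edge s S K) = join (s ≡ˢ s) (≡ˢ-refl s) (join (S ≡ᵈ S) (≡⇒≡ᵇ (sideCode S) (sideCode S) refl) (≡⇒≡ᵇ (sideCode K) (sideCode K) refl))

-- Sets of lists of boundaries, stored as tries to keep the evaluation of search cheap.
data Trie : Set where
  node : Bool → List (Bound × Trie) → Trie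

mutual
  member : List Bound → Trie → Bool
  member [] (node o _) = o
  member (x ∷ xs) (node _ cs) = memberL x xs cs

  memberL : Bound → List Bound → List (Bound × Trie) → Bool
  memberL x xs [] = false
  memberL x xs ((y , t) ∷ cs) = if x ≡ᵍ y then member xs t else memberL x xs cs

mutual
  insert : List Bound → Trie → Trie
  insert [] (node _ cs) = node true cs
  insert (x ∷ xs) (node o cs) = node o (insertL x xs cs)

  insertL : Bound → List Bound → List (Bound × Trie) → List (Bound × Trie)
  insertL x xs [] = (x , insert xs (node false [])) ∷ []
  insertL x xs ((y , t) ∷ cs) = if x ≡ᵍ y then (y , insert xs t) ∷ cs else (y , t) ∷ insertL x xs cs

if-true : ∀ {A : Set} {b} {x y : A} → T b → (if b then x else y) ≡ x
if-true {b = true} _ = refl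

mutual
  member-insert : ∀ xs t → T (member xs (insert xs t))
  member-insert [] (node _ _) = tt
  member-insert (x ∷ xs) (node _ cs) = memberL-insert x xs cs

  memberL-insert : ∀ x xs cs → T (memberL x xs (insertL x xs cs))
  memberL-insert x xs [] = subst T (sym (if-true (≡ᵍ-refl x))) (member-insert xs (node false []))
  memberL-insert x xs ((y , t) ∷ cs) with x ≡ᵍ y in eq
  ... | true = subst T (sym (if-true (subst T (sym eq) tt))) (member-insert xs t)
  ... | false rewrite eq = memberL-insert x xs cs

mutual
  insert-⊇ : ∀ n t xs → T (member xs t) → T (member xs (insert n t))
  insert-⊇ [] (node _ cs) [] m = tt
  insert-⊇ [] (node _ cs) (x ∷ xs) m = m
  insert-⊇ (y ∷ n) (node _ cs) [] m = m
  insert-⊇ (y ∷ n) (node _ cs) (x ∷ xs) m = insertL-⊇ y n cs x xs m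

  insertL-⊇ : ∀ y n cs x xs → T (memberL x xs cs) → T (memberL x xs (insertL y n cs))
  insertL-⊇ y n ((z , t) ∷ cs) x xs m with y ≡ᵍ z
  ... | true with x ≡ᵍ z
  ... | true = insert-⊇ n t xs m
  ... | false = m
  insertL-⊇ y n ((z , t) ∷ cs) x xs m | false with x ≡ᵍ z
  ... | true = m
  ... | false = insertL-⊇ y n cs x xs m

mutual
  insert-⊆ : ∀ n t xs → T (member xs (insert n t)) → T (member xs t) ⊎ xs ≡ n
  insert-⊆ [] (node _ cs) [] m = inj₂ refl
  insert-⊆ [] (node _ cs) (x ∷ xs) m = inj₁ m
  insert-⊆ (y ∷ n) (node _ cs) [] m = inj₁ m
  insert-⊆ (y ∷ n) (node _ cs) (x ∷ xs) m = insertL-⊆ y n cs x xs m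

  insertL-⊆ : ∀ y n cs x xs → T (memberL x xs (insertL y n cs)) → T (memberL x xs cs) ⊎ x ∷ xs ≡ y ∷ n
  insertL-⊆ y n [] x xs m with x ≡ᵍ y in eq
  ... | true with insert-⊆ n (node false []) xs m
  ... | inj₂ e = inj₂ (cong₂ _∷_ (≡ᵍ-sound x y (subst T (sym eq) tt)) e)
  ... | inj₁ m' = ⊥-elim (empty xs m')
    where
    empty : ∀ xs → T (member xs (node false [])) → ⊥
    empty [] ()
    empty (_ ∷ _) ()
  insertL-⊆ y n ((z , t) ∷ cs) x xs m with y ≡ᵍ z in eq
  insertL-⊆ y n ((z , t) ∷ cs) x xs m | true with x ≡ᵍ z in eq'
  ... | false = inj₁ m
  ... | true with insert-⊆ n t xs m
  ... | inj₁ m' = inj₁ m'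
  ... | inj₂ e = inj₂ (cong₂ _∷_ (trans (≡ᵍ-sound x z (subst T (sym eq') tt)) (sym (≡ᵍ-sound y z (subst T (sym eq) tt)))) e)
  insertL-⊆ y n ((z , t) ∷ cs) x xs m | false with x ≡ᵍ z
  ... | true = inj₁ m
  ... | false = insertL-⊆ y n cs x xs m

-- Closed sets of boundary situations

everything : Pattern
everything = pat [] 0

-- The columns of a new block are unconstrained, and those still open at the boundary are kept only
-- through the sides in `Bound`. So the list of boundaries, one for each pass, is the whole memory,
-- and finitely many situations arise however many blocks there are.
succs : Table → List Bound → List (List Bound)
succs tb bs = map (map far) (next tb [] bs everything everything everything everything)

addAll : List (List Bound) → Trie × List (List Bound) → Trie × List (List Bound)
addAll [] VQ = VQ
addAll (n ∷ ns) (V , Q) = if member n V then addAll ns (V , Q) else addAll ns (insert n V , n ∷ Q)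

record Added (ns : List (List Bound)) (V : Trie) (Q : List (List Bound)) (V' : Trie) (Q' : List (List Bound)) : Set where
  field
    V⊆ : ∀ m → T (member m V) → T (member m V')
    Q⊆ : ∀ {m} → m ∈ Q → m ∈ Q'
    ns⊆ : ∀ {m} → m ∈ ns → T (member m V')
    new : ∀ m → T (member m V') → T (member m V) ⊎ m ∈ Q'

open Added

added : ∀ ns V Q → Added ns V Q (proj₁ (addAll ns (V , Q))) (proj₂ (addAll ns (V , Q)))
added [] V Q = record { V⊆ = λ _ m → m ; Q⊆ = λ i → i ; ns⊆ = λ () ; new = λ _ → inj₁ }
added (n ∷ ns) V Q with member n V in eq
... | true = let A = added ns V Q in record
  { V⊆ = V⊆ A ; Q⊆ = Q⊆ A ; new = new A
  ; ns⊆ = λ { (here refl) → V⊆ A n (subst T (sym eq) tt) ; (there i) → ns⊆ A i } }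
... | false = let A = added ns (insert n V) (n ∷ Q) in record
  { V⊆ = λ m p → V⊆ A m (insert-⊇ n V m p) ; Q⊆ = λ i → Q⊆ A (there i)
  ; ns⊆ = λ { (here refl) → V⊆ A n (member-insert n V) ; (there i) → ns⊆ A i }
  ; new = λ m p → back m (new A m p) (Q⊆ A) }
  where
  back : ∀ m {Q'} → T (member m (insert n V)) ⊎ m ∈ Q' → (∀ {m} → m ∈ n ∷ Q → m ∈ Q') → T (member m V) ⊎ m ∈ Q'
  back m (inj₂ i) _ = inj₂ i
  back m (inj₁ p) q with insert-⊆ n V m p
  ... | inj₁ p' = inj₁ p'
  ... | inj₂ refl = inj₂ (q (here refl))

-- The fuel bounds the number of situations; the answer is false when it runs out.
search : ℕ → (List Bound → Bool) → Table → Trie × List (List Bound) → Bool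
search zero good tb _ = false
search (suc k) good tb (V , []) = true
search (suc k) good tb (V , n ∷ Q) = good n ∧ search k good tb (addAll (succs tb n) (V , Q))

record Closed (good : List Bound → Bool) (tb : Table) (W : Trie) (n : List Bound) : Set where
  field
    isGood : T (good n)
    inside : ∀ {m} → m ∈ succs tb n → T (member m W)

open Closed

-- `W` is the final set of visited situations. The last clause leaves unprocessed only what was in
-- `V` at the outset; the search is started with all of `V` in the queue, so there `W` is closed.
search-sound : ∀ k good tb V Q → T (search k good tb (V , Q)) → ∃ λ W →
  (∀ m → T (member m V) → T (member m W)) ×
  (∀ m → m ∈ Q → Closed good tb W m) ×
  (∀ m → T (member m W) → T (member m V) ⊎ Closed good tb W m)
search-sound (suc k) good tb V [] _ = V , (λ _ m → m) , (λ _ ()) , λ _ → inj₁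
search-sound (suc k) good tb V (n ∷ Q) p = go (search-sound k good tb V' Q' (proj₂ (split (good n) p)))
  where
  V' = proj₁ (addAll (succs tb n) (V , Q))
  Q' = proj₂ (addAll (succs tb n) (V , Q))
  A = added (succs tb n) V Q
  Result : Trie → List (List Bound) → Set
  Result V Q = ∃ λ W → (∀ m → T (member m V) → T (member m W)) × (∀ m → m ∈ Q → Closed good tb W m) ×
    (∀ m → T (member m W) → T (member m V) ⊎ Closed good tb W m)
  go : Result V' Q' → Result V (n ∷ Q)
  go (W , VW , QW , WV) = W , (λ m p → VW m (V⊆ A m p)) , queue , (λ m q → old m (WV m q))
    where
    queue : ∀ m → m ∈ n ∷ Q → Closed good tb W m
    queue m (here refl) = record { isGood = proj₁ (split (good n) p) ; inside = λ {m} i → VW m (ns⊆ A i) }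
    queue m (there i) = QW m (Q⊆ A i)
    old : ∀ m → T (member m V') ⊎ Closed good tb W m → T (member m V) ⊎ Closed good tb W m
    old m (inj₂ c) = inj₂ c
    old m (inj₁ q) with new A m q
    ... | inj₁ v = inj₁ v
    ... | inj₂ i = inj₂ (QW m i)

Label : Set
Label = ℕ × ℕ

_≡ˡ_ : Label → Label → Bool
(r , d) ≡ˡ (r' , d') = (r ≡ᵇ r') ∧ (d ≡ᵇ d')

≡ˡ-sound : ∀ l l' → T (l ≡ˡ l') → l ≡ l'
≡ˡ-sound (r , d) (r' , d') p with split (r ≡ᵇ r') p
... | p₁ , p₂ = cong₂ _,_ (≡ᵇ⇒≡ r r' p₁) (≡ᵇ⇒≡ d d' p₂)

module Explore (flags : List Bool) (A⁰ : Pattern) (label : List Row → Label) (claim : Label → List St → Bool) where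

  -- At the far end the open columns of the last block are completed by `e₃` and `eK`, pass after
  -- pass. A situation that cannot end there (a state `s*`, or an impossible column) satisfies the
  -- claim vacuously.
  finish : (List St → Bool) → List Bound → (A₃ AK : Pattern) → Bool
  finish P [] _ _ = P []
  finish P (edge s S₃ SK ∷ bs) A₃ AK with plain s | cut S₃ A₃ | cut SK AK
  ... | true | just A₃' | just AK' = finish (λ ss → P (s ∷ ss)) bs (put (e₃ s) A₃') (put (eK s) AK')
  ... | _ | _ | _ = true

  bottoms : List Bound
  bottoms = map (λ _ → edge s0 any any) flags

  inits : Table → List (List Row)
  inits tb = next tb flags bottoms A⁰ everything everything everything

  good : Label → List Bound → Bool
  good l n = finish (claim l) n everything everything

  start : Table → Label → Trie × List (List Bound)
  start tb l = addAll (map (map far) (filterᵇ (λ rs → label rs ≡ˡ l) (inits tb))) (node false [] , [])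

  one-of : Label → List Label → Bool
  one-of l [] = false
  one-of l (l' ∷ ls) = (l ≡ˡ l') ∨ one-of l ls

  check' : List Label → Table → Bool
  check' ls tb = all∈ (λ rs → one-of (label rs) ls) (inits tb) ∧ all∈ (λ l → search 20000 (good l) tb (start tb l)) ls

  check : List Label → List Word → Bool
  check ls ws = tableK states ws (check' ls)

  finish-sound : ∀ P {bs p₃ pK ts A₃ AK} → T (finish P bs A₃ AK) → In A₃ p₃ → In AK pK → Chain 0 bs [] p₃ pK [] ts → T (P ts)
  finish-sound P p i₃ iK [] = p
  finish-sound P {edge s S₃ SK ∷ bs} {A₃ = A₃} {AK} p i₃ iK (cons (done pl) X₀ Y₀ refl refl _ c)
    with plain s | pl | cut S₃ A₃ | cut-sound S₃ A₃ X₀ i₃ | cut SK AK | cut-sound SK AK Y₀ iK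
  ... | true | _ | _ | A₃' , refl , i₃' | _ | AK' , refl , iK' =
    finish-sound (λ ss → P (s ∷ ss)) p (put-sound (e₃ s) A₃' i₃') (put-sound (eK s) AK' iK') c

  far-toRow : ∀ ws → map far (map toRow ws) ≡ map bnd ws
  far-toRow [] = refl
  far-toRow (w ∷ ws) = cong (_ ∷_) (far-toRow ws)

  run-sound : ∀ l W → (∀ m → T (member m W) → Closed (good l) (table states words) W m) →
    ∀ {M} bs {p₃ pK} {C : Conf M} {ts} → T (member bs W) → Chain M bs [] p₃ pK C ts → T (claim l ts)
  run-sound l W cl {zero} bs {C = []} m c = finish-sound (claim l) (isGood (cl bs m)) (anything _) (anything _) c
  run-sound l W cl {suc M} bs {C = b ∷ C} m c = run-sound l W cl (map bnd (firsts c))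
    (subst (λ n → T (member n W)) (far-toRow (firsts c))
      (inside (cl bs m) (∈-map⁺ (map far) (next-sound (proj₁ (blocks c)) (anything _) (anything _) (anything _) (anything _)))))
    (proj₂ (blocks c))

  one-of-sound : ∀ l ls → T (one-of l ls) → l ∈ ls
  one-of-sound l (l' ∷ ls) p with l ≡ˡ l' in eq
  ... | true = here (≡ˡ-sound l l' (subst T (sym eq) tt))
  ... | false = there (one-of-sound l ls p)

  ≡ˡ-refl : ∀ l → T (l ≡ˡ l)
  ≡ˡ-refl (r , d) = join (r ≡ᵇ r) (≡⇒≡ᵇ r r refl) (≡⇒≡ᵇ d d refl)

  chain-sound : (ls : List Label) → T (check ls words) → ∀ {M p₃ pK b C ts} → In A⁰ (c₁ b) →
    (c : Chain (suc M) bottoms flags p₃ pK (b ∷ C) ts) → T (claim (label (map toRow (firsts c))) ts)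
  chain-sound ls ok {ts = ts} i c =
    go (search-sound 20000 (good l) tb _ _ (all∈-sound (λ l → search 20000 (good l) tb (start tb l)) {ls} (proj₂ parts)
         (one-of-sound l ls (all∈-sound (λ rs → one-of (label rs) ls) (proj₁ parts) rs∈))))
    where
    tb = table states words
    l = label (map toRow (firsts c))
    parts = split (all∈ (λ rs → one-of (label rs) ls) (inits tb)) (subst T (tableK-≡ states words (check' ls)) ok)
    rs∈ : map toRow (firsts c) ∈ inits tb
    rs∈ = next-sound (proj₁ (blocks c)) i (anything _) (anything _) (anything _)
    seeds = map (map far) (filterᵇ (λ rs → label rs ≡ˡ l) (inits tb))
    A = added seeds (node false []) []
    empty : ∀ xs → T (member xs (node false [])) → ⊥
    empty [] ()
    empty (_ ∷ _) ()
    go : (∃ λ W → (∀ m → T (member m (proj₁ (start tb l))) → T (member m W)) ×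
           (∀ m → m ∈ proj₂ (start tb l) → Closed (good l) tb W m) ×
           (∀ m → T (member m W) → T (member m (proj₁ (start tb l))) ⊎ Closed (good l) tb W m)) → T (claim l ts)
    go (W , VW , QW , WV) = run-sound l W closed (map bnd (firsts c))
        (VW (map bnd (firsts c)) (ns⊆ A (subst (_∈ seeds) (far-toRow (firsts c))
          (∈-map⁺ (map far) (∈-filterᵇ⁺ (λ rs → label rs ≡ˡ l) rs∈ (≡ˡ-refl l)))))) (proj₂ (blocks c))
      where
      closed : ∀ m → T (member m W) → Closed (good l) tb W m
      closed m p with WV m p
      ... | inj₂ c = c
      ... | inj₁ v with new A m v
      ... | inj₂ i = QW m i
      ... | inj₁ e = ⊥-elim (empty m e)


-- The elements of B⁽²'¹⁾ as columns of two elements of B⁽¹'¹⁾.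
pair : St → St → Maybe B
pair s1 s0 = just b1
pair s2 s0 = just b2
pair s2 s1 = just b3
pair s3 s1 = just b4
pair s3 s2 = just b5
pair s4 s1 = just b6
pair s3 s3 = just b7
pair s4 s2 = just b8
pair s4 s3 = just b9
pair s5 s2 = just b10
pair s5 s3 = just b11
pair s5 s4 = just b12
pair s6 s4 = just b13
pair s6 s5 = just b14
pair s6 s0 = just ∅
pair _ _ = nothing

isEmpty : B → ℕ
isEmpty ∅ = 1
isEmpty _ = 0

-- The number of parts that ν⁽²⁾ loses.
drop : B → B → ℕ
drop b b' = (∣ H b b' ∣ + isEmpty b) ∸ isEmpty b'

-- Parts lost equal boxes lost in the leftmost column, so the label is visible in the block of the
-- shortest strings: the parts of ν⁽²⁾ lost in two passes, and the parts of ν⁽¹⁾ lost in the former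
-- of them.
labelR : List Row → Label
labelR (r ∷ r' ∷ _) = aR r + aR r' , δR r
labelR _ = 0 , 0

claimR : Label → List St → Bool
claimR (n , d) (x ∷ y ∷ x' ∷ y' ∷ []) with pair x y | pair x' y'
... | just b | just b' = (n ≡ᵇ drop b b') ∧ (d ≡ᵇ 1 + isEmpty b)
... | _ | _ = false
claimR _ _ = false

claimN : Label → List St → Bool
claimN _ (x ∷ y ∷ []) with pair x y
... | just _ = false
... | nothing = true
claimN _ _ = false

-- Four passes are two successive removals, with a singular string added before each, as needed for
-- `H` of two neighbours. In `Unpaired` the pattern `pat [] 1` says that no string of length 1 is
-- singular; two passes then never form a column, so undoing the removal of an element always
-- exposes the string that was added.
module Removed = Explore (true ∷ false ∷ true ∷ false ∷ []) everything labelR claimR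
module Unpaired = Explore (false ∷ false ∷ []) (pat [] 1) (λ _ → 0 , 0) claimN

-- Labels are collected from the block of the shortest strings alone. Since `drop` is at most 2, the
-- check also shows that no run with 3 or 4 lost parts of ν⁽²⁾ reaches the far end.
labels : List Label
labels = (0 , 1) ∷ (1 , 1) ∷ (2 , 1) ∷ (2 , 2) ∷ (3 , 1) ∷ (3 , 2) ∷ (4 , 2) ∷ []

opaque
  unfolding words

  unpaired-checked : Unpaired.check ((0 , 0) ∷ []) words ≡ true
  unpaired-checked = refl

  removed-checked : Removed.check labels words ≡ true
  removed-checked = refl


-- The charge

cs : Column → ℕ
cs [] = 0
cs (x ∷ X) = x * suc (length X) + cs X

cs-shift : ∀ r X → cs (shift r X) ≡ r * length X + cs X
cs-shift r [] = sym (trans (NP.+-identityʳ (r * 0)) (NP.*-zeroʳ r))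
cs-shift r (x ∷ X) = eq r x (length X) (cs X)
  where
  eq : ∀ r x l c → (r + x) * suc l + c ≡ r * suc l + (x * suc l + c)
  eq = NR.solve-∀

cs-▷ : ∀ S X → cs (S ▷ X) ≡ pv S + (bs S * length X + cs X)
cs-▷ any X = refl
cs-▷ ge1 X = cs-shift 1 X
cs-▷ ge2 X = cs-shift 2 X
cs-▷ pop0 X = refl
cs-▷ pop0ge1 X = cs-shift 1 X
cs-▷ pop00 X = refl
cs-▷ pop1 X = eq (length X) (cs X)
  where
  eq : ∀ l c → 1 * suc l + c ≡ 1 + (1 * l + c)
  eq = NR.solve-∀

csᶻ : ∀ S X → + cs (S ▷ X) ≡ + pv S ⊕ (+ bs S ⊛ + length X ⊕ + cs X)
csᶻ S X = trans (cong +_ (cs-▷ S X)) (cong (λ z → + pv S ⊕ (z ⊕ + cs X)) (ZP.pos-* (bs S) (length X)))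

quad : ℤ → ℤ → ℤ → ℤ → ℤ
quad x y z k = x ⊛ x ⊕ (y ⊛ y ⊕ z ⊛ z) - (x ⊕ (y ⊕ z)) ⊛ k ⊕ k ⊛ k

-- This is minus the charge. With Q the quadratic form, c(ν) is Q - L·(parts of ν⁽²⁾), the sum of
-- all vacancy numbers over strings is L·(parts of ν⁽²⁾) - 2Q, and |J| is that sum minus the
-- coriggings. So L cancels, and configurations for different L can be compared.
energy : ∀ {M} → Conf M → ℤ
energy [] = 0ℤ
energy (b ∷ C) = quad (+ m₁) (+ m₂) (+ m₃) (+ NK) ⊕ (+ cs (c₁ b) ⊕ (+ cs (c₂ b) ⊕ (+ cs (c₃ b) ⊕ + cs (cK b)))) ⊕ energy C
  where open Vac b (#₁ C) (#K C)

ω₀ ω₁ ω₂ ω₃ ωK₀ ωK₃ : Word → ℤ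
ω₀ w = + gS (src w) - + hS (src w)
ω₁ w = + G₁ w - + H₁ w
ω₂ w = + G₂ w - + H₂ w
ω₃ w = + gS (tgt w) - + hS (tgt w)
ωK₀ w = + gK (src w) - + hK (src w)
ωK₃ w = + gK (tgt w) - + hK (tgt w)

-- What is left of the change of energy across a block once everything that
-- involves the numbers of strings has cancelled.
residue : Word → ℤ
residue w =
  (+ δ₁ w ⊛ + δ₁ w ⊕ + δ₂ w ⊛ + δ₂ w ⊕ + δ₃ w ⊛ + δ₃ w - + a w ⊛ (+ δ₁ w ⊕ (+ δ₂ w ⊕ + δ₃ w)) ⊕ + a w ⊛ + a w)
  ⊕ (ω₃ w ⊛ + st (tgt w) - ω₁ w ⊛ + np (b₁ w) - ω₂ w ⊛ + np (b₂ w))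
  ⊕ (+ pv (f₁ w) - + pv (b₁ w) ⊕ (+ pv (f₂ w) - + pv (b₂ w)) ⊕ + pv (f₃ w) ⊕ + st (tgt w))
  - (ω₀ w ⊛ + δ₁ w ⊕ ωK₀ w ⊛ + a w ⊕ (+ pv (b₀ w) ⊕ + st (src w)))

opaque
  unfolding words

  residue≡0 : ∀ {w} → w ∈ words → residue w ≡ 0ℤ
  residue≡0 {w} i = ZP.∣i∣≡0⇒i≡0 (eqn (λ w → ∣ residue w ∣) (λ _ → 0) {words} refl i)
  pv-fK≡0 : ∀ {w} → w ∈ words → pv (fK w) ≡ 0
  pv-fK≡0 = eqn (λ w → pv (fK w)) (λ _ → 0) {words} refl
  pv-bK≡0 : ∀ {w} → w ∈ words → pv (bK w) ≡ 0
  pv-bK≡0 = eqn (λ w → pv (bK w)) (λ _ → 0) {words} refl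

opaque
  unfolding allSt

  pv-e₃≡0 : ∀ s → pv (e₃ s) ≡ 0
  pv-e₃≡0 = eqnSt (λ s → pv (e₃ s)) (λ _ → 0) refl
  pv-eK≡0 : ∀ s → pv (eK s) ≡ 0
  pv-eK≡0 = eqnSt (λ s → pv (eK s)) (λ _ → 0) refl

pv-hdK≡0 : ∀ {t s M} (τ : Trace t s M) → pv (hdK τ) ≡ 0
pv-hdK≡0 {t} (done _) = pv-eK≡0 t
pv-hdK≡0 (step w i refl _ _ _ _ _) = pv-bK≡0 i

-- ω₁ = ω₀ + a - 2δ₁ and so on, from the corresponding equations between naturals.
diff : ∀ G h H g δ a → G + h + (δ + δ) ≡ H + g + a → + G - + H ≡ (+ g - + h) ⊕ + a - (+ δ ⊕ + δ)
diff G h H g δ a e = ≡-via (trans (eq (+ G) (+ h) (+ H) (+ g) (+ δ) (+ a)) (ZP.i≡j⇒i-j≡0 (cong +_ e)))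
  where
  eq : ∀ G h H g δ a → (G - H) - ((g - h) ⊕ a - (δ ⊕ δ)) ≡ (G ⊕ h ⊕ (δ ⊕ δ)) - (H ⊕ g ⊕ a)
  eq = ZR.solve-∀

diffK : ∀ G h H g δ₁ δ₂ δ₃ a → G + h + (a + a) ≡ H + g + (δ₁ + (δ₂ + δ₃)) →
  + G - + H ≡ (+ g - + h) ⊕ (+ δ₁ ⊕ (+ δ₂ ⊕ + δ₃)) - (+ a ⊕ + a)
diffK G h H g δ₁ δ₂ δ₃ a e = ≡-via (trans (eq (+ G) (+ h) (+ H) (+ g) (+ δ₁) (+ δ₂) (+ δ₃) (+ a)) (ZP.i≡j⇒i-j≡0 (cong +_ e)))
  where
  eq : ∀ G h H g δ₁ δ₂ δ₃ a → (G - H) - ((g - h) ⊕ (δ₁ ⊕ (δ₂ ⊕ δ₃)) - (a ⊕ a)) ≡ (G ⊕ h ⊕ (a ⊕ a)) - (H ⊕ g ⊕ (δ₁ ⊕ (δ₂ ⊕ δ₃)))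
  eq = ZR.solve-∀

quad-step : ∀ x y z k d e f a → quad (x ⊕ d) (y ⊕ e) (z ⊕ f) (k ⊕ a) ≡
  quad x y z k ⊕ ((d ⊕ d - a) ⊛ x ⊕ (e ⊕ e - a) ⊛ y ⊕ (f ⊕ f - a) ⊛ z ⊕ (a ⊕ a - (d ⊕ (e ⊕ f))) ⊛ k)
    ⊕ (d ⊛ d ⊕ e ⊛ e ⊕ f ⊛ f - a ⊛ (d ⊕ (e ⊕ f)) ⊕ a ⊛ a)
quad-step = expand
  where
  expand : ∀ x y z k d e f a →
    ((x ⊕ d) ⊛ (x ⊕ d) ⊕ ((y ⊕ e) ⊛ (y ⊕ e) ⊕ (z ⊕ f) ⊛ (z ⊕ f)) - ((x ⊕ d) ⊕ ((y ⊕ e) ⊕ (z ⊕ f))) ⊛ (k ⊕ a) ⊕ (k ⊕ a) ⊛ (k ⊕ a)) ≡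
    (x ⊛ x ⊕ (y ⊛ y ⊕ z ⊛ z) - (x ⊕ (y ⊕ z)) ⊛ k ⊕ k ⊛ k)
    ⊕ ((d ⊕ d - a) ⊛ x ⊕ (e ⊕ e - a) ⊛ y ⊕ (f ⊕ f - a) ⊛ z ⊕ (a ⊕ a - (d ⊕ (e ⊕ f))) ⊛ k)
    ⊕ (d ⊛ d ⊕ e ⊛ e ⊕ f ⊛ f - a ⊛ (d ⊕ (e ⊕ f)) ⊕ a ⊛ a)
  expand = ZR.solve-∀

-- Abel summation of the weights against the numbers of strings.
abel : ∀ ω a d e f u₁ u₂ u₃ l₁ l₂ l₃ s n →
  (let ω₁ = ω ⊕ a - (d ⊕ d) ; ω₂ = ω₁ ⊕ a - (e ⊕ e) ; ω₃ = ω₂ ⊕ a - (f ⊕ f)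
       z = u₃ ⊕ l₃ ⊕ n ; y = u₂ ⊕ l₂ ⊕ z ; x = u₁ ⊕ l₁ ⊕ y) →
  ω₁ ⊛ l₁ ⊕ ω₂ ⊛ l₂ ⊕ ω₃ ⊛ l₃ ⊕ ω₃ ⊛ (n ⊕ (u₃ ⊕ s)) ≡
  ω ⊛ x - ((d ⊕ d - a) ⊛ x ⊕ (e ⊕ e - a) ⊛ y ⊕ (f ⊕ f - a) ⊛ z) ⊕ (ω₃ ⊛ s - ω₁ ⊛ u₁ - ω₂ ⊛ u₂)
abel = ZR.solve-∀

abel' : ∀ ω ω₁ ω₂ ω₃ a d e f u₁ u₂ u₃ l₁ l₂ l₃ s n →
  ω₁ ≡ ω ⊕ a - (d ⊕ d) → ω₂ ≡ ω₁ ⊕ a - (e ⊕ e) → ω₃ ≡ ω₂ ⊕ a - (f ⊕ f) →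
  (let z = u₃ ⊕ l₃ ⊕ n ; y = u₂ ⊕ l₂ ⊕ z ; x = u₁ ⊕ l₁ ⊕ y) →
  ω₁ ⊛ l₁ ⊕ ω₂ ⊛ l₂ ⊕ ω₃ ⊛ l₃ ⊕ ω₃ ⊛ (n ⊕ (u₃ ⊕ s)) ≡
  ω ⊛ x - ((d ⊕ d - a) ⊛ x ⊕ (e ⊕ e - a) ⊛ y ⊕ (f ⊕ f - a) ⊛ z) ⊕ (ω₃ ⊛ s - ω₁ ⊛ u₁ - ω₂ ⊛ u₂)
abel' ω _ _ _ a d e f u₁ u₂ u₃ l₁ l₂ l₃ s n refl refl refl = abel ω a d e f u₁ u₂ u₃ l₁ l₂ l₃ s n

abelK : ∀ ω ωK a d e f u y N → ωK ≡ ω ⊕ (d ⊕ (e ⊕ f)) - (a ⊕ a) →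
  ωK ⊛ y ⊕ ωK ⊛ (N ⊕ u) ≡ ω ⊛ (u ⊕ y ⊕ N) - (a ⊕ a - (d ⊕ (e ⊕ f))) ⊛ (u ⊕ y ⊕ N)
abelK ω _ a d e f u y N refl = eq ω a d e f u y N
  where
  eq : ∀ ω a d e f u y N → (let ωK = ω ⊕ (d ⊕ (e ⊕ f)) - (a ⊕ a)) →
    ωK ⊛ y ⊕ ωK ⊛ (N ⊕ u) ≡ ω ⊛ (u ⊕ y ⊕ N) - (a ⊕ a - (d ⊕ (e ⊕ f))) ⊛ (u ⊕ y ⊕ N)
  eq = ZR.solve-∀

columns : ∀ p₁ q₁ p₂ q₂ p₃ q₃ g₁ h₁ g₂ h₂ g₃ h₃ gk hk s l₁ l₂ l₃ y k₁ k₂ k₃ k →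
  (p₁ ⊕ (g₁ ⊛ l₁ ⊕ k₁)) ⊕ ((p₂ ⊕ (g₂ ⊛ l₂ ⊕ k₂)) ⊕ ((p₃ ⊕ ((g₃ ⊕ s) ⊛ l₃ ⊕ k₃)) ⊕ (gk ⊛ y ⊕ k))) ≡
  (q₁ ⊕ (h₁ ⊛ l₁ ⊕ k₁)) ⊕ ((q₂ ⊕ (h₂ ⊛ l₂ ⊕ k₂)) ⊕ ((q₃ ⊕ ((h₃ ⊕ s) ⊛ l₃ ⊕ k₃)) ⊕ (hk ⊛ y ⊕ k)))
  ⊕ ((g₁ - h₁) ⊛ l₁ ⊕ (g₂ - h₂) ⊛ l₂ ⊕ (g₃ - h₃) ⊛ l₃) ⊕ (gk - hk) ⊛ y ⊕ (p₁ - q₁ ⊕ (p₂ - q₂) ⊕ p₃ - q₃)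
columns = ZR.solve-∀

glue : ∀ Q A AK Δ C L LK Pv q₃ E W WK s W₀x W₀d V₀k V₀a t R Z →
  L ⊕ W ≡ W₀x - A ⊕ R → LK ⊕ WK ≡ V₀k - AK → Δ ⊕ R ⊕ (Pv ⊕ s) - Z ≡ 0ℤ → Z ≡ W₀d ⊕ V₀a ⊕ t →
  (Q ⊕ (A ⊕ AK) ⊕ Δ) ⊕ (C ⊕ L ⊕ LK ⊕ (Pv - q₃)) ⊕ (E ⊕ W ⊕ WK ⊕ (q₃ ⊕ s)) ≡
  (Q ⊕ C ⊕ E) ⊕ (W₀x ⊕ W₀d) ⊕ (V₀k ⊕ V₀a) ⊕ t
glue Q A AK Δ C L LK Pv q₃ E W WK s W₀x W₀d V₀k V₀a t R _ e₁ e₂ e₃ refl = ≡-via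
  (trans (eq Q A AK Δ C L LK Pv q₃ E W WK s W₀x W₀d V₀k V₀a t R)
  (cong₂ _⊕_ (cong₂ _⊕_ (ZP.i≡j⇒i-j≡0 e₁) (ZP.i≡j⇒i-j≡0 e₂)) e₃))
  where
  eq : ∀ Q A AK Δ C L LK Pv q₃ E W WK s W₀x W₀d V₀k V₀a t R →
    ((Q ⊕ (A ⊕ AK) ⊕ Δ) ⊕ (C ⊕ L ⊕ LK ⊕ (Pv - q₃)) ⊕ (E ⊕ W ⊕ WK ⊕ (q₃ ⊕ s)))
      - ((Q ⊕ C ⊕ E) ⊕ (W₀x ⊕ W₀d) ⊕ (V₀k ⊕ V₀a) ⊕ t) ≡
    ((L ⊕ W) - (W₀x - A ⊕ R)) ⊕ ((LK ⊕ WK) - (V₀k - AK)) ⊕ (Δ ⊕ R ⊕ (Pv ⊕ s) - (W₀d ⊕ V₀a ⊕ t))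
  eq = ZR.solve-∀

-- These are φ₁ - ε₁ and φ₂ - ε₂, the coordinates of the weight of a vertex of `B^{1,1}`, with `s*`
-- counted as `s3`.
ωS ωKS : St → ℤ
ωS s = + gS s - + hS s
ωKS s = + gK s - + hK s

-- The general source is forced by the induction, since the rest of a trace starts in another state;
-- the coefficients are the drops of the vacancy numbers at that state. From `s0` only the number of
-- strings of ν⁽¹⁾ survives.
energy-out : ∀ {t s M} (τ : Trace t s M) →
  energy (inp τ) ≡ energy (out τ) ⊕ ωS s ⊛ + #₁ (inp τ) ⊕ ωKS s ⊛ + #K (inp τ) ⊕ (+ pv (hd₃ τ) ⊕ + st s)
energy-out {t} (done p) = sym (trans (cong₂ (λ x y → 0ℤ ⊕ ωS t ⊛ + 0 ⊕ ωKS t ⊛ + 0 ⊕ (+ x ⊕ + y)) (pv-e₃≡0 t) (st-plain t p)) (eq (ωS t) (ωKS t)))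
  where
  eq : ∀ x y → 0ℤ ⊕ x ⊛ + 0 ⊕ y ⊛ + 0 ⊕ (+ 0 ⊕ + 0) ≡ 0ℤ
  eq = ZR.solve-∀
energy-out (step w i refl X₁ X₂ X₃ Y₃ τ) = trans (cong₂ _⊕_ (cong₂ _⊕_ before cin) rec) (trans joined after)
  where
  open Crossing w i X₁ X₂ X₃ Y₃ τ
  d = + δ₁ w
  e = + δ₂ w
  f = + δ₃ w
  α = + a w
  s = + st (tgt w)
  l₁ = + length X₁
  l₂ = + length X₂
  l₃ = + length X₃
  l = + length Y₃
  u₁ = + np (b₁ w)
  u₂ = + np (b₂ w)
  u₃ = + np (hd₃ τ)
  uK = + np (hdK τ)
  n = + #₁ (out τ)
  n' = + #K (out τ)
  z = u₃ ⊕ l₃ ⊕ n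
  y = u₂ ⊕ l₂ ⊕ z
  x = u₁ ⊕ l₁ ⊕ y
  k = uK ⊕ l ⊕ n'
  q₃ = + pv (hd₃ τ)
  z≡ : + O.m₃ ≡ z
  z≡ = cong (λ m → + (m + #₁ (out τ))) (length-▷ (hd₃ τ) X₃)
  y≡ : + O.m₂ ≡ y
  y≡ = cong₂ (λ a b → + a ⊕ b) (length-▷ (b₂ w) X₂) z≡
  x≡ : + O.m₁ ≡ x
  x≡ = cong₂ (λ a b → + a ⊕ b) (length-▷ (b₁ w) X₁) y≡
  k≡ : + O.NK ≡ k
  k≡ = cong (λ m → + (m + #K (out τ))) (length-▷ (hdK τ) Y₃)
  A = (d ⊕ d - α) ⊛ x ⊕ (e ⊕ e - α) ⊛ y ⊕ (f ⊕ f - α) ⊛ z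
  AK = (α ⊕ α - (d ⊕ (e ⊕ f))) ⊛ k
  Δ = d ⊛ d ⊕ e ⊛ e ⊕ f ⊛ f - α ⊛ (d ⊕ (e ⊕ f)) ⊕ α ⊛ α
  before : quad (+ I.m₁) (+ I.m₂) (+ I.m₃) (+ I.NK) ≡ quad x y z k ⊕ (A ⊕ AK) ⊕ Δ
  before = trans (cong₄ (trans (cong +_ n₁) (cong (_⊕ d) x≡)) (trans (cong +_ n₂) (cong (_⊕ e) y≡))
      (trans (cong +_ n₃) (cong (_⊕ f) z≡)) (trans (cong +_ nK) (cong (_⊕ α) k≡))) (quad-step x y z k d e f α)
    where
    cong₄ : ∀ {x x' y y' z z' k k'} → x ≡ x' → y ≡ y' → z ≡ z' → k ≡ k' → quad x y z k ≡ quad x' y' z' k'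
    cong₄ refl refl refl refl = refl
  K₁ = + cs X₁
  K₂ = + cs X₂
  K₃ = + cs X₃
  K = + cs Y₃
  Pv = + pv (f₁ w) - + pv (b₁ w) ⊕ (+ pv (f₂ w) - + pv (b₂ w)) ⊕ + pv (f₃ w)
  out₁ = + pv (b₁ w) ⊕ (+ H₁ w ⊛ l₁ ⊕ K₁)
  out₂ = + pv (b₂ w) ⊕ (+ H₂ w ⊛ l₂ ⊕ K₂)
  out₃ = q₃ ⊕ ((+ hS (tgt w) ⊕ s) ⊛ l₃ ⊕ K₃)
  outK = + hK (tgt w) ⊛ l ⊕ K
  Cout = out₁ ⊕ (out₂ ⊕ (out₃ ⊕ outK))
  L = ω₁ w ⊛ l₁ ⊕ ω₂ w ⊛ l₂ ⊕ ω₃ w ⊛ l₃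
  LK = ωK₃ w ⊛ l
  col : ∀ S X {g} → bs S ≡ g → + cs (S ▷ X) ≡ + pv S ⊕ (+ g ⊛ + length X ⊕ + cs X)
  col S X refl = csᶻ S X
  colK : ∀ S X {g} → pv S ≡ 0 → bs S ≡ g → + cs (S ▷ X) ≡ + g ⊛ + length X ⊕ + cs X
  colK S X {g} p refl = trans (csᶻ S X) (trans (cong (λ v → + v ⊕ (+ g ⊛ + length X ⊕ + cs X)) p) (ZP.+-identityˡ _))
  cin : + cs (f₁ w ▷ X₁) ⊕ (+ cs (f₂ w ▷ X₂) ⊕ (+ cs (f₃ w ▷ X₃) ⊕ + cs (fK w ▷ Y₃))) ≡ Cout ⊕ L ⊕ LK ⊕ (Pv - q₃)
  cin = trans (cong₂ _⊕_ (col (f₁ w) X₁ (bs-f₁ i)) (cong₂ _⊕_ (col (f₂ w) X₂ (bs-f₂ i))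
      (cong₂ _⊕_ (col (f₃ w) X₃ (bs-f₃ i)) (colK (fK w) Y₃ (pv-fK≡0 i) (bs-fK i)))))
    (columns (+ pv (f₁ w)) (+ pv (b₁ w)) (+ pv (f₂ w)) (+ pv (b₂ w)) (+ pv (f₃ w)) q₃ (+ G₁ w) (+ H₁ w) (+ G₂ w) (+ H₂ w)
      (+ gS (tgt w)) (+ hS (tgt w)) (+ gK (tgt w)) (+ hK (tgt w)) s l₁ l₂ l₃ l K₁ K₂ K₃ K)
  cout : + cs (b₁ w ▷ X₁) ⊕ (+ cs (b₂ w ▷ X₂) ⊕ (+ cs (hd₃ τ ▷ X₃) ⊕ + cs (hdK τ ▷ Y₃))) ≡ Cout
  cout = cong₂ _⊕_ (col (b₁ w) X₁ (bs-b₁ i)) (cong₂ _⊕_ (col (b₂ w) X₂ (bs-b₂ i))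
      (cong₂ _⊕_ (col (hd₃ τ) X₃ (bs-hd₃ τ)) (colK (hdK τ) Y₃ (pv-hdK≡0 τ) (bs-hdK τ))))
  W = ω₃ w ⊛ (n ⊕ (u₃ ⊕ s))
  WK = ωK₃ w ⊛ (n' ⊕ uK)
  rec : energy (inp τ) ≡ energy (out τ) ⊕ W ⊕ WK ⊕ (q₃ ⊕ s)
  rec = trans (energy-out τ) (cong₂ (λ a b → energy (out τ) ⊕ ω₃ w ⊛ a ⊕ ωK₃ w ⊛ b ⊕ (q₃ ⊕ s))
    (cong +_ (trans (#₁-out τ) (cong (#₁ (out τ) N.+_) (sym (np-hd₃ τ)))))
    (cong +_ (trans (#K-out τ) (cong (#K (out τ) N.+_) (sym (np-hdK τ))))))
  R = ω₃ w ⊛ s - ω₁ w ⊛ u₁ - ω₂ w ⊛ u₂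
  end = + pv (b₀ w) ⊕ + st (src w)
  joined : (quad x y z k ⊕ (A ⊕ AK) ⊕ Δ) ⊕ (Cout ⊕ L ⊕ LK ⊕ (Pv - q₃)) ⊕ (energy (out τ) ⊕ W ⊕ WK ⊕ (q₃ ⊕ s))
    ≡ (quad x y z k ⊕ Cout ⊕ energy (out τ)) ⊕ (ω₀ w ⊛ x ⊕ ω₀ w ⊛ d) ⊕ (ωK₀ w ⊛ k ⊕ ωK₀ w ⊛ α) ⊕ end
  joined = glue (quad x y z k) A AK Δ Cout L LK Pv q₃ (energy (out τ)) W WK s (ω₀ w ⊛ x) (ω₀ w ⊛ d) (ωK₀ w ⊛ k) (ωK₀ w ⊛ α) end R _
    (abel' (ω₀ w) (ω₁ w) (ω₂ w) (ω₃ w) α d e f u₁ u₂ u₃ l₁ l₂ l₃ s n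
      (diff (G₁ w) (hS (src w)) (H₁ w) (gS (src w)) (δ₁ w) (a w) (gh₁ i))
      (diff (G₂ w) (H₁ w) (H₂ w) (G₁ w) (δ₂ w) (a w) (gh₂ i))
      (diff (gS (tgt w)) (H₂ w) (hS (tgt w)) (G₂ w) (δ₃ w) (a w) (gh₃ i)))
    (abelK (ωK₀ w) (ωK₃ w) α d e f uK l n'
      (diffK (gK (tgt w)) (hK (src w)) (hK (tgt w)) (gK (src w)) (δ₁ w) (δ₂ w) (δ₃ w) (a w) (ghK i)))
    (residue≡0 i) refl
  after : (quad x y z k ⊕ Cout ⊕ energy (out τ)) ⊕ (ω₀ w ⊛ x ⊕ ω₀ w ⊛ d) ⊕ (ωK₀ w ⊛ k ⊕ ωK₀ w ⊛ α) ⊕ end ≡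
    energy (out (step w i refl X₁ X₂ X₃ Y₃ τ)) ⊕ ω₀ w ⊛ + I.m₁ ⊕ ωK₀ w ⊛ + I.NK ⊕ end
  after = sym (cong₃ (λ q a b → q ⊕ a ⊕ b ⊕ end)
    (cong (_⊕ energy (out τ)) (cong₂ _⊕_ (cong₄ x≡ y≡ z≡ k≡) cout))
    (trans (cong (ω₀ w ⊛_) (trans (cong +_ n₁) (cong (_⊕ d) x≡))) (ZP.*-distribˡ-+ (ω₀ w) x d))
    (trans (cong (ωK₀ w ⊛_) (trans (cong +_ nK) (cong (_⊕ α) k≡))) (ZP.*-distribˡ-+ (ωK₀ w) k α)))
    where
    cong₃ : ∀ (f : ℤ → ℤ → ℤ → ℤ) {x x' y y' z z'} → x ≡ x' → y ≡ y' → z ≡ z' → f x y z ≡ f x' y' z'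
    cong₃ f refl refl refl = refl
    cong₄ : ∀ {x x' y y' z z' k k'} → x ≡ x' → y ≡ y' → z ≡ z' → k ≡ k' → quad x y z k ≡ quad x' y' z' k'
    cong₄ refl refl refl refl = refl


-- The elements of B⁽²'¹⁾

elements : List B
elements = b1 ∷ b2 ∷ b3 ∷ b4 ∷ b5 ∷ b6 ∷ b7 ∷ b8 ∷ b9 ∷ b10 ∷ b11 ∷ b12 ∷ b13 ∷ b14 ∷ ∅ ∷ []

∈-elements : ∀ b → b ∈ elements
∈-elements b1 = ∈-lookup {xs = elements} (# 0)
∈-elements b2 = ∈-lookup {xs = elements} (# 1)
∈-elements b3 = ∈-lookup {xs = elements} (# 2)
∈-elements b4 = ∈-lookup {xs = elements} (# 3)
∈-elements b5 = ∈-lookup {xs = elements} (# 4)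
∈-elements b6 = ∈-lookup {xs = elements} (# 5)
∈-elements b7 = ∈-lookup {xs = elements} (# 6)
∈-elements b8 = ∈-lookup {xs = elements} (# 7)
∈-elements b9 = ∈-lookup {xs = elements} (# 8)
∈-elements b10 = ∈-lookup {xs = elements} (# 9)
∈-elements b11 = ∈-lookup {xs = elements} (# 10)
∈-elements b12 = ∈-lookup {xs = elements} (# 11)
∈-elements b13 = ∈-lookup {xs = elements} (# 12)
∈-elements b14 = ∈-lookup {xs = elements} (# 13)
∈-elements ∅ = ∈-lookup {xs = elements} (# 14)

upper lower : B → St
upper b1 = s1
upper b2 = s2
upper b3 = s2
upper b4 = s3
upper b5 = s3
upper b6 = s4
upper b7 = s3
upper b8 = s4
upper b9 = s4
upper b10 = s5
upper b11 = s5
upper b12 = s5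
upper b13 = s6
upper b14 = s6
upper ∅ = s6
lower b1 = s0
lower b2 = s0
lower b3 = s1
lower b4 = s1
lower b5 = s2
lower b6 = s1
lower b7 = s3
lower b8 = s2
lower b9 = s3
lower b10 = s2
lower b11 = s3
lower b12 = s4
lower b13 = s4
lower b14 = s5
lower ∅ = s0

opaque
  unfolding allSt

  pair-sound : ∀ x y {b} → pair x y ≡ just b → x ≡ upper b × y ≡ lower b
  pair-sound x y {b} e = finish (subst (λ m → T (ok m)) e
      (allSt-sound (λ y → okx x y) (allSt-sound (λ x → allSt (okx x)) (trueT refl) x) y))
    where
    ok' : St → St → Maybe B → Bool
    ok' x y nothing = true
    ok' x y (just b) = (x ≡ˢ upper b) ∧ (y ≡ˢ lower b)
    okx : St → St → Bool
    okx x y = ok' x y (pair x y)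
    ok : Maybe B → Bool
    ok = ok' x y
    finish : T (ok (just b)) → x ≡ upper b × y ≡ lower b
    finish p with split (x ≡ˢ upper b) p
    ... | p₁ , p₂ = ≡ˢ-sound x (upper b) p₁ , ≡ˢ-sound y (lower b) p₂

pair-upper : ∀ b → pair (upper b) (lower b) ≡ just b
pair-upper b1 = refl
pair-upper b2 = refl
pair-upper b3 = refl
pair-upper b4 = refl
pair-upper b5 = refl
pair-upper b6 = refl
pair-upper b7 = refl
pair-upper b8 = refl
pair-upper b9 = refl
pair-upper b10 = refl
pair-upper b11 = refl
pair-upper b12 = refl
pair-upper b13 = refl
pair-upper b14 = refl
pair-upper ∅ = refl

_≤?ᵇ_ : ℤ → ℤ → Bool
i ≤?ᵇ j = isYes (i Z.≤? j)

≤?ᵇ-sound : ∀ i j → T (i ≤?ᵇ j) → i ≤ᶻ j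
≤?ᵇ-sound i j p with i Z.≤? j
... | Relation.Nullary.yes q = q

factB : (f : B → Bool) → all∈ f elements ≡ true → ∀ b → T (f b)
factB f c b = all∈-sound f (trueT c) (∈-elements b)

leB : (l r : B → ℤ) → all∈ (λ b → l b ≤?ᵇ r b) elements ≡ true → ∀ b → l b ≤ᶻ r b
leB l r c b = ≤?ᵇ-sound (l b) (r b) (factB (λ b → l b ≤?ᵇ r b) c b)

wt₁ : ∀ b → proj₁ (wt b) ≡ ωS (upper b) ⊕ ωS (lower b)
wt₁ b = ≡-via (ZP.∣i∣≡0⇒i≡0 (≡ᵇ⇒≡ _ 0 (factB (λ b → ∣ proj₁ (wt b) - (ωS (upper b) ⊕ ωS (lower b)) ∣ ≡ᵇ 0) refl b)))

wt₂ : ∀ b → proj₂ (wt b) ≡ ωKS (upper b) ⊕ ωKS (lower b)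
wt₂ b = ≡-via (ZP.∣i∣≡0⇒i≡0 (≡ᵇ⇒≡ _ 0 (factB (λ b → ∣ proj₂ (wt b) - (ωKS (upper b) ⊕ ωKS (lower b)) ∣ ≡ᵇ 0) refl b)))

-- ε(b) is the maximum of the two conditions imposed by the two passes.
ε₁-lower : ∀ b → + hS (lower b) ≤ᶻ + ε 1 b
ε₁-lower = leB (λ b → + hS (lower b)) (λ b → + ε 1 b) refl
ε₂-lower : ∀ b → + hK (lower b) ≤ᶻ + ε 2 b
ε₂-lower = leB (λ b → + hK (lower b)) (λ b → + ε 2 b) refl
ε₁-upper : ∀ b → + hS (upper b) - ωS (lower b) ≤ᶻ + ε 1 b
ε₁-upper = leB (λ b → + hS (upper b) - ωS (lower b)) (λ b → + ε 1 b) refl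
ε₂-upper : ∀ b → + hK (upper b) - ωKS (lower b) ≤ᶻ + ε 2 b
ε₂-upper = leB (λ b → + hK (upper b) - ωKS (lower b)) (λ b → + ε 2 b) refl

either : (l r r' : B → ℤ) → all∈ (λ b → (l b ≤?ᵇ r b) ∨ (l b ≤?ᵇ r' b)) elements ≡ true → ∀ b → (l b ≤ᶻ r b) ⊎ (l b ≤ᶻ r' b)
either l r r' c b with l b ≤?ᵇ r b in eq | factB (λ b → (l b ≤?ᵇ r b) ∨ (l b ≤?ᵇ r' b)) c b
... | true | _ = inj₁ (≤?ᵇ-sound (l b) (r b) (subst T (sym eq) tt))
... | false | p = inj₂ (≤?ᵇ-sound (l b) (r' b) p)

ε₁-max : ∀ b → (+ ε 1 b ≤ᶻ + hS (lower b)) ⊎ (+ ε 1 b ≤ᶻ + hS (upper b) - ωS (lower b))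
ε₁-max = either (λ b → + ε 1 b) (λ b → + hS (lower b)) (λ b → + hS (upper b) - ωS (lower b)) refl
ε₂-max : ∀ b → (+ ε 2 b ≤ᶻ + hK (lower b)) ⊎ (+ ε 2 b ≤ᶻ + hK (upper b) - ωKS (lower b))
ε₂-max = either (λ b → + ε 2 b) (λ b → + hK (lower b)) (λ b → + hK (upper b) - ωKS (lower b)) refl

plain-upper : ∀ b → T (plain (upper b))
plain-upper = factB (λ b → plain (upper b)) refl
plain-lower : ∀ b → T (plain (lower b))
plain-lower = factB (λ b → plain (lower b)) refl

-- The correction for ∅ is a difference of a function of b and the same function of b', so it
-- telescopes along a path. The check includes that the truncated subtraction in `drop` loses
-- nothing.
H-drop : ∀ b b' → H b b' ≡ - + drop b b' ⊕ + isEmpty b - + isEmpty b'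
H-drop b b' = ≡-via (ZP.∣i∣≡0⇒i≡0 (≡ᵇ⇒≡ _ 0 (all∈-sound (check b)
  (factB (λ b → all∈ (check b) elements) refl b) (∈-elements b'))))
  where
  check : B → B → Bool
  check b b' = ∣ H b b' - (- + drop b b' ⊕ + isEmpty b - + isEmpty b') ∣ ≡ᵇ 0

-- Sizes of highest weight configurations

size₁ sizeK : ∀ {M} → Conf M → ℕ
size₁ [] = 0
size₁ (b ∷ C) = (m₁ + (m₂ + m₃)) + size₁ C
  where open Vac b (#₁ C) (#K C)
sizeK [] = 0
sizeK (b ∷ C) = NK + sizeK C
  where open Vac b (#₁ C) (#K C)

HW-size : ∀ {M} {p P l₁ l₂ : ℤ} (C : Conf M) → HW p P C l₁ l₂ →
  l₁ ≡ p - + (size₁ C + size₁ C) ⊕ + (sizeK C + (sizeK C + sizeK C)) × l₂ ≡ P ⊕ + size₁ C - + (sizeK C + sizeK C)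
HW-size {p = p} {P} [] (refl , refl) = eq₁ p , eq₂ P
  where
  eq₁ : ∀ p → p ≡ p - + 0 ⊕ + 0
  eq₁ = ZR.solve-∀
  eq₂ : ∀ p → p ≡ p ⊕ + 0 - + 0
  eq₂ = ZR.solve-∀
HW-size {p = p} {P} (b ∷ C) (_ , _ , _ , _ , hw) with HW-size C hw
... | e₁ , e₂ = trans e₁ (eq₁ p (+ m₁) (+ m₂) (+ m₃) (+ NK) (+ size₁ C) (+ sizeK C))
              , trans e₂ (eq₂ P (+ m₁) (+ m₂) (+ m₃) (+ NK) (+ size₁ C) (+ sizeK C))
  where
  open Vac b (#₁ C) (#K C)
  eq₁ : ∀ p x y z k u v →
    (((p - (x ⊕ x) ⊕ k) - (y ⊕ y) ⊕ k) - (z ⊕ z) ⊕ k) - (u ⊕ u) ⊕ (v ⊕ (v ⊕ v)) ≡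
    p - (((x ⊕ (y ⊕ z)) ⊕ u) ⊕ ((x ⊕ (y ⊕ z)) ⊕ u)) ⊕ ((k ⊕ v) ⊕ ((k ⊕ v) ⊕ (k ⊕ v)))
  eq₁ = ZR.solve-∀
  eq₂ : ∀ P x y z k u v → (P ⊕ (x ⊕ (y ⊕ z)) - (k ⊕ k)) ⊕ u - (v ⊕ v) ≡
    P ⊕ ((x ⊕ (y ⊕ z)) ⊕ u) - ((k ⊕ v) ⊕ (k ⊕ v))
  eq₂ = ZR.solve-∀

0≤2 : ∀ {x} → 0ℤ ≤ᶻ x → 0ℤ ≤ᶻ x ⊕ x
0≤2 p = 0≤⊕ p p

-- The combination 2l₁ + 3l₂ eliminates the size of ν⁽²⁾, and l₁ + 2l₂ below eliminates that of
-- ν⁽¹⁾; the coefficients come from inverting the Cartan matrix.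
HW-bound₁ : ∀ {M} {p P : ℕ} {l₁ l₂ : ℤ} (C : Conf M) → 0ℤ ≤ᶻ l₁ → 0ℤ ≤ᶻ l₂ → HW (+ p) (+ P) C l₁ l₂ →
  size₁ C N.≤ (p + p) + (P + (P + P))
HW-bound₁ {p = p} {P} C q₁ q₂ hw with HW-size C hw
... | refl , refl = ZP.drop‿+≤+ (≤-via _ (0≤⊕ (0≤2 q₁) (0≤⊕ q₂ (0≤2 q₂))) (eq (+ p) (+ P) (+ size₁ C) (+ sizeK C)))
  where
  eq : ∀ p P u v → ((p ⊕ p) ⊕ (P ⊕ (P ⊕ P))) - u ≡
    ((p - (u ⊕ u) ⊕ (v ⊕ (v ⊕ v))) ⊕ (p - (u ⊕ u) ⊕ (v ⊕ (v ⊕ v)))) ⊕ ((P ⊕ u - (v ⊕ v)) ⊕ ((P ⊕ u - (v ⊕ v)) ⊕ (P ⊕ u - (v ⊕ v))))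
  eq = ZR.solve-∀

HW-boundK : ∀ {M} {p P : ℕ} {l₁ l₂ : ℤ} (C : Conf M) → 0ℤ ≤ᶻ l₁ → 0ℤ ≤ᶻ l₂ → HW (+ p) (+ P) C l₁ l₂ →
  sizeK C N.≤ p + (P + P)
HW-boundK {p = p} {P} C q₁ q₂ hw with HW-size C hw
... | refl , refl = ZP.drop‿+≤+ (≤-via _ (0≤⊕ q₁ (0≤2 q₂)) (eq (+ p) (+ P) (+ size₁ C) (+ sizeK C)))
  where
  eq : ∀ p P u v → (p ⊕ (P ⊕ P)) - v ≡
    (p - (u ⊕ u) ⊕ (v ⊕ (v ⊕ v))) ⊕ ((P ⊕ u - (v ⊕ v)) ⊕ (P ⊕ u - (v ⊕ v)))
  eq = ZR.solve-∀

noBlock : Block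
noBlock = blk [] [] [] []

columns₁ : Block → ℕ
columns₁ b = length (c₁ b) + (length (c₂ b) + length (c₃ b))

last : ∀ {M} → Block → Conf M → Block
last b [] = b
last b (b' ∷ C) = last b' C

last≤#₁ : ∀ {M} b (C : Conf M) → columns₁ (last b C) N.≤ #₁ (b ∷ C)
last≤#₁ b [] = NP.≤-reflexive (eq (length (c₁ b)) (length (c₂ b)) (length (c₃ b)))
  where
  eq : ∀ x y z → x + (y + z) ≡ x + (y + (z + 0))
  eq = NR.solve-∀
last≤#₁ b (b' ∷ C) = NP.≤-trans (last≤#₁ b' C) (NP.≤-trans (NP.m≤n+m _ (length (c₃ b)))
  (NP.≤-trans (NP.m≤n+m _ (length (c₂ b))) (NP.m≤n+m _ (length (c₁ b)))))

last≤size₁ : ∀ {M} b (C : Conf M) → suc M * columns₁ (last b C) N.≤ size₁ (b ∷ C)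
last≤size₁ b C = NP.+-mono-≤ (NP.≤-trans (last≤#₁ b C) (NP.m≤m+n _ _)) (others b C)
  where
  others : ∀ {M} b (C : Conf M) → M * columns₁ (last b C) N.≤ size₁ C
  others b [] = z≤n
  others b (b' ∷ C) = last≤size₁ b' C

last≤#K : ∀ {M} b (C : Conf M) → length (cK (last b C)) N.≤ #K (b ∷ C)
last≤#K b [] = NP.m≤m+n _ _
last≤#K b (b' ∷ C) = NP.≤-trans (last≤#K b' C) (NP.m≤n+m _ (length (cK b)))

last≤sizeK : ∀ {M} b (C : Conf M) → suc M * length (cK (last b C)) N.≤ sizeK (b ∷ C)
last≤sizeK b C = NP.+-mono-≤ (last≤#K b C) (others b C)
  where
  others : ∀ {M} b (C : Conf M) → M * length (cK (last b C)) N.≤ sizeK C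
  others b [] = z≤n
  others b (b' ∷ C) = last≤sizeK b' C

length-0 : ∀ {X : Column} → length X ≡ 0 → X ≡ []
length-0 {[]} _ = refl

block-0 : ∀ b → columns₁ b ≡ 0 → length (cK b) ≡ 0 → b ≡ noBlock
block-0 (blk [] [] [] []) _ _ = refl

vanishes : ∀ m k n → suc m * k N.≤ n → n N.≤ m → k ≡ 0
vanishes m zero n _ _ = refl
vanishes m (suc k) n p q = ⊥-elim (NP.<-irrefl refl (NP.≤-trans (NP.≤-trans (NP.m≤m*n (suc m) (suc k)) p) q))

-- A string in the last of M + 1 blocks has boxes in every block, hence contributes at least M + 1
-- to the size.
lastEmpty : ∀ {M} b (C : Conf M) → size₁ (b ∷ C) N.≤ M → sizeK (b ∷ C) N.≤ M → LastEmpty b C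
lastEmpty {M} b C p q = go b C (block-0 (last b C)
    (vanishes M _ _ (last≤size₁ b C) p) (vanishes M _ _ (last≤sizeK b C) q))
  where
  go : ∀ {M} b (C : Conf M) → last b C ≡ noBlock → LastEmpty b C
  go b [] e = e
  go b (b' ∷ C) e = go b' C e

allEmpty : ∀ {M} (C : Conf M) → size₁ C N.≤ 0 → sizeK C N.≤ 0 → C ≡ replicate M noBlock
allEmpty [] _ _ = refl
allEmpty (blk [] [] [] [] ∷ C) p q = cong (noBlock ∷_)
  (allEmpty C (NP.≤-trans (NP.m≤n+m _ _) p) (NP.≤-trans (NP.m≤n+m _ _) q))


-- One pass

run : ∀ {M} (C : Conf M) → ∃ λ t → Σ (Trace t s0 M) λ τ → inp τ ≡ C
run C = forward s0 C tt

End : ∀ {M} → Conf M → St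
End C = proj₁ (run C)

trace : ∀ {M} (C : Conf M) → Trace (End C) s0 M
trace C = proj₁ (proj₂ (run C))

inp-trace : ∀ {M} (C : Conf M) → inp (trace C) ≡ C
inp-trace C = proj₂ (proj₂ (run C))

Out : ∀ {M} → Conf M → Conf M
Out C = out (trace C)

run-unique : ∀ {M t} (τ : Trace t s0 M) → End (inp τ) ≡ t × Out (inp τ) ≡ out τ
run-unique τ with forward-unique (trace (inp τ)) τ (inp-trace (inp τ))
... | e , _ , _ , o = e , o

run-injective : ∀ {M} (C C' : Conf M) → End C ≡ End C' → Out C ≡ Out C' → C ≡ C'
run-injective C C' e o with run C | run C'
run-injective C C' refl o | t , τ , refl | .t , τ' , refl = backward₀-unique τ τ' o

sub-add : ∀ l g h → (l - (g - h)) ⊕ g ≡ l ⊕ h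
sub-add = ZR.solve-∀

suc-shift : ∀ p → + p ⊕ + 1 ≡ + suc p ⊕ + 0
suc-shift p = cong +_ (trans (NP.+-comm p 1) (sym (NP.+-identityʳ (suc p))))

-- The vacancy number at length 0 counts the factors of weight Λ₁. A pass spends one of them, and
-- its presence is the initial room `gS s0` = 1.
HW-pass : ∀ {M} (C : Conf M) {p P : ℕ} {l₁ l₂ : ℤ} → 0ℤ ≤ᶻ l₁ → 0ℤ ≤ᶻ l₂ → HW (+ suc p) (+ P) C l₁ l₂ →
  HW (+ p) (+ P) (Out C) (l₁ - ωS (End C)) (l₂ - ωKS (End C)) × (+ hS (End C) ≤ᶻ l₁ - ωS (End C)) × (+ hK (End C) ≤ᶻ l₂ - ωKS (End C))
HW-pass C {p} {P} {l₁} {l₂} q₁ q₂ hw with run C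
... | t , τ , refl = HW-out τ (suc-shift p) refl (sub-add l₁ (+ gS t) (+ hS t)) (sub-add l₂ (+ gK t) (+ hK t))
  (roomI τ (+≤+ (s≤s z≤n)) (+≤+ z≤n) q₁ q₂ hw) hw

HW-unpass : ∀ {M t} (τ : Trace t s0 M) {p P : ℕ} {l₁ l₂ : ℤ} → + hS t ≤ᶻ l₁ - ωS t → + hK t ≤ᶻ l₂ - ωKS t →
  HW (+ p) (+ P) (out τ) (l₁ - ωS t) (l₂ - ωKS t) → HW (+ suc p) (+ P) (inp τ) l₁ l₂
HW-unpass {t = t} τ {p} {P} {l₁} {l₂} ε₁ ε₂ hw =
  HW-inp τ (suc-shift p) refl (sub-add l₁ (+ gS t) (+ hS t)) (sub-add l₂ (+ gK t) (+ hK t))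
    (roomO τ (+≤+ z≤n) (+≤+ z≤n) ε₁ ε₂ hw) hw

energy-pass : ∀ {M} (C : Conf M) → energy C ≡ energy (Out C) ⊕ + #₁ C
energy-pass C with run C
... | t , τ , refl = trans (energy-out τ) (trans (cong (λ v → energy (out τ) ⊕ ωS s0 ⊛ + #₁ (inp τ) ⊕ ωKS s0 ⊛ + #K (inp τ) ⊕ (+ v ⊕ + 0))
    (NP.n≤0⇒n≡0 (pv-hd₃ τ))) (eq (energy (out τ)) (+ #₁ (inp τ)) (+ #K (inp τ))))
  where
  eq : ∀ e n N → e ⊕ + 1 ⊛ n ⊕ + 0 ⊛ N ⊕ (+ 0 ⊕ + 0) ≡ e ⊕ n
  eq = ZR.solve-∀

-- Adding a singular string of length 1

add : ∀ {M} → Conf (suc M) → Conf (suc M)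
add (blk C₁ C₂ C₃ CK ∷ C) = blk (0 ∷ C₁) C₂ C₃ CK ∷ C

add-injective : ∀ {M} (C C' : Conf (suc M)) → add C ≡ add C' → C ≡ C'
add-injective (blk _ _ _ _ ∷ _) (blk _ _ _ _ ∷ _) refl = refl

-- The two factors of weight Λ₁ add 2 to every vacancy number of ν⁽¹⁾ and the new box takes 2 away;
-- for ν⁽²⁾ the new box replaces the missing factor of weight Λ₂.
HW-add : ∀ {M} (C : Conf (suc M)) (P : ℕ) (l₁ l₂ : ℤ) → HW (+ 2) (+ P) (add C) l₁ l₂ ≡ HW (+ 0) (+ suc P) C l₁ l₂
HW-add (blk C₁ C₂ C₃ CK ∷ C) P l₁ l₂ = cong₂ Body (eq₁ (+ m₁) (+ NK)) (eq₂ (+ P) (+ m₁) (+ (m₂ + m₃)) (+ (NK + NK)))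
  where
  open Vac (blk C₁ C₂ C₃ CK) (#₁ C) (#K C)
  Body : ℤ → ℤ → Set
  Body p P = (+ sum C₁ ≤ᶻ p) × (+ sum C₂ ≤ᶻ dn p m₂ NK) × (+ sum C₃ ≤ᶻ dn (dn p m₂ NK) m₃ NK) × (+ sum CK ≤ᶻ P) ×
    HW (dn (dn p m₂ NK) m₃ NK) P C l₁ l₂
  eq₁ : ∀ m k → + 2 - ((+ 1 ⊕ m) ⊕ (+ 1 ⊕ m)) ⊕ k ≡ + 0 - (m ⊕ m) ⊕ k
  eq₁ = ZR.solve-∀
  eq₂ : ∀ P m n k → P ⊕ ((+ 1 ⊕ m) ⊕ n) - k ≡ (+ 1 ⊕ P) ⊕ (m ⊕ n) - k
  eq₂ = ZR.solve-∀

energy-add : ∀ {M} (C : Conf (suc M)) → energy (add C) ≡ energy C ⊕ (+ #₁ C ⊕ + #₁ C ⊕ + 1 - + #K C)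
energy-add (blk C₁ C₂ C₃ CK ∷ C) = eq (+ m₁) (+ m₂) (+ m₃) (+ NK) _ (energy C)
  where
  open Vac (blk C₁ C₂ C₃ CK) (#₁ C) (#K C)
  eq : ∀ x y z k c e →
    ((+ 1 ⊕ x) ⊛ (+ 1 ⊕ x) ⊕ (y ⊛ y ⊕ z ⊛ z) - ((+ 1 ⊕ x) ⊕ (y ⊕ z)) ⊛ k ⊕ k ⊛ k) ⊕ c ⊕ e ≡
    (x ⊛ x ⊕ (y ⊛ y ⊕ z ⊛ z) - (x ⊕ (y ⊕ z)) ⊛ k ⊕ k ⊛ k) ⊕ c ⊕ e ⊕ (x ⊕ x ⊕ + 1 - k)
  eq = ZR.solve-∀

#₁-add : ∀ {M} (C : Conf (suc M)) → #₁ (add C) ≡ suc (#₁ C)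
#₁-add (blk _ _ _ _ ∷ _) = refl

#K-add : ∀ {M} (C : Conf (suc M)) → #K (add C) ≡ #K C
#K-add (blk _ _ _ _ ∷ _) = refl

-- Two passes

top bot : ∀ {M} → Conf (suc M) → St
top C = End (add C)
bot C = End (Out (add C))

remaining : ∀ {M} → Conf (suc M) → Conf (suc M)
remaining C = Out (Out (add C))

first : ∀ {M} → Conf (suc M) → B
first C = fromMaybe ∅ (pair (top C) (bot C))

fourfold : ∀ {M} (C : Conf (suc M)) →
  Chain (suc M) Removed.bottoms (true ∷ false ∷ true ∷ false ∷ []) [] [] C (top C ∷ bot C ∷ top (remaining C) ∷ bot (remaining C) ∷ [])
fourfold C = cons (trace (add C)) _ _ refl refl (ins C)
  (cons (trace (Out (add C))) _ _ refl refl (no-ins (Out (add C)))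
  (cons (trace (add (remaining C))) _ _ refl refl (ins (remaining C))
  (cons (trace (Out (add (remaining C)))) _ _ refl refl (no-ins (Out (add (remaining C)))) [])))
  where
  ins : ∀ {M fl} (C : Conf (suc M)) → insB (true ∷ fl) C ≡ inp (trace (add C))
  ins C@(blk _ _ _ _ ∷ _) = sym (inp-trace (add C))
  no-ins : ∀ {M fl} (C : Conf (suc M)) → insB (false ∷ fl) C ≡ inp (trace C)
  no-ins C@(blk _ _ _ _ ∷ _) = sym (inp-trace C)

labelled : ∀ {M bs fl p₃ pK C ts t t' s s' S S' K K'} (τ : Trace t s (suc M)) (τ' : Trace t' s' (suc M)) X Y e₁ e₂ e₃ X' Y' e₁' e₂' e₃'
  (c : Chain (suc M) bs (popFlag (popFlag fl)) (hd₃ τ' ▷ X') (hdK τ' ▷ Y') (out τ') ts) →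
  labelR (map toRow (firsts {M} {edge s S K ∷ edge s' S' K' ∷ bs} {fl} {p₃} {pK} {C} (cons τ X Y e₁ e₂ e₃ (cons τ' X' Y' e₁' e₂' e₃' c))))
  ≡ (aτ τ + aτ τ' , dτ τ)
labelled (step _ _ _ _ _ _ _ _) (step _ _ _ _ _ _ _ _) _ _ _ _ _ _ _ _ _ _ _ = refl

record Step {M} (C : Conf (suc M)) : Set where
  field
    is-pair : pair (top C) (bot C) ≡ just (first C)
    lost : aτ (trace (add C)) + aτ (trace (Out (add C))) ≡ drop (first C) (first (remaining C))
    lost₁ : dτ (trace (add C)) ≡ suc (isEmpty (first C))

open Step

claimed : ∀ n d x y x' y' → T (claimR (n , d) (x ∷ y ∷ x' ∷ y' ∷ [])) →
  pair x y ≡ just (fromMaybe ∅ (pair x y)) × n ≡ drop (fromMaybe ∅ (pair x y)) (fromMaybe ∅ (pair x' y')) × d ≡ suc (isEmpty (fromMaybe ∅ (pair x y)))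
claimed n d x y x' y' p with pair x y | pair x' y'
... | just b | just b' with split (n ≡ᵇ drop b b') p
... | p₁ , p₂ = refl , ≡ᵇ⇒≡ n (drop b b') p₁ , ≡ᵇ⇒≡ d (suc (isEmpty b)) p₂

stepOf : ∀ {M} (C : Conf (suc M)) → Step C
stepOf C = record { is-pair = proj₁ facts ; lost = proj₁ (proj₂ facts) ; lost₁ = proj₂ (proj₂ facts) }
  where
  τ = trace (add C)
  τ' = trace (Out (add C))
  go : ∀ {M} (C : Conf (suc M)) → T (claimR (labelR (map toRow (firsts (fourfold C)))) (top C ∷ bot C ∷ top (remaining C) ∷ bot (remaining C) ∷ []))
  go C@(_ ∷ _) = Removed.chain-sound labels (trueT removed-checked) (anything _) (fourfold C)
  facts = claimed (aτ τ + aτ τ') (dτ τ) (top C) (bot C) (top (remaining C)) (bot (remaining C))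
    (subst (λ l → T (claimR l (top C ∷ bot C ∷ top (remaining C) ∷ bot (remaining C) ∷ []))) (labelled τ τ' _ _ _ _ _ _ _ _ _ _ _) (go C))

#K-next : ∀ {M} (C : Conf (suc M)) → #K C ≡ #K (remaining C) + drop (first C) (first (remaining C))
#K-next C = trans (trans (sym (#K-add C)) (trans (pass (add C)) (trans (cong (N._+ aτ (trace (add C))) (pass (Out (add C))))
    (eq (#K (remaining C)) (aτ (trace (Out (add C)))) (aτ (trace (add C))))))) (cong (#K (remaining C) N.+_) (lost (stepOf C)))
  where
  pass : ∀ {M} (C : Conf M) → #K C ≡ #K (Out C) + aτ (trace C)
  pass C = trans (cong #K (sym (inp-trace C))) (#K-out (trace C))
  eq : ∀ n x y → n + x + y ≡ n + (y + x)
  eq = NR.solve-∀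

-- With n strings in ν⁽¹⁾ and N in ν⁽²⁾, the added string raises the energy by 2n + 1 - N, and the
-- two passes lower it by n + 1 and by n, or n - 1 if the element is ∅.
energy-next : ∀ {M} (C : Conf (suc M)) → energy C ≡ energy (remaining C) ⊕ + #K C - + isEmpty (first C)
energy-next C = ≡-via (trans
  (eq (energy C) (energy (add C)) (energy C') (energy (remaining C)) (+ #₁ C) (+ #₁ C') (+ #K C) (+ isEmpty (first C)))
  (cong₂ _⊕_ (cong₂ _⊕_ (cong₂ _⊕_ (off' (energy-add C)) (off (trans (energy-pass (add C)) (cong (λ n → energy C' ⊕ + n) (#₁-add C)))))
     (off (energy-pass C'))) (off' e)))
  where
  C' = Out (add C)
  off : ∀ {x y : ℤ} → x ≡ y → x - y ≡ 0ℤ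
  off = ZP.i≡j⇒i-j≡0
  off' : ∀ {x y : ℤ} → x ≡ y → y - x ≡ 0ℤ
  off' e = ZP.i≡j⇒i-j≡0 (sym e)
  e : + 1 ⊕ + #₁ C ≡ + #₁ C' ⊕ (+ 1 ⊕ + isEmpty (first C))
  e = cong +_ (trans (sym (#₁-add C)) (trans (cong #₁ (sym (inp-trace (add C)))) (trans (#₁-out (trace (add C)))
        (cong (#₁ C' N.+_) (lost₁ (stepOf C))))))
  eq : ∀ E A E' E'' n n' N i → E - (E'' ⊕ N - i) ≡
    (((E ⊕ (n ⊕ n ⊕ + 1 - N)) - A) ⊕ (A - (E' ⊕ (+ 1 ⊕ n))) ⊕ (E' - (E'' ⊕ n'))) ⊕ ((n' ⊕ (+ 1 ⊕ i)) - (+ 1 ⊕ n))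
  eq = ZR.solve-∀

-- The empty configuration

none : ∀ M → Conf M
none M = replicate M noBlock

opaque
  unfolding words

  rest₀ : word s0 s0 0 0 ∈ words
  rest₀ = ∈-lookup {xs = words} (# 0)
  rest₁ : word s1 s1 1 1 ∈ words
  rest₁ = ∈-lookup {xs = words} (# 13)
  move₁ : word s0 s1 1 1 ∈ words
  move₁ = ∈-lookup {xs = words} (# 3)

idle₀ : ∀ M → Trace s0 s0 M
idle₀ zero = done tt
idle₀ (suc M) = step (word s0 s0 0 0) rest₀ refl [] [] [] [] (idle₀ M)

idle₁ : ∀ M → Trace s1 s1 M
idle₁ zero = done tt
idle₁ (suc M) = step (word s1 s1 1 1) rest₁ refl [] [] [] [] (idle₁ M)

inp-idle₀ : ∀ M → inp (idle₀ M) ≡ none M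
inp-idle₀ zero = refl
inp-idle₀ (suc M) = cong (noBlock ∷_) (inp-idle₀ M)

inp-idle₁ : ∀ M → inp (idle₁ M) ≡ none M
inp-idle₁ zero = refl
inp-idle₁ (suc M) = cong (noBlock ∷_) (inp-idle₁ M)

hd-idle₁ : ∀ M → hd₃ (idle₁ M) ▷ [] ≡ [] × hdK (idle₁ M) ▷ [] ≡ []
hd-idle₁ zero = refl , refl
hd-idle₁ (suc M) = refl , refl

out-idle₁ : ∀ M → out (idle₁ M) ≡ none M
out-idle₁ zero = refl
out-idle₁ (suc M) = cong₂ _∷_ (cong₂ (blk [] []) (proj₁ (hd-idle₁ M)) (proj₂ (hd-idle₁ M))) (out-idle₁ M)

end₁ : ∀ {M} (C : Conf M) {t} (τ : Trace t s0 M) → inp τ ≡ C → End C ≡ t × Out C ≡ out τ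
end₁ _ τ refl = run-unique τ

-- This is the convention that the path is followed by 1: with it the last energy term has the same
-- form as the others.
first-none : ∀ M → first (none (suc M)) ≡ b1
first-none M = cong₂ (λ x y → fromMaybe ∅ (pair x y)) (proj₁ e) (trans (cong End (trans (proj₂ e) eo)) (proj₁ e'))
  where
  τ : Trace s1 s0 (suc M)
  τ = step (word s0 s1 1 1) move₁ refl [] [] [] [] (idle₁ M)
  e = end₁ (add (none (suc M))) τ (cong (_ ∷_) (inp-idle₁ M))
  eo : out τ ≡ none (suc M)
  eo = cong₂ _∷_ (cong₂ (blk [] []) (proj₁ (hd-idle₁ M)) (proj₂ (hd-idle₁ M))) (out-idle₁ M)
  e' = end₁ (none (suc M)) (idle₀ (suc M)) (inp-idle₀ (suc M))

#₁-none : ∀ M → #₁ (none M) ≡ 0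
#₁-none zero = refl
#₁-none (suc M) = #₁-none M

#K-none : ∀ M → #K (none M) ≡ 0
#K-none zero = refl
#K-none (suc M) = #K-none M

energy-none : ∀ M → energy (none M) ≡ 0ℤ
energy-none zero = refl
energy-none (suc M) rewrite #₁-none M | #K-none M = trans (ZP.+-identityˡ _) (energy-none M)

HW-none : ∀ {M} (C : Conf M) {l₁ l₂ : ℤ} → 0ℤ ≤ᶻ l₁ → 0ℤ ≤ᶻ l₂ → HW (+ 0) (+ 0) C l₁ l₂ → C ≡ none M
HW-none C q₁ q₂ hw = allEmpty C (HW-bound₁ {p = 0} {0} C q₁ q₂ hw) (HW-boundK {p = 0} {0} C q₁ q₂ hw)

none-HW : ∀ M → HW (+ 0) (+ 0) (none M) (+ 0) (+ 0)
none-HW zero = refl , refl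
none-HW (suc M) rewrite #₁-none M | #K-none M = +≤+ z≤n , +≤+ z≤n , +≤+ z≤n , +≤+ z≤n , none-HW M

-- The path of a configuration

path : ∀ {M} n → Conf (suc M) → Vec B n
path zero C = []
path (suc n) C = first C ∷ path n (remaining C)

sub-wt : ∀ l x y {w : ℤ} → w ≡ x ⊕ y → (l - x) - y ≡ l - w
sub-wt l x y refl = eq l x y
  where
  eq : ∀ l x y → (l - x) - y ≡ l - (x ⊕ y)
  eq = ZR.solve-∀

nonneg : ∀ {k : ℕ} {l : ℤ} → + k ≤ᶻ l → 0ℤ ≤ᶻ l
nonneg p = ZP.≤-trans (+≤+ z≤n) p

≤-sub : ∀ {x y : ℤ} z → x ≤ᶻ y → x - z ≤ᶻ y - z
≤-sub z p = ZP.+-monoˡ-≤ (- z) p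

record NextHW {M} (n : ℕ) (C : Conf (suc M)) (l₁ l₂ : ℤ) : Set where
  field
    hw : HW (+ 0) (+ n) (remaining C) (l₁ - proj₁ (wt (first C))) (l₂ - proj₂ (wt (first C)))
    ε₁≤ : + ε 1 (first C) ≤ᶻ l₁ - proj₁ (wt (first C))
    ε₂≤ : + ε 2 (first C) ≤ᶻ l₂ - proj₂ (wt (first C))

open NextHW

next-HW : ∀ {M} n (C : Conf (suc M)) {l₁ l₂ : ℤ} → 0ℤ ≤ᶻ l₁ → 0ℤ ≤ᶻ l₂ → HW (+ 0) (+ suc n) C l₁ l₂ → NextHW n C l₁ l₂
next-HW n C {l₁} {l₂} q₁ q₂ h = record
  { hw = subst₂ (HW (+ 0) (+ n) (remaining C)) e₁ e₂ (proj₁ second)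
  ; ε₁≤ = choose₁ (ε₁-max b)
  ; ε₂≤ = choose₂ (ε₂-max b) }
  where
  b = first C
  xy = pair-sound (top C) (bot C) (is-pair (stepOf C))
  firstP = HW-pass (add C) q₁ q₂ (subst (λ X → X) (sym (HW-add C n l₁ l₂)) h)
  second = HW-pass (Out (add C)) (nonneg (proj₁ (proj₂ firstP))) (nonneg (proj₂ (proj₂ firstP))) (proj₁ firstP)
  e₁ : (l₁ - ωS (top C)) - ωS (bot C) ≡ l₁ - proj₁ (wt b)
  e₁ = sub-wt l₁ (ωS (top C)) (ωS (bot C)) (trans (wt₁ b) (sym (cong₂ (λ x y → ωS x ⊕ ωS y) (proj₁ xy) (proj₂ xy))))
  e₂ : (l₂ - ωKS (top C)) - ωKS (bot C) ≡ l₂ - proj₂ (wt b)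
  e₂ = sub-wt l₂ (ωKS (top C)) (ωKS (bot C)) (trans (wt₂ b) (sym (cong₂ (λ x y → ωKS x ⊕ ωKS y) (proj₁ xy) (proj₂ xy))))
  choose₁ : (+ ε 1 b ≤ᶻ + hS (lower b)) ⊎ (+ ε 1 b ≤ᶻ + hS (upper b) - ωS (lower b)) → + ε 1 b ≤ᶻ l₁ - proj₁ (wt b)
  choose₁ (inj₁ p) = ZP.≤-trans p (subst₂ _≤ᶻ_ (cong (λ s → + hS s) (proj₂ xy)) e₁ (proj₁ (proj₂ second)))
  choose₁ (inj₂ p) = ZP.≤-trans p (subst₂ _≤ᶻ_ (cong₂ (λ s s' → + hS s - ωS s') (proj₁ xy) (proj₂ xy)) e₁ (≤-sub (ωS (bot C)) (proj₁ (proj₂ firstP))))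
  choose₂ : (+ ε 2 b ≤ᶻ + hK (lower b)) ⊎ (+ ε 2 b ≤ᶻ + hK (upper b) - ωKS (lower b)) → + ε 2 b ≤ᶻ l₂ - proj₂ (wt b)
  choose₂ (inj₁ p) = ZP.≤-trans p (subst₂ _≤ᶻ_ (cong (λ s → + hK s) (proj₂ xy)) e₂ (proj₂ (proj₂ second)))
  choose₂ (inj₂ p) = ZP.≤-trans p (subst₂ _≤ᶻ_ (cong₂ (λ s s' → + hK s - ωKS s') (proj₁ xy) (proj₂ xy)) e₂ (≤-sub (ωKS (bot C)) (proj₂ (proj₂ firstP))))

path-IsPath : ∀ {M} n (C : Conf (suc M)) {l₁ l₂ : ℤ} → 0ℤ ≤ᶻ l₁ → 0ℤ ≤ᶻ l₂ → HW (+ 0) (+ n) C l₁ l₂ → IsPath (l₁ , l₂) (path n C)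
path-IsPath {M} zero C q₁ q₂ h with HW-none C q₁ q₂ h
... | refl = HW-final (suc M) h
  where
  HW-final : ∀ M {l₁ l₂ : ℤ} → HW (+ 0) (+ 0) (none M) l₁ l₂ → (l₁ , l₂) ≡ (+ 0 , + 0)
  HW-final zero (refl , refl) = refl
  HW-final (suc M) (_ , _ , _ , _ , h) rewrite #₁-none M | #K-none M = HW-final M h
path-IsPath (suc n) C q₁ q₂ h =
  path-IsPath n (remaining C) (nonneg (ε₁≤ N)) (nonneg (ε₂≤ N)) (hw N) , ε₁≤ N , ε₂≤ N
  where N = next-HW n C q₁ q₂ h

path-injective : ∀ {M} n (C C' : Conf (suc M)) {l₁ l₂ : ℤ} → 0ℤ ≤ᶻ l₁ → 0ℤ ≤ᶻ l₂ →
  HW (+ 0) (+ n) C l₁ l₂ → HW (+ 0) (+ n) C' l₁ l₂ → path n C ≡ path n C' → C ≡ C'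
path-injective zero C C' q₁ q₂ h h' _ = trans (HW-none C q₁ q₂ h) (sym (HW-none C' q₁ q₂ h'))
path-injective (suc n) C C' {l₁} {l₂} q₁ q₂ h h' e =
  add-injective C C' (run-injective (add C) (add C') tops
    (run-injective (Out (add C)) (Out (add C')) bots rec))
  where
  N = next-HW n C q₁ q₂ h
  N' = next-HW n C' q₁ q₂ h'
  eb : first C ≡ first C'
  eb = proj₁ (∷-inj e)
  xy = pair-sound (top C) (bot C) (is-pair (stepOf C))
  xy' = pair-sound (top C') (bot C') (is-pair (stepOf C'))
  tops : top C ≡ top C'
  tops = trans (proj₁ xy) (trans (cong upper eb) (sym (proj₁ xy')))
  bots : bot C ≡ bot C'
  bots = trans (proj₂ xy) (trans (cong lower eb) (sym (proj₂ xy')))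
  rec : remaining C ≡ remaining C'
  rec = path-injective n (remaining C) (remaining C') (nonneg (ε₁≤ N)) (nonneg (ε₂≤ N)) (hw N)
    (subst (λ b → HW (+ 0) (+ n) (remaining C') (l₁ - proj₁ (wt b)) (l₂ - proj₂ (wt b))) (sym eb) (hw N')) (proj₂ (∷-inj e))

zero-head : ∀ c → (∃ λ c' → c ≡ 0 ∷ c') ⊎ In (pat [] 1) c
zero-head [] = inj₂ ([] , refl)
zero-head (zero ∷ c) = inj₁ (c , refl)
zero-head (suc x ∷ c) = inj₂ (x ∷ c , refl)

remove : ∀ {M x y} (τ : Trace x s0 (suc M)) (τ' : Trace y s0 (suc M)) → out τ ≡ inp τ' → ∀ {b} → pair x y ≡ just b →
  ∃ λ C → add C ≡ inp τ
remove {x = x} {y} τ τ' e {b} pb = go (inp τ) refl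
  where
  bad : ∀ {b} → pair x y ≡ just b → T (claimN (0 , 0) (x ∷ y ∷ [])) → ⊥
  bad e p with pair x y | e
  ... | just _ | refl = p
  no-ins : ∀ {M} (C : Conf M) fl → insB (false ∷ fl) C ≡ C
  no-ins [] fl = refl
  no-ins (_ ∷ _) fl = refl
  go : ∀ C → C ≡ inp τ → ∃ λ C' → add C' ≡ C
  go (blk C₁ C₂ C₃ CK ∷ C) q with zero-head C₁
  ... | inj₁ (c , refl) = blk c C₂ C₃ CK ∷ C , refl
  ... | inj₂ i = ⊥-elim (bad pb (Unpaired.chain-sound ((0 , 0) ∷ []) (trueT unpaired-checked) {p₃ = []} {pK = []} i
      (cons τ [] [] refl refl q (cons τ' _ _ refl refl (trans (no-ins (out τ) []) e) []))))

-- The hypothesis on M makes the last block empty before each inverse pass: with k ≤ 1 factors of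
-- weight Λ₁ and n of weight Λ₂, `HW-bound₁` gives the size bound 2k + 3n.
path-surjective : ∀ {M} n → 2 + (n + (n + n)) N.≤ M → ∀ {l₁ l₂ : ℤ} (v : Vec B n) → IsPath (l₁ , l₂) v →
  ∃ λ (C : Conf (suc M)) → HW (+ 0) (+ n) C l₁ l₂ × path n C ≡ v
path-surjective {M} zero _ [] refl = none (suc M) , none-HW (suc M) , refl
path-surjective {M} (suc n) le {l₁} {l₂} (b ∷ v) (ip , ε₁ , ε₂) = go (path-surjective n le' v ip)
  where
  le' : 2 + (n + (n + n)) N.≤ M
  le' = NP.≤-trans (NP.+-monoʳ-≤ 2 (NP.+-mono-≤ (NP.n≤1+n n) (NP.+-mono-≤ (NP.n≤1+n n) (NP.n≤1+n n)))) le
  x = upper b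
  y = lower b
  L₁ = l₁ - proj₁ (wt b)
  L₂ = l₂ - proj₂ (wt b)
  e₁ : (l₁ - ωS x) - ωS y ≡ L₁
  e₁ = sub-wt l₁ (ωS x) (ωS y) (wt₁ b)
  e₂ : (l₂ - ωKS x) - ωKS y ≡ L₂
  e₂ = sub-wt l₂ (ωKS x) (ωKS y) (wt₂ b)
  add-back : ∀ h l w → h - w ≤ᶻ l - w → h ≤ᶻ l
  add-back h l w p = subst₂ _≤ᶻ_ (eq h w) (eq l w) (ZP.+-monoˡ-≤ w p)
    where
    eq : ∀ h w → (h - w) ⊕ w ≡ h
    eq = ZR.solve-∀
  a₁ : + hS y ≤ᶻ (l₁ - ωS x) - ωS y
  a₁ = subst (+ hS y ≤ᶻ_) (sym e₁) (ZP.≤-trans (ε₁-lower b) ε₁)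
  a₂ : + hK y ≤ᶻ (l₂ - ωKS x) - ωKS y
  a₂ = subst (+ hK y ≤ᶻ_) (sym e₂) (ZP.≤-trans (ε₂-lower b) ε₂)
  a₃ : + hS x ≤ᶻ l₁ - ωS x
  a₃ = add-back (+ hS x) (l₁ - ωS x) (ωS y) (subst ((+ hS x - ωS y) ≤ᶻ_) (sym e₁) (ZP.≤-trans (ε₁-upper b) ε₁))
  a₄ : + hK x ≤ᶻ l₂ - ωKS x
  a₄ = add-back (+ hK x) (l₂ - ωKS x) (ωKS y) (subst ((+ hK x - ωKS y) ≤ᶻ_) (sym e₂) (ZP.≤-trans (ε₂-upper b) ε₂))
  bound₁ : ∀ k → k N.≤ 1 → (k + k) + (n + (n + n)) N.≤ M
  bound₁ k k≤1 = NP.≤-trans (NP.+-monoˡ-≤ (n + (n + n)) (NP.+-mono-≤ k≤1 k≤1)) le'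
  boundK : ∀ k → k N.≤ 1 → k + (n + n) N.≤ M
  boundK k k≤1 = NP.≤-trans (NP.+-mono-≤ (NP.m≤m+n k k) (NP.m≤n+m (n + n) n)) (bound₁ k k≤1)
  -- k counts the factors of weight Λ₁ already restored: 0 when the lower entry of the column is put
  -- back, 1 for the upper entry.
  pull : ∀ {t} → T (plain t) → (k : ℕ) → k N.≤ 1 → (C : Conf (suc M)) (u₁ u₂ : ℤ) →
    + hS t ≤ᶻ u₁ - ωS t → + hK t ≤ᶻ u₂ - ωKS t → HW (+ k) (+ n) C (u₁ - ωS t) (u₂ - ωKS t) →
    Σ (Trace t s0 (suc M)) λ τ → out τ ≡ C × HW (+ suc k) (+ n) (inp τ) u₁ u₂
  pull {t} pl k k≤1 (b' ∷ C) u₁ u₂ p q hw = proj₁ back , proj₂ back ,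
      HW-unpass (proj₁ back) {k} {n} {u₁} {u₂} p q (subst (λ C → HW (+ k) (+ n) C (u₁ - ωS t) (u₂ - ωKS t)) (sym (proj₂ back)) hw)
    where
    back = backward₀ pl b' C (lastEmpty b' C
      (NP.≤-trans (HW-bound₁ {p = k} {n} (b' ∷ C) (nonneg p) (nonneg q) hw) (bound₁ k k≤1))
      (NP.≤-trans (HW-boundK {p = k} {n} (b' ∷ C) (nonneg p) (nonneg q) hw) (boundK k k≤1)))
  Goal : Set
  Goal = ∃ λ (C : Conf (suc M)) → HW (+ 0) (+ suc n) C l₁ l₂ × path (suc n) C ≡ b ∷ v
  finish : (τ₁ : Trace x s0 (suc M)) (τ₂ : Trace y s0 (suc M)) → out τ₁ ≡ inp τ₂ → HW (+ 2) (+ n) (inp τ₁) l₁ l₂ →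
    path n (out τ₂) ≡ v → ∀ C → add C ≡ inp τ₁ → Goal
  finish τ₁ τ₂ eo hw ev C eC =
    C , subst (λ X → X) (HW-add C n l₁ l₂) (subst (λ C → HW (+ 2) (+ n) C l₁ l₂) (sym eC) hw) ,
    cong₂ _∷_ (trans (cong₂ (λ x y → fromMaybe ∅ (pair x y)) (proj₁ run₁) (trans (cong End (trans (proj₂ run₁) eo)) (proj₁ run₂)))
                (cong (fromMaybe ∅) (pair-upper b)))
              (trans (cong (path n) (trans (cong Out (trans (proj₂ run₁) eo)) (proj₂ run₂))) ev)
    where
    run₁ = end₁ (add C) τ₁ (sym eC)
    run₂ = run-unique τ₂
  go : (∃ λ (C : Conf (suc M)) → HW (+ 0) (+ n) C L₁ L₂ × path n C ≡ v) → Goal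
  go (C₂ , hw , ev) = finish τ₁ τ₂ eo (proj₂ (proj₂ pull₁)) (trans (cong (path n) (proj₁ (proj₂ pull₂))) ev)
      (proj₁ removed) (proj₂ removed)
    where
    pull₂ = pull (plain-lower b) 0 z≤n C₂ (l₁ - ωS x) (l₂ - ωKS x) a₁ a₂ (subst₂ (HW (+ 0) (+ n) C₂) (sym e₁) (sym e₂) hw)
    τ₂ = proj₁ pull₂
    pull₁ = pull (plain-upper b) 1 (s≤s z≤n) (inp τ₂) l₁ l₂ a₃ a₄ (proj₂ (proj₂ pull₂))
    τ₁ = proj₁ pull₁
    eo = proj₁ (proj₂ pull₁)
    removed = remove τ₁ τ₂ eo (pair-upper b)

-- The energy of a path

total : List B → ℤ
total [] = 0ℤ
total (b ∷ []) = H b b1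
total (b ∷ c ∷ bs) = H b c ⊕ total (c ∷ bs)

energyFrom-suc : ∀ k bs → energyFrom (suc k) bs ≡ energyFrom k bs ⊕ total bs
energyFrom-suc k [] = refl
energyFrom-suc k (b ∷ []) = eq (+ k) (H b b1)
  where
  eq : ∀ k h → (+ 1 ⊕ k) ⊛ h ≡ k ⊛ h ⊕ h
  eq = ZR.solve-∀
energyFrom-suc k (b ∷ c ∷ bs) = trans (cong (+ suc k ⊛ H b c ⊕_) (energyFrom-suc (suc k) (c ∷ bs)))
  (eq (+ k) (H b c) (energyFrom (suc k) (c ∷ bs)) (total (c ∷ bs)))
  where
  eq : ∀ k h e t → (+ 1 ⊕ k) ⊛ h ⊕ (e ⊕ t) ≡ k ⊛ h ⊕ e ⊕ (h ⊕ t)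
  eq = ZR.solve-∀

-- A factor put in front raises every index j by one, so D grows by the unweighted sum of all local
-- energies; the second component evaluates that sum and must be carried along.
energy-path : ∀ {M} n (C : Conf (suc M)) {l₁ l₂ : ℤ} → 0ℤ ≤ᶻ l₁ → 0ℤ ≤ᶻ l₂ → HW (+ 0) (+ n) C l₁ l₂ →
  - energy C ≡ energyFrom 1 (toList (path n C)) × total (toList (path n C)) ≡ - + #K C ⊕ + isEmpty (first C)
energy-path {M} zero C q₁ q₂ h with HW-none C q₁ q₂ h
... | refl = cong -_ (energy-none (suc M)) , sym (cong₂ (λ n b → - + n ⊕ + isEmpty b) (#K-none (suc M)) (first-none M))
energy-path {M} (suc n) C q₁ q₂ h = trans eE (sym eD) , eT
  where
  N = next-HW n C q₁ q₂ h
  C' = remaining C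
  rec = energy-path n C' (nonneg (ε₁≤ N)) (nonneg (ε₂≤ N)) (hw N)
  tail' = toList (path n C')
  b = first C
  b' = first C'
  last-b1 : ∀ n {l₁ l₂ : ℤ} → 0ℤ ≤ᶻ l₁ → 0ℤ ≤ᶻ l₂ → HW (+ 0) (+ n) C' l₁ l₂ →
    total (b ∷ toList (path n C')) ≡ H b b' ⊕ total (toList (path n C')) ×
    energyFrom 1 (b ∷ toList (path n C')) ≡ H b b' ⊕ energyFrom 2 (toList (path n C'))
  last-b1 zero q₁ q₂ h = trans (sym (ZP.+-identityʳ _)) (cong (λ c → H b c ⊕ 0ℤ) e) ,
      trans (ZP.*-identityˡ (H b b1)) (trans (sym (ZP.+-identityʳ _)) (cong (λ c → H b c ⊕ 0ℤ) e))
    where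
    e : b1 ≡ b'
    e = sym (trans (cong first (HW-none C' q₁ q₂ h)) (first-none M))
  last-b1 (suc n) _ _ _ = refl , cong (_⊕ energyFrom 2 (toList (path (suc n) C'))) (ZP.*-identityˡ (H b b'))
  lb = last-b1 n (nonneg (ε₁≤ N)) (nonneg (ε₂≤ N)) (hw N)
  eT : total (b ∷ tail') ≡ - + #K C ⊕ + isEmpty b
  eT = trans (proj₁ lb) (trans (cong₂ _⊕_ (H-drop b b') (proj₂ rec))
    (trans (eq (+ drop b b') (+ isEmpty b) (+ isEmpty b') (+ #K C')) (cong (λ n → - + n ⊕ + isEmpty b) (sym (#K-next C)))))
    where
    eq : ∀ d i i' k → (- d ⊕ i - i') ⊕ (- k ⊕ i') ≡ - (k ⊕ d) ⊕ i
    eq = ZR.solve-∀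
  eD : energyFrom 1 (b ∷ tail') ≡ - energy C' ⊕ (- + #K C ⊕ + isEmpty b)
  eD = trans (proj₂ lb) (trans (cong (H b b' ⊕_) (energyFrom-suc 1 tail')) (trans (eq (H b b') (energyFrom 1 tail') (total tail'))
    (cong₂ _⊕_ (sym (proj₁ rec)) (trans (sym (proj₁ lb)) eT))))
    where
    eq : ∀ h e t → h ⊕ (e ⊕ t) ≡ e ⊕ (h ⊕ t)
    eq = ZR.solve-∀
  eE : - energy C ≡ - energy C' ⊕ (- + #K C ⊕ + isEmpty b)
  eE = trans (cong -_ (energy-next C)) (eq (energy C') (+ #K C) (+ isEmpty b))
    where
    eq : ∀ e k i → - (e ⊕ k - i) ≡ - e ⊕ (- k ⊕ i)
    eq = ZR.solve-∀


-- Sums over the parts of a partition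

Σto-cong : ∀ n {f f' : ℕ → ℤ} → (∀ j → f j ≡ f' j) → Σto n f ≡ Σto n f'
Σto-cong zero e = refl
Σto-cong (suc n) e = cong₂ _⊕_ (Σto-cong n e) (e (suc n))

Σto-+ : ∀ n (f f' : ℕ → ℕ) → Σto n (λ j → + (f j + f' j)) ≡ Σto n (λ j → + f j) ⊕ Σto n (λ j → + f' j)
Σto-+ zero f f' = refl
Σto-+ (suc n) f f' = trans (cong (_⊕ + (f (suc n) + f' (suc n))) (Σto-+ n f f')) (eq (Σto n (λ j → + f j)) _ (+ f (suc n)) (+ f' (suc n)))
  where
  eq : ∀ a b c d → (a ⊕ b) ⊕ (c ⊕ d) ≡ (a ⊕ c) ⊕ (b ⊕ d)
  eq = ZR.solve-∀

δ : ℕ → ℕ → ℕ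
δ x j = if x ≡ᵇ j then 1 else 0

δ-refl : ∀ x → δ x x ≡ 1
δ-refl zero = refl
δ-refl (suc x) = δ-refl x

δ-< : ∀ x j → j N.< x → δ x j ≡ 0
δ-< (suc x) zero _ = refl
δ-< (suc x) (suc j) (s≤s p) = δ-< x j p

δ-> : ∀ x j → x N.< j → δ x j ≡ 0
δ-> zero (suc j) _ = refl
δ-> (suc x) (suc j) (s≤s p) = δ-> x j p

point-0 : ∀ n (g : ℕ → ℕ) x → n N.< x → Σto n (λ j → + (g j * δ x j)) ≡ 0ℤ
point-0 zero g x _ = refl
point-0 (suc n) g x p rewrite δ-< x (suc n) p | NP.*-zeroʳ (g (suc n)) = trans (ZP.+-identityʳ _) (point-0 n g x (NP.<-trans (NP.n<1+n n) p))

point : ∀ n (g : ℕ → ℕ) x → 1 N.≤ x → x N.≤ n → Σto n (λ j → + (g j * δ x j)) ≡ + g x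
point zero g x p q = ⊥-elim (NP.<-irrefl refl (NP.≤-trans p q))
point (suc n) g x p q with NP.m≤n⇒m<n∨m≡n q
... | inj₂ refl rewrite δ-refl n | NP.*-identityʳ (g (suc n)) =
  trans (cong (_⊕ + g (suc n)) (point-0 n g (suc n) (NP.n<1+n n))) (ZP.+-identityˡ _)
... | inj₁ (s≤s q') rewrite δ-> x (suc n) (s≤s q') | NP.*-zeroʳ (g (suc n)) = trans (ZP.+-identityʳ _) (point n g x p q')

Parts : ℕ → List ℕ → Set
Parts n = All (λ x → 1 N.≤ x × x N.≤ n)

Σto-mult : ∀ n (g : ℕ → ℕ) ν → Parts n ν → Σto n (λ j → + (g j * mult ν j)) ≡ + sum (map g ν)
Σto-mult n g [] [] = trans (Σto-cong n (λ j → cong +_ (NP.*-zeroʳ (g j)))) (zeros n)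
  where
  zeros : ∀ n → Σto n (λ _ → + 0) ≡ + 0
  zeros zero = refl
  zeros (suc n) = trans (ZP.+-identityʳ _) (zeros n)
Σto-mult n g (x ∷ ν) ((p , q) ∷ ps) = trans (Σto-cong n (λ j → cong +_ (NP.*-distribˡ-+ (g j) (δ x j) (mult ν j))))
  (trans (Σto-+ n (λ j → g j * δ x j) (λ j → g j * mult ν j)) (cong₂ _⊕_ (point n g x p q) (Σto-mult n g ν ps)))

parts-sum : ∀ ν → All (λ x → 1 N.≤ x) ν → ∀ {n} → sum ν N.≤ n → Parts n ν
parts-sum [] [] _ = []
parts-sum (x ∷ ν) (p ∷ ps) q = (p , NP.≤-trans (NP.m≤m+n x (sum ν)) q) ∷ parts-sum ν ps (NP.≤-trans (NP.m≤n+m (sum ν) x) q)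

parts-≤ : ∀ {n n' ν} → n N.≤ n' → Parts n ν → Parts n' ν
parts-≤ le = All.map (λ (p , q) → p , NP.≤-trans q le)

Pos : List ℕ → Set
Pos = All (λ x → 1 N.≤ x)

sum-map-* : ∀ (g : ℕ → ℕ) k q → sum (map (λ y → g y * k) q) ≡ sum (map g q) * k
sum-map-* g k [] = refl
sum-map-* g k (y ∷ q) = trans (cong (λ z → g y * k + z) (sum-map-* g k q)) (sym (NP.*-distribʳ-+ k (g y) (sum (map g q))))

module Sums (ν₁ ν₂ : List ℕ) (pos₁ : Pos ν₁) (pos₂ : Pos ν₂) where
  ν : Config
  ν = ν₁ , ν₂
  parts₁ : Parts (bound ν) ν₁
  parts₁ = parts-sum ν₁ pos₁ (NP.m≤m+n (sum ν₁) (sum ν₂))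
  parts₂ : Parts (bound ν) ν₂
  parts₂ = parts-sum ν₂ pos₂ (NP.m≤n+m (sum ν₂) (sum ν₁))

  Σm₁ : ∀ g → Σm ν ν₁ g ≡ + sum (map g ν₁)
  Σm₁ g = Σto-mult (bound ν) g ν₁ parts₁
  Σm₂ : ∀ g → Σm ν ν₂ g ≡ + sum (map g ν₂)
  Σm₂ g = Σto-mult (bound ν) g ν₂ parts₂

  double : ∀ p q → Parts (bound ν) p → Parts (bound ν) q → ∀ (g : ℕ → ℕ → ℕ) → ΣΣ ν p q g ≡ + sum (map (λ x → sum (map (g x) q)) p)
  double p q pp pq g = trans (Σto-cong (bound ν) (λ i → trans (Σto-mult (bound ν) (λ j → g i j * mult p i) q pq)
      (cong +_ (sum-map-* (g i) (mult p i) q)))) (Σto-mult (bound ν) (λ x → sum (map (g x) q)) p pp)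

sum₁ sum₃ : ℕ → List ℕ → ℕ
sum₁ i ν = sum (map (λ x → i ⊓ x) ν)
sum₃ i ν = sum (map (λ y → i ⊓ (3 * y)) ν)

vacL₁ vacL₂ : List ℕ → List ℕ → ℕ → ℕ → ℤ
vacL₁ ν₁ ν₂ L i = - (+ 2 ⊛ + sum₁ i ν₁) ⊕ + sum₃ i ν₂
vacL₂ ν₁ ν₂ L i = + L ⊕ + sum₁ (3 * i) ν₁ - + 2 ⊛ + sum₁ i ν₂

vac₁≡ : ∀ ν₁ ν₂ → Pos ν₁ → Pos ν₂ → ∀ L i → vac1 (ν₁ , ν₂) L i ≡ vacL₁ ν₁ ν₂ L i
vac₁≡ ν₁ ν₂ p₁ p₂ L i = cong₂ (λ a b → - (+ 2 ⊛ a) ⊕ b) (Σm₁ (i ⊓_)) (Σm₂ (λ j → i ⊓ (3 * j)))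
  where open Sums ν₁ ν₂ p₁ p₂

vac₂≡ : ∀ ν₁ ν₂ → Pos ν₁ → Pos ν₂ → ∀ L i → vac2 (ν₁ , ν₂) L i ≡ vacL₂ ν₁ ν₂ L i
vac₂≡ ν₁ ν₂ p₁ p₂ L i = cong₂ (λ a b → + L ⊕ a - + 2 ⊛ b) (Σm₁ ((3 * i) ⊓_)) (Σm₂ (i ⊓_))
  where open Sums ν₁ ν₂ p₁ p₂

gt : ℕ → ℕ → ℕ
gt t zero = 0
gt zero (suc x) = 1
gt (suc t) (suc x) = gt t x

cnt : List ℕ → ℕ → ℕ
cnt ν t = sum (map (gt t) ν)

gt-⊓ : ∀ t x → suc t ⊓ x ≡ t ⊓ x + gt t x
gt-⊓ zero zero = refl
gt-⊓ (suc t) zero = refl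
gt-⊓ zero (suc x) = refl
gt-⊓ (suc t) (suc x) = cong suc (gt-⊓ t x)

gt-δ : ∀ t x → gt t x ≡ δ x (suc t) + gt (suc t) x
gt-δ t zero = refl
gt-δ zero (suc zero) = refl
gt-δ zero (suc (suc x)) = refl
gt-δ (suc t) (suc x) = gt-δ t x

gt-≤ : ∀ t x → x N.≤ t → gt t x ≡ 0
gt-≤ t zero _ = refl
gt-≤ (suc t) (suc x) (s≤s p) = gt-≤ t x p

sum-map-+ : ∀ (f g h : ℕ → ℕ) ν → (∀ x → f x ≡ g x + h x) → sum (map f ν) ≡ sum (map g ν) + sum (map h ν)
sum-map-+ f g h [] e = refl
sum-map-+ f g h (x ∷ ν) e = trans (cong₂ _+_ (e x) (sum-map-+ f g h ν e)) (eq (g x) (h x) _ _)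
  where
  eq : ∀ a b c d → (a + b) + (c + d) ≡ (a + c) + (b + d)
  eq = NR.solve-∀

mult-sum : ∀ ν t → mult ν t ≡ sum (map (λ x → δ x t) ν)
mult-sum [] t = refl
mult-sum (x ∷ ν) t = cong (λ k → δ x t + k) (mult-sum ν t)

cnt-suc : ∀ ν t → cnt ν t ≡ mult ν (suc t) + cnt ν (suc t)
cnt-suc ν t = trans (sum-map-+ (gt t) (λ x → δ x (suc t)) (gt (suc t)) ν (gt-δ t)) (cong (_+ cnt ν (suc t)) (sym (mult-sum ν (suc t))))

cnt-0 : ∀ ν t → All (N._≤ t) ν → cnt ν t ≡ 0
cnt-0 [] t [] = refl
cnt-0 (x ∷ ν) t (p ∷ ps) = cong₂ _+_ (gt-≤ t x p) (cnt-0 ν t ps)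

sum₁-suc : ∀ ν t → sum₁ (suc t) ν ≡ sum₁ t ν + cnt ν t
sum₁-suc ν t = sum-map-+ (suc t ⊓_) (t ⊓_) (gt t) ν (gt-⊓ t)

-- Multiplication by 3 in a form that unfolds to three successors, so that the lengths of a block
-- match definitionally.
th : ℕ → ℕ
th zero = 0
th (suc j) = suc (suc (suc (th j)))

th-3* : ∀ j → 3 * j ≡ th j
th-3* zero = refl
th-3* (suc j) = trans (eq j) (cong (λ k → suc (suc (suc k))) (th-3* j))
  where
  eq : ∀ j → 3 * suc j ≡ 3 + 3 * j
  eq = NR.solve-∀

gt-th : ∀ j y → gt (th j) (th y) ≡ gt j y × gt (suc (th j)) (th y) ≡ gt j y × gt (suc (suc (th j))) (th y) ≡ gt j y
gt-th j zero = refl , refl , refl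
gt-th zero (suc y) = refl , refl , refl
gt-th (suc j) (suc y) = gt-th j y

sum₃-suc : ∀ ν t j → (∀ y → gt t (th y) ≡ gt j y) → sum₃ (suc t) ν ≡ sum₃ t ν + cnt ν j
sum₃-suc ν t j e = sum-map-+ (λ y → suc t ⊓ (3 * y)) (λ y → t ⊓ (3 * y)) (gt j) ν
  (λ y → trans (gt-⊓ t (3 * y)) (cong (λ z → t ⊓ (3 * y) + z) (trans (cong (gt t) (th-3* y)) (e y))))

sum₁-all : ∀ ν t → All (N._≤ t) ν → sum₁ t ν ≡ sum ν
sum₁-all [] t [] = refl
sum₁-all (x ∷ ν) t (p ∷ ps) = cong₂ _+_ (NP.m≥n⇒m⊓n≡n p) (sum₁-all ν t ps)

sum₃-all : ∀ ν t → All (N._≤ t) ν → ∀ {i} → 3 * t N.≤ i → sum₃ i ν ≡ 3 * sum ν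
sum₃-all [] t [] _ = refl
sum₃-all (x ∷ ν) t (p ∷ ps) q = trans (cong₂ _+_ (NP.m≥n⇒m⊓n≡n (NP.≤-trans (NP.*-monoʳ-≤ 3 p) q)) (sum₃-all ν t ps q)) (sym (NP.*-distribˡ-+ 3 x (sum ν)))

-- Riggings as columns

enc : ℕ → ℕ → List ℕ → Column
enc p zero μ = []
enc p (suc m) [] = p ∷ enc 0 m []
enc p (suc m) (j ∷ μ) = p ∸ j ∷ enc j m μ

length-enc : ∀ p m μ → length (enc p m μ) ≡ m
length-enc p zero μ = refl
length-enc p (suc m) [] = cong suc (length-enc 0 m [])
length-enc p (suc m) (j ∷ μ) = cong suc (length-enc j m μ)

dec : ℕ → Column → List ℕ
dec p [] = []
dec p (c ∷ C) with p ∸ c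
... | zero = []
... | suc j = suc j ∷ dec (suc j) C

data Rig : ℕ → List ℕ → Set where
  [] : ∀ {p} → Rig p []
  _∷_ : ∀ {p j μ} → 1 N.≤ j × j N.≤ p → Rig j μ → Rig p (j ∷ μ)

below : ∀ {x ν} → Linked N._≥_ (x ∷ ν) → All (N._≤ x) ν
below [-] = []
below (q ∷ qs) = q ∷ All.map (λ r → NP.≤-trans r q) (below qs)

rig : ∀ p μ → IsPartition μ → All (N._≤ p) μ → Rig p μ
rig p [] _ _ = []
rig p (j ∷ []) (_ , q ∷ _) (r ∷ _) = (q , r) ∷ []
rig p (j ∷ k ∷ μ) (l ∷ ls , q ∷ qs) (r ∷ rs) = (q , r) ∷ rig j (k ∷ μ) (ls , qs) (below (l ∷ ls))

rig-partition : ∀ {p μ} → Rig p μ → IsPartition μ × All (N._≤ p) μ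
rig-partition [] = ([] , []) , []
rig-partition {p} ((q , r) ∷ []) = ([-] , q ∷ []) , r ∷ []
rig-partition {p} ((q , r) ∷ rs@((_ , r') ∷ _)) with rig-partition rs
... | (ls , ps) , bs = (r' ∷ ls , q ∷ ps) , r ∷ All.map (λ b → NP.≤-trans b r) bs

sum-enc : ∀ p m {μ} → Rig p μ → sum (enc p m μ) N.≤ p
sum-enc p zero _ = z≤n
sum-enc p (suc m) [] = NP.≤-trans (NP.+-monoʳ-≤ p (sum-enc 0 m [])) (NP.≤-reflexive (NP.+-identityʳ p))
sum-enc p (suc m) {j ∷ μ} ((_ , r) ∷ rs) = NP.≤-trans (NP.+-monoʳ-≤ (p ∸ j) (sum-enc j m rs)) (NP.≤-reflexive (NP.m∸n+n≡m r))

cs-enc : ∀ p m {μ} → Rig p μ → length μ N.≤ m → sum μ + cs (enc p m μ) ≡ m * p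
cs-enc p zero [] z≤n = refl
cs-enc p (suc m) [] _ rewrite length-enc 0 m [] = trans (cong (λ z → p * suc m + z) (trans (cs-enc 0 m [] z≤n) (NP.*-zeroʳ m)))
  (trans (NP.+-identityʳ _) (NP.*-comm p (suc m)))
cs-enc p (suc m) {j ∷ μ} ((_ , r) ∷ rs) (s≤s l) rewrite length-enc j m μ =
  trans (eq₁ j (p ∸ j) m (sum μ) (cs (enc j m μ))) (trans (cong (λ k → j + (p ∸ j) * suc m + k) (cs-enc j m rs l))
  (trans (eq₂ j (p ∸ j) m) (cong (suc m *_) (NP.m∸n+n≡m r))))
  where
  eq₁ : ∀ j d m s c → j + s + (d * suc m + c) ≡ j + d * suc m + (s + c)
  eq₁ = NR.solve-∀
  eq₂ : ∀ j d m → j + d * suc m + m * j ≡ suc m * (d + j)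
  eq₂ = NR.solve-∀

enc-injective : ∀ p m {μ μ'} → Rig p μ → Rig p μ' → length μ N.≤ m → length μ' N.≤ m → enc p m μ ≡ enc p m μ' → μ ≡ μ'
enc-injective p m [] [] _ _ _ = refl
enc-injective p (suc m) [] ((q , r) ∷ _) _ _ e = ⊥-elim (differ p _ q r (∷-injectiveˡ e))
  where
  differ : ∀ p j → 1 N.≤ j → j N.≤ p → p ≡ p ∸ j → ⊥
  differ (suc p) (suc j) _ _ e = NP.<-irrefl (sym e) (s≤s (NP.m∸n≤m p j))
enc-injective p (suc m) r@((_ ∷ _)) [] l l' e = sym (enc-injective p (suc m) [] r l' l (sym e))
enc-injective p (suc m) {j ∷ μ} {j' ∷ μ'} ((_ , r) ∷ rs) ((_ , r') ∷ rs') (s≤s l) (s≤s l') e = go (NP.∸-cancelˡ-≡ r r' (∷-injectiveˡ e))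
  where
  go : j ≡ j' → j ∷ μ ≡ j' ∷ μ'
  go refl = cong (j ∷_) (enc-injective j m rs rs' l l' (∷-injectiveʳ e))

dec-rig : ∀ p C → Rig p (dec p C) × length (dec p C) N.≤ length C
dec-rig p [] = [] , z≤n
dec-rig p (c ∷ C) with p ∸ c in eq
... | zero = [] , z≤n
... | suc j with dec-rig (suc j) C
... | r , l = (s≤s z≤n , subst (N._≤ p) eq (NP.m∸n≤m p c)) ∷ r , s≤s l

enc-zeros : ∀ C → sum C N.≤ 0 → enc 0 (length C) [] ≡ C
enc-zeros [] _ = refl
enc-zeros (zero ∷ C) p = cong (0 ∷_) (enc-zeros C p)

-- Riggings decrease along the column, so after the first rigging 0 only zeros follow; `dec` drops
-- them, as they are not parts of a partition, and `enc` restores them from the multiplicity.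
enc-dec : ∀ p C → sum C N.≤ p → enc p (length C) (dec p C) ≡ C
enc-dec p [] _ = refl
enc-dec p (c ∷ C) le with p ∸ c in eq
... | zero = cong₂ _∷_ p≡c (enc-zeros C (subst (sum C N.≤_) eq (NP.m+n≤o⇒m≤o∸n (sum C) (subst (N._≤ p) (NP.+-comm c (sum C)) le))))
  where
  p≡c : p ≡ c
  p≡c = NP.≤-antisym (NP.m∸n≡0⇒m≤n eq) (NP.≤-trans (NP.m≤m+n c (sum C)) le)
... | suc j = cong₂ _∷_ back (enc-dec (suc j) C (subst (sum C N.≤_) eq (NP.m+n≤o⇒m≤o∸n (sum C) (subst (N._≤ p) (NP.+-comm c (sum C)) le))))
  where
  back : p ∸ suc j ≡ c
  back = trans (cong (p ∸_) (sym eq)) (NP.m∸[m∸n]≡n (NP.≤-trans (NP.m≤m+n c (sum C)) le))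

-- Partitions from multiplicities

mult-beyond : ∀ {n ν} → All (N._≤ n) ν → ∀ {i} → n N.< i → mult ν i ≡ 0
mult-beyond [] _ = refl
mult-beyond {ν = x ∷ ν} (p ∷ ps) {i} q = cong₂ _+_ (δ-> x i (NP.≤-<-trans p q)) (mult-beyond ps q)

tailL : ∀ {x ν} → Linked N._≥_ (x ∷ ν) → Linked N._≥_ ν
tailL [-] = []
tailL (_ ∷ qs) = qs

mult-head : ∀ x ν → 1 N.≤ mult (x ∷ ν) x
mult-head x ν rewrite δ-refl x = s≤s z≤n

mult-unique : ∀ {ν ν'} → Linked N._≥_ ν → Linked N._≥_ ν' → (∀ i → mult ν i ≡ mult ν' i) → ν ≡ ν'
mult-unique {[]} {[]} _ _ _ = refl
mult-unique {[]} {x ∷ ν'} _ _ e = ⊥-elim (NP.<-irrefl (e x) (mult-head x ν'))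
mult-unique {x ∷ ν} {[]} _ _ e = ⊥-elim (NP.<-irrefl (sym (e x)) (mult-head x ν))
mult-unique {x ∷ ν} {y ∷ ν'} l l' e = go (NP.≤-antisym
    (NP.≮⇒≥ (λ q → NP.<-irrefl (trans (sym (mult-beyond {ν = y ∷ ν'} (NP.≤-refl ∷ below l') q)) (sym (e x))) (mult-head x ν)))
    (NP.≮⇒≥ (λ q → NP.<-irrefl (trans (sym (mult-beyond {ν = x ∷ ν} (NP.≤-refl ∷ below l) q)) (e y)) (mult-head y ν'))))
  where
  go : x ≡ y → x ∷ ν ≡ y ∷ ν'
  go refl = cong (x ∷_) (mult-unique (tailL l) (tailL l') (λ i → NP.+-cancelˡ-≡ (δ x i) _ _ (e i)))

mkPart : (ℕ → ℕ) → ℕ → List ℕ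
mkPart m zero = []
mkPart m (suc n) = L.replicate (m (suc n)) (suc n) ++ mkPart m n

mult-++ : ∀ ν ν' i → mult (ν ++ ν') i ≡ mult ν i + mult ν' i
mult-++ [] ν' i = refl
mult-++ (x ∷ ν) ν' i = trans (cong (λ k → δ x i + k) (mult-++ ν ν' i)) (sym (NP.+-assoc (δ x i) (mult ν i) (mult ν' i)))

mult-replicate : ∀ k x i → mult (L.replicate k x) i ≡ k * δ x i
mult-replicate zero x i = refl
mult-replicate (suc k) x i = cong (λ k → δ x i + k) (mult-replicate k x i)

mkPart-parts : ∀ m n → Parts n (mkPart m n)
mkPart-parts m zero = []
mkPart-parts m (suc n) = go (m (suc n))
  where
  go : ∀ k → Parts (suc n) (L.replicate k (suc n) ++ mkPart m n)
  go zero = parts-≤ (NP.n≤1+n n) (mkPart-parts m n)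
  go (suc k) = (s≤s z≤n , NP.≤-refl) ∷ go k

mkPart-linked : ∀ m n → Linked N._≥_ (mkPart m n)
mkPart-linked m zero = []
mkPart-linked m (suc n) = go (m (suc n))
  where
  link : ∀ {x ν} → All (N._≤ x) ν → Linked N._≥_ ν → Linked N._≥_ (x ∷ ν)
  link [] [] = [-]
  link (p ∷ _) ls = p ∷ ls
  go : ∀ k → Linked N._≥_ (L.replicate k (suc n) ++ mkPart m n)
  go zero = mkPart-linked m n
  go (suc k) = link (le k) (go k)
    where
    le : ∀ k → All (N._≤ suc n) (L.replicate k (suc n) ++ mkPart m n)
    le zero = All.map (λ (_ , q) → NP.≤-trans q (NP.n≤1+n n)) (mkPart-parts m n)
    le (suc k) = NP.≤-refl ∷ le k

mkPart-partition : ∀ m n → IsPartition (mkPart m n)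
mkPart-partition m n = mkPart-linked m n , All.map proj₁ (mkPart-parts m n)

mult-mkPart : ∀ m n i → 1 N.≤ i → i N.≤ n → mult (mkPart m n) i ≡ m i
mult-mkPart m zero i p q = ⊥-elim (NP.<-irrefl refl (NP.≤-trans p q))
mult-mkPart m (suc n) i p q with NP.m≤n⇒m<n∨m≡n q
... | inj₂ refl = trans (mult-++ (L.replicate (m (suc n)) (suc n)) (mkPart m n) (suc n))
    (trans (cong₂ _+_ (trans (mult-replicate (m (suc n)) (suc n) (suc n)) (trans (cong (m (suc n) *_) (δ-refl n)) (NP.*-identityʳ _)))
      (mult-beyond (All.map proj₂ (mkPart-parts m n)) (NP.n<1+n n))) (NP.+-identityʳ _))
... | inj₁ (s≤s q') = trans (mult-++ (L.replicate (m (suc n)) (suc n)) (mkPart m n) i)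
    (cong₂ _+_ (trans (mult-replicate (m (suc n)) (suc n) i) (trans (cong (m (suc n) *_) (δ-< (suc n) i (s≤s q'))) (NP.*-zeroʳ (m (suc n)))))
      (mult-mkPart m n i p q'))


-- Configurations with prescribed columns

conf : (c d : ℕ → Column) → ℕ → ∀ M → Conf M
conf c d j zero = []
conf c d j (suc M) = blk (c (suc (th j))) (c (suc (suc (th j)))) (c (suc (suc (suc (th j))))) (d (suc j)) ∷ conf c d (suc j) M

at₁ atK : ∀ {M} → Conf M → ℕ → Column
at₁ C zero = []
at₁ [] (suc i) = []
at₁ (b ∷ C) (suc zero) = c₁ b
at₁ (b ∷ C) (suc (suc zero)) = c₂ b
at₁ (b ∷ C) (suc (suc (suc zero))) = c₃ b
at₁ (b ∷ C) (suc (suc (suc (suc i)))) = at₁ C (suc i)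
atK C zero = []
atK [] (suc j) = []
atK (b ∷ C) (suc zero) = cK b
atK (b ∷ C) (suc (suc j)) = atK C (suc j)

conf-cong : ∀ {c d c' d'} → (∀ i → c (suc i) ≡ c' (suc i)) → (∀ j → d (suc j) ≡ d' (suc j)) → ∀ j M → conf c d j M ≡ conf c' d' j M
conf-cong e f j zero = refl
conf-cong e f j (suc M) = cong₂ _∷_ (blk-cong (e _) (e _) (e _) (f j)) (conf-cong e f (suc j) M)
  where
  blk-cong : ∀ {x y z k x' y' z' k'} → x ≡ x' → y ≡ y' → z ≡ z' → k ≡ k' → blk x y z k ≡ blk x' y' z' k'
  blk-cong refl refl refl refl = refl

conf-shift : ∀ c d j M → conf c d (suc j) M ≡ conf (λ i → c (suc (suc (suc i)))) (λ i → d (suc i)) j M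
conf-shift c d j zero = refl
conf-shift c d j (suc M) = cong (_ ∷_) (conf-shift c d (suc j) M)

conf-at : ∀ {M} (C : Conf M) → conf (at₁ C) (atK C) 0 M ≡ C
conf-at [] = refl
conf-at {suc M} (b ∷ C) = cong (b ∷_) (trans (conf-shift (at₁ (b ∷ C)) (atK (b ∷ C)) 0 M)
  (trans (conf-cong (λ _ → refl) (λ _ → refl) 0 M) (conf-at C)))

at₁-shift : ∀ c d M i → i N.< th M → at₁ (conf c d 0 M) (suc i) ≡ c (suc i)
at₁-shift c d (suc M) zero _ = refl
at₁-shift c d (suc M) (suc zero) _ = refl
at₁-shift c d (suc M) (suc (suc zero)) _ = refl
at₁-shift c d (suc M) (suc (suc (suc i))) (s≤s (s≤s (s≤s p))) = trans (cong (λ C → at₁ C (suc i)) (conf-shift c d 0 M)) (at₁-shift _ _ M i p)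

atK-shift : ∀ c d M j → j N.< M → atK (conf c d 0 M) (suc j) ≡ d (suc j)
atK-shift c d (suc M) zero _ = refl
atK-shift c d (suc M) (suc j) (s≤s p) = trans (cong (λ C → atK C (suc j)) (conf-shift c d 0 M)) (atK-shift _ _ M j p)

at₁-beyond : ∀ {M} (C : Conf M) i → th M N.≤ i → at₁ C (suc i) ≡ []
at₁-beyond [] i _ = refl
at₁-beyond (b ∷ C) (suc (suc (suc i))) (s≤s (s≤s (s≤s p))) = at₁-beyond C i p

atK-beyond : ∀ {M} (C : Conf M) j → M N.≤ j → atK C (suc j) ≡ []
atK-beyond [] j _ = refl
atK-beyond (b ∷ C) (suc j) (s≤s p) = atK-beyond C j p

-- The quadratic form truncated at length 3j: increasing t by one adds the product
-- of the numbers of parts longer than t, because min(x , y) > t iff x > t and y > t.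

gt-× : ∀ t x y → gt t (x ⊓ y) ≡ gt t x * gt t y
gt-× t zero y = refl
gt-× t (suc x) zero = sym (NP.*-zeroʳ (gt t (suc x)))
gt-× zero (suc x) (suc y) = refl
gt-× (suc t) (suc x) (suc y) = gt-× t x y

sum-product : ∀ (g h : ℕ → ℕ) ν ν' → sum (map (λ x → sum (map (λ y → g x * h y) ν')) ν) ≡ sum (map g ν) * sum (map h ν')
sum-product g h [] ν' = refl
sum-product g h (x ∷ ν) ν' = trans (cong₂ _+_ (factor ν') (sum-product g h ν ν')) (sym (NP.*-distribʳ-+ (sum (map h ν')) (g x) (sum (map g ν))))
  where
  factor : ∀ ν' → sum (map (λ y → g x * h y) ν') ≡ g x * sum (map h ν')
  factor [] = sym (NP.*-zeroʳ (g x))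
  factor (y ∷ ν') = trans (cong (λ k → g x * h y + k) (factor ν')) (sym (NP.*-distribˡ-+ (g x) (h y) (sum (map h ν'))))

pairs : (ℕ → ℕ) → ℕ → List ℕ → List ℕ → ℕ
pairs f t ν ν' = sum (map (λ x → sum (map (λ y → t ⊓ (x ⊓ f y)) ν')) ν)

pairs-suc : ∀ f t k ν ν' → (∀ y → gt t (f y) ≡ gt k y) → pairs f (suc t) ν ν' ≡ pairs f t ν ν' + cnt ν t * cnt ν' k
pairs-suc f t k ν ν' e = trans
  (sum-map-+ _ (λ x → sum (map (λ y → t ⊓ (x ⊓ f y)) ν')) (λ x → sum (map (λ y → gt t x * gt k y) ν')) ν
    (λ x → sum-map-+ _ (λ y → t ⊓ (x ⊓ f y)) (λ y → gt t x * gt k y) ν'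
      (λ y → trans (gt-⊓ t (x ⊓ f y)) (cong (λ z → t ⊓ (x ⊓ f y) + z) (trans (gt-× t x (f y)) (cong (gt t x *_) (e y)))))))
  (cong (λ z → pairs f t ν ν' + z) (sum-product (gt t) (gt k) ν ν'))

sum-map-cong : ∀ {f g : ℕ → ℕ} {ν} → All (λ x → f x ≡ g x) ν → sum (map f ν) ≡ sum (map g ν)
sum-map-cong [] = refl
sum-map-cong (e ∷ es) = cong₂ _+_ e (sum-map-cong es)

pairs-all : ∀ f t {ν} ν' → All (N._≤ t) ν → pairs f t ν ν' ≡ sum (map (λ x → sum (map (λ y → x ⊓ f y) ν')) ν)
pairs-all f t ν' ps = sum-map-cong (All.map (λ {x} p → sum-map-cong (All.universal (λ y → NP.m≥n⇒m⊓n≡n (NP.≤-trans (NP.m⊓n≤m x (f y)) p)) ν')) ps)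

sum-map-0 : ∀ (ν : List ℕ) → sum (map (λ _ → 0) ν) ≡ 0
sum-map-0 [] = refl
sum-map-0 (x ∷ ν) = sum-map-0 ν

pairs-0 : ∀ f ν ν' → pairs f 0 ν ν' ≡ 0
pairs-0 f ν ν' = trans (sum-map-cong {λ x → sum (map (λ y → 0) ν')} {λ _ → 0} (All.universal (λ _ → sum-map-0 ν') ν)) (sum-map-0 ν)

form : List ℕ → List ℕ → ℕ → ℤ
form ν₁ ν₂ j = + pairs (λ x → x) (th j) ν₁ ν₁ - + pairs (3 *_) (th j) ν₁ ν₂ ⊕ + pairs (λ x → x) j ν₂ ν₂

form-suc : ∀ ν₁ ν₂ j → form ν₁ ν₂ (suc j) ≡
  form ν₁ ν₂ j ⊕ quad (+ cnt ν₁ (th j)) (+ cnt ν₁ (suc (th j))) (+ cnt ν₁ (suc (suc (th j)))) (+ cnt ν₂ j)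
form-suc ν₁ ν₂ j = trans (cong₂ _⊕_ (cong₂ _-_
    (trans (up₁ _) (cong₂ _⊕_ (trans (up₁ _) (cong₂ _⊕_ (up₁ _) refl)) refl))
    (trans (up₃ _ (λ y → proj₂ (proj₂ (gt-th j y)))) (cong₂ _⊕_ (trans (up₃ _ (λ y → proj₁ (proj₂ (gt-th j y)))) (cong₂ _⊕_ (up₃ _ (λ y → proj₁ (gt-th j y))) refl)) refl))) (upK j))
  (eq (+ pairs (λ x → x) (th j) ν₁ ν₁) (+ pairs (3 *_) (th j) ν₁ ν₂) (+ pairs (λ x → x) j ν₂ ν₂)
    (+ cnt ν₁ (th j)) (+ cnt ν₁ (suc (th j))) (+ cnt ν₁ (suc (suc (th j)))) (+ cnt ν₂ j))
  where
  up₁ : ∀ t → + pairs (λ x → x) (suc t) ν₁ ν₁ ≡ + pairs (λ x → x) t ν₁ ν₁ ⊕ + cnt ν₁ t ⊛ + cnt ν₁ t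
  up₁ t = trans (cong +_ (pairs-suc (λ x → x) t t ν₁ ν₁ (λ _ → refl))) (cong (+ pairs (λ x → x) t ν₁ ν₁ ⊕_) (ZP.pos-* (cnt ν₁ t) (cnt ν₁ t)))
  upK : ∀ t → + pairs (λ x → x) (suc t) ν₂ ν₂ ≡ + pairs (λ x → x) t ν₂ ν₂ ⊕ + cnt ν₂ t ⊛ + cnt ν₂ t
  upK t = trans (cong +_ (pairs-suc (λ x → x) t t ν₂ ν₂ (λ _ → refl))) (cong (+ pairs (λ x → x) t ν₂ ν₂ ⊕_) (ZP.pos-* (cnt ν₂ t) (cnt ν₂ t)))
  up₃ : ∀ t → (∀ y → gt t (th y) ≡ gt j y) → + pairs (3 *_) (suc t) ν₁ ν₂ ≡ + pairs (3 *_) t ν₁ ν₂ ⊕ + cnt ν₁ t ⊛ + cnt ν₂ j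
  up₃ t g = trans (cong +_ (pairs-suc (3 *_) t j ν₁ ν₂ (λ y → trans (cong (gt t) (th-3* y)) (g y))))
    (cong (+ pairs (3 *_) t ν₁ ν₂ ⊕_) (ZP.pos-* (cnt ν₁ t) (cnt ν₂ j)))
  eq : ∀ A B C x y z k → (((A ⊕ x ⊛ x) ⊕ y ⊛ y) ⊕ z ⊛ z) - (((B ⊕ x ⊛ k) ⊕ y ⊛ k) ⊕ z ⊛ k) ⊕ (C ⊕ k ⊛ k) ≡
    (A - B ⊕ C) ⊕ (x ⊛ x ⊕ (y ⊛ y ⊕ z ⊛ z) - (x ⊕ (y ⊕ z)) ⊛ k ⊕ k ⊛ k)
  eq = ZR.solve-∀

upsum : (ℕ → ℕ) → ℕ → ℕ → ℕ
upsum u t zero = 0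
upsum u t (suc n) = u (suc t) + upsum u (suc t) n

upsum-shift : ∀ u t n → upsum u (suc t) n ≡ upsum (λ i → u (suc i)) t n
upsum-shift u t zero = refl
upsum-shift u t (suc n) = cong (λ k → u (suc (suc t)) + k) (upsum-shift u (suc t) n)

upsum-Jat : ∀ J n → length J N.≤ n → upsum (λ i → sum (Jat J i)) 0 n ≡ sum (map sum J)
upsum-Jat [] n _ = zeros 0 n
  where
  zeros : ∀ t n → upsum (λ i → sum (Jat [] i)) t n ≡ 0
  zeros t zero = refl
  zeros t (suc n) = zeros (suc t) n
upsum-Jat (μ ∷ J) (suc n) (s≤s p) = cong (λ k → sum μ + k)
  (trans (upsum-shift (λ i → sum (Jat (μ ∷ J) i)) 0 n) (trans (same 0 n) (upsum-Jat J n p)))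
  where
  same : ∀ t n → upsum (λ i → sum (Jat (μ ∷ J) (suc i))) t n ≡ upsum (λ i → sum (Jat J i)) t n
  same t zero = refl
  same t (suc n) = cong (λ k → sum (Jat J (suc t)) + k) (same (suc t) n)

vacL₁-suc : ∀ ν₁ ν₂ L t j → (∀ y → gt t (th y) ≡ gt j y) → dn (vacL₁ ν₁ ν₂ L t) (cnt ν₁ t) (cnt ν₂ j) ≡ vacL₁ ν₁ ν₂ L (suc t)
vacL₁-suc ν₁ ν₂ L t j e = trans (eq (+ sum₁ t ν₁) (+ sum₃ t ν₂) (+ cnt ν₁ t) (+ cnt ν₂ j))
  (sym (cong₂ (λ x y → - (+ 2 ⊛ + x) ⊕ + y) (sum₁-suc ν₁ t) (sum₃-suc ν₂ t j e)))
  where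
  eq : ∀ s r n k → (- (+ 2 ⊛ s) ⊕ r) - (n ⊕ n) ⊕ k ≡ - (+ 2 ⊛ (s ⊕ n)) ⊕ (r ⊕ k)
  eq = ZR.solve-∀

vacL₂-suc : ∀ ν₁ ν₂ L j → vacL₂ ν₁ ν₂ L j ⊕ + (cnt ν₁ (th j) + (cnt ν₁ (suc (th j)) + cnt ν₁ (suc (suc (th j))))) - + (cnt ν₂ j + cnt ν₂ j) ≡ vacL₂ ν₁ ν₂ L (suc j)
vacL₂-suc ν₁ ν₂ L j = trans (eq (+ L) (+ sum₁ (3 * j) ν₁) (+ sum₁ j ν₂) (+ cnt ν₁ (th j)) (+ cnt ν₁ (suc (th j))) (+ cnt ν₁ (suc (suc (th j)))) (+ cnt ν₂ j))
  (sym (cong₂ (λ x y → + L ⊕ + x - + 2 ⊛ + y) up (sum₁-suc ν₂ j)))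
  where
  up : sum₁ (3 * suc j) ν₁ ≡ sum₁ (3 * j) ν₁ + cnt ν₁ (th j) + cnt ν₁ (suc (th j)) + cnt ν₁ (suc (suc (th j)))
  up = trans (cong (λ t → sum₁ t ν₁) (th-3* (suc j))) (trans (sum₁-suc ν₁ (suc (suc (th j)))) (cong (λ k → k + cnt ν₁ (suc (suc (th j))))
    (trans (sum₁-suc ν₁ (suc (th j))) (cong (λ k → k + cnt ν₁ (suc (th j))) (trans (sum₁-suc ν₁ (th j)) (cong (λ t → sum₁ t ν₁ + cnt ν₁ (th j)) (sym (th-3* j))))))))
  eq : ∀ L s r x y z k → (L ⊕ s - + 2 ⊛ r) ⊕ (x ⊕ (y ⊕ z)) - (k ⊕ k) ≡ L ⊕ (s ⊕ x ⊕ y ⊕ z) - + 2 ⊛ (r ⊕ k)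
  eq = ZR.solve-∀

-- Highest weight condition and charge in terms of partitions

module Shape (ν₁ ν₂ : List ℕ) (L : ℕ) (c d : ℕ → Column)
    (lc : ∀ i → length (c (suc i)) ≡ mult ν₁ (suc i)) (ld : ∀ j → length (d (suc j)) ≡ mult ν₂ (suc j))
    (K : ℕ) (bd₁ : All (N._≤ th K) ν₁) (bd₂ : All (N._≤ K) ν₂) where

  v1 v2 : ℕ → ℤ
  v1 = vacL₁ ν₁ ν₂ L
  v2 = vacL₂ ν₁ ν₂ L

  next≡ : ∀ j M → j + suc M ≡ K → suc j + M ≡ K
  next≡ j M e = trans (sym (NP.+-suc j M)) e

  last≡ : ∀ j → j + 0 ≡ K → K ≡ j
  last≡ j e = sym (trans (sym (NP.+-identityʳ j)) e)

  peel₁ : ∀ t {n} → n ≡ cnt ν₁ (suc t) → length (c (suc t)) + n ≡ cnt ν₁ t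
  peel₁ t refl = trans (cong (λ k → k + cnt ν₁ (suc t)) (lc t)) (sym (cnt-suc ν₁ t))

  peelK : ∀ j {n} → n ≡ cnt ν₂ (suc j) → length (d (suc j)) + n ≡ cnt ν₂ j
  peelK j refl = trans (cong (λ k → k + cnt ν₂ (suc j)) (ld j)) (sym (cnt-suc ν₂ j))

  #₁-conf : ∀ j M → j + M ≡ K → #₁ (conf c d j M) ≡ cnt ν₁ (th j)
  #₁-conf j zero e = sym (cnt-0 ν₁ (th j) (subst (λ k → All (N._≤ th k) ν₁) (last≡ j e) bd₁))
  #₁-conf j (suc M) e = peel₁ _ (peel₁ _ (peel₁ _ (#₁-conf (suc j) M (next≡ j M e))))

  #K-conf : ∀ j M → j + M ≡ K → #K (conf c d j M) ≡ cnt ν₂ j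
  #K-conf j zero e = sym (cnt-0 ν₂ j (subst (λ k → All (N._≤ k) ν₂) (last≡ j e) bd₂))
  #K-conf j (suc M) e = peelK j (#K-conf (suc j) M (next≡ j M e))

  module At (j M : ℕ) (e : j + suc M ≡ K) where
    rest : Conf M
    rest = conf c d (suc j) M
    blockAt : Block
    blockAt = blk (c (suc (th j))) (c (suc (suc (th j)))) (c (suc (suc (suc (th j))))) (d (suc j))
    open Vac blockAt (#₁ rest) (#K rest) public

    m₃≡ : m₃ ≡ cnt ν₁ (suc (suc (th j)))
    m₃≡ = peel₁ _ (#₁-conf (suc j) M (next≡ j M e))
    m₂≡ : m₂ ≡ cnt ν₁ (suc (th j))
    m₂≡ = peel₁ _ m₃≡
    m₁≡ : m₁ ≡ cnt ν₁ (th j)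
    m₁≡ = peel₁ _ m₂≡
    NK≡ : NK ≡ cnt ν₂ j
    NK≡ = peelK j (#K-conf (suc j) M (next≡ j M e))

    v₁≡ : v₁ (v1 (th j)) ≡ v1 (suc (th j))
    v₁≡ = trans (cong₂ (dn (v1 (th j))) m₁≡ NK≡) (vacL₁-suc ν₁ ν₂ L (th j) j (λ y → proj₁ (gt-th j y)))
    v₂≡ : v₂ (v1 (th j)) ≡ v1 (suc (suc (th j)))
    v₂≡ = trans (cong (λ p → dn p m₂ NK) v₁≡) (trans (cong₂ (dn (v1 (suc (th j)))) m₂≡ NK≡) (vacL₁-suc ν₁ ν₂ L (suc (th j)) j (λ y → proj₁ (proj₂ (gt-th j y)))))
    v₃≡ : v₃ (v1 (th j)) ≡ v1 (th (suc j))
    v₃≡ = trans (cong (λ p → dn p m₃ NK) v₂≡) (trans (cong₂ (dn (v1 (suc (suc (th j))))) m₃≡ NK≡) (vacL₁-suc ν₁ ν₂ L (suc (suc (th j))) j (λ y → proj₂ (proj₂ (gt-th j y)))))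
    vK≡ : vK (v2 j) ≡ v2 (suc j)
    vK≡ = trans (cong₂ (λ n k → v2 j ⊕ + n - + (k + k)) (cong₂ _+_ m₁≡ (cong₂ _+_ m₂≡ m₃≡)) NK≡) (vacL₂-suc ν₁ ν₂ L j)

  Fits : ℤ → ℤ → ℕ → ℕ → Set
  Fits l₁ l₂ j zero = v1 (th j) ≡ l₁ × v2 j ≡ l₂
  Fits l₁ l₂ j (suc M) = (+ sum (c (suc (th j))) ≤ᶻ v1 (suc (th j))) × (+ sum (c (suc (suc (th j)))) ≤ᶻ v1 (suc (suc (th j))))
    × (+ sum (c (th (suc j))) ≤ᶻ v1 (th (suc j))) × (+ sum (d (suc j)) ≤ᶻ v2 (suc j)) × Fits l₁ l₂ (suc j) M

  HW≡Fits : ∀ l₁ l₂ j M → j + M ≡ K → HW (v1 (th j)) (v2 j) (conf c d j M) l₁ l₂ ≡ Fits l₁ l₂ j M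
  HW≡Fits l₁ l₂ j zero e = refl
  HW≡Fits l₁ l₂ j (suc M) e = product v₁≡ v₂≡ v₃≡ vK≡
      (trans (cong₂ (λ p P → HW p P rest l₁ l₂) v₃≡ vK≡) (HW≡Fits l₁ l₂ (suc j) M (next≡ j M e)))
    where
    open At j M e
    product : ∀ {x y z k a b f g a' b' f' g' : ℤ} {X X' : Set} → a ≡ a' → b ≡ b' → f ≡ f' → g ≡ g' → X ≡ X' →
      ((x ≤ᶻ a) × (y ≤ᶻ b) × (z ≤ᶻ f) × (k ≤ᶻ g) × X) ≡ ((x ≤ᶻ a') × (y ≤ᶻ b') × (z ≤ᶻ f') × (k ≤ᶻ g') × X')
    product refl refl refl refl refl = refl

  Ends : ℤ → ℤ → Set
  Ends l₁ l₂ = v1 (th K) ≡ l₁ × v2 K ≡ l₂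

  fits-all : ∀ {l₁ l₂} → (∀ i → + sum (c (suc i)) ≤ᶻ v1 (suc i)) → (∀ j → + sum (d (suc j)) ≤ᶻ v2 (suc j)) → Ends l₁ l₂ →
    ∀ j M → j + M ≡ K → Fits l₁ l₂ j M
  fits-all p q r j zero e = subst (λ k → v1 (th k) ≡ _ × v2 k ≡ _) (last≡ j e) r
  fits-all p q r j (suc M) e = p _ , p _ , p _ , q _ , fits-all p q r (suc j) M (next≡ j M e)

  -- Addition with an accumulator: passing over three columns turns `th j` into `th (suc j)` by
  -- computation.
  skip : ℕ → ℕ → ℕ
  skip zero t = t
  skip (suc i) t = skip i (suc t)

  skip-0 : ∀ i → skip i 0 ≡ i
  skip-0 i = trans (go i 0) (NP.+-identityʳ i)
    where
    go : ∀ i t → skip i t ≡ i + t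
    go zero t = refl
    go (suc i) t = trans (go i (suc t)) (NP.+-suc i t)

  fits₁ : ∀ {l₁ l₂} j M → Fits l₁ l₂ j M → ∀ i → i N.< th M → + sum (c (skip (suc i) (th j))) ≤ᶻ v1 (skip (suc i) (th j))
  fits₁ j (suc M) (p , q , r , s , f) zero _ = p
  fits₁ j (suc M) (p , q , r , s , f) (suc zero) _ = q
  fits₁ j (suc M) (p , q , r , s , f) (suc (suc zero)) _ = r
  fits₁ j (suc M) (p , q , r , s , f) (suc (suc (suc i))) (s≤s (s≤s (s≤s le))) = fits₁ (suc j) M f i le

  fitsK : ∀ {l₁ l₂} j M → Fits l₁ l₂ j M → ∀ i → i N.< M → + sum (d (skip (suc i) j)) ≤ᶻ v2 (skip (suc i) j)
  fitsK j (suc M) (p , q , r , s , f) zero _ = s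
  fitsK j (suc M) (p , q , r , s , f) (suc i) (s≤s le) = fitsK (suc j) M f i le

  fits-ends : ∀ {l₁ l₂} j M → j + M ≡ K → Fits l₁ l₂ j M → Ends l₁ l₂
  fits-ends j zero e r = subst (λ k → v1 (th k) ≡ _ × v2 k ≡ _) (sym (last≡ j e)) r
  fits-ends j (suc M) e (_ , _ , _ , _ , f) = fits-ends (suc j) M (next≡ j M e) f

  v1-0 : v1 0 ≡ + 0
  v1-0 = cong₂ (λ x y → - (+ 2 ⊛ + x) ⊕ + y) (sum-map-0 ν₁) (sum-map-0 ν₂)

  v2-0 : v2 0 ≡ + L
  v2-0 = trans (cong₂ (λ x y → + L ⊕ + x - + 2 ⊛ + y) (sum-map-0 ν₁) (sum-map-0 ν₂)) (eq (+ L))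
    where
    eq : ∀ L → L ⊕ + 0 - + 2 ⊛ + 0 ≡ L
    eq = ZR.solve-∀

  HW-conf≡ : ∀ l₁ l₂ → HW (+ 0) (+ L) (conf c d 0 K) l₁ l₂ ≡ Fits l₁ l₂ 0 K
  HW-conf≡ l₁ l₂ = trans (cong₂ (λ p P → HW p P (conf c d 0 K) l₁ l₂) (sym v1-0) (sym v2-0)) (HW≡Fits l₁ l₂ 0 K refl)

  v1-end : ∀ {i} → th K N.≤ i → v1 i ≡ - (+ 2 ⊛ + sum ν₁) ⊕ + 3 ⊛ + sum ν₂
  v1-end {i} le = cong₂ (λ x y → - (+ 2 ⊛ + x) ⊕ y) (sum₁-all ν₁ i (All.map (λ p → NP.≤-trans p le) bd₁))
    (trans (cong +_ (sum₃-all ν₂ K bd₂ (subst (N._≤ i) (sym (th-3* K)) le))) (ZP.pos-* 3 (sum ν₂)))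

  v2-end : ∀ {j} → K N.≤ j → v2 j ≡ + L ⊕ + sum ν₁ - + 2 ⊛ + sum ν₂
  v2-end {j} le = cong₂ (λ x y → + L ⊕ + x - + 2 ⊛ + y)
    (sum₁-all ν₁ (3 * j) (All.map (λ p → NP.≤-trans p (subst (N._≤ 3 * j) (th-3* K) (NP.*-monoʳ-≤ 3 le))) bd₁))
    (sum₁-all ν₂ j (All.map (λ p → NP.≤-trans p le) bd₂))

  module Charge (u w : ℕ → ℕ)
      (ec : ∀ i → + u (suc i) ⊕ + cs (c (suc i)) ≡ + length (c (suc i)) ⊛ v1 (suc i))
      (ed : ∀ j → + w (suc j) ⊕ + cs (d (suc j)) ≡ + length (d (suc j)) ⊛ v2 (suc j)) where

    F : ℕ → ℤ
    F = form ν₁ ν₂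

    -- Summation by parts for the blocks after j: the vacancy numbers at the boundary multiply the
    -- numbers of longer strings, and the quadratic form appears with the opposite sign. At j = 0
    -- the boundary values are 0 and L.
    Claim : ℕ → ℕ → Set
    Claim j M = energy (conf c d j M) ≡
      v1 (th j) ⊛ + #₁ (conf c d j M) ⊕ v2 j ⊛ + #K (conf c d j M) - (F K - F j) - + (upsum u (th j) (th M) + upsum w j M)

    isolate : ∀ (x y : ℤ) {z} → x ⊕ y ≡ z → y ≡ z - x
    isolate x y refl = eq x y
      where
      eq : ∀ x y → y ≡ (x ⊕ y) - x
      eq = ZR.solve-∀

    cs-c : ∀ i → + cs (c (suc i)) ≡ + length (c (suc i)) ⊛ v1 (suc i) - + u (suc i)
    cs-c i = isolate (+ u (suc i)) (+ cs (c (suc i))) (ec i)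
    cs-d : ∀ j → + cs (d (suc j)) ≡ + length (d (suc j)) ⊛ v2 (suc j) - + w (suc j)
    cs-d j = isolate (+ w (suc j)) (+ cs (d (suc j))) (ed j)

    step-eq : ∀ (p P n N l₁ l₂ l₃ lK u₁ u₂ u₃ uK U W f fK : ℤ) {q₁ q₂ q₃ qK E f' v₁ v₂ v₃ vK : ℤ} →
      let n₂ = l₃ ⊕ n ; n₁ = l₂ ⊕ n₂ ; n₀ = l₁ ⊕ n₁ ; k = lK ⊕ N in
      p - (n₀ ⊕ n₀) ⊕ k ≡ v₁ → v₁ - (n₁ ⊕ n₁) ⊕ k ≡ v₂ → v₂ - (n₂ ⊕ n₂) ⊕ k ≡ v₃ → P ⊕ (n₀ ⊕ (n₁ ⊕ n₂)) - (k ⊕ k) ≡ vK →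
      q₁ ≡ l₁ ⊛ v₁ - u₁ → q₂ ≡ l₂ ⊛ v₂ - u₂ → q₃ ≡ l₃ ⊛ v₃ - u₃ → qK ≡ lK ⊛ vK - uK →
      f' ≡ f ⊕ quad n₀ n₁ n₂ k → E ≡ v₃ ⊛ n ⊕ vK ⊛ N - (fK - f') - (U ⊕ W) →
      quad n₀ n₁ n₂ k ⊕ (q₁ ⊕ (q₂ ⊕ (q₃ ⊕ qK))) ⊕ E ≡ p ⊛ n₀ ⊕ P ⊛ k - (fK - f) - ((u₁ ⊕ (u₂ ⊕ (u₃ ⊕ U))) ⊕ (uK ⊕ W))
    step-eq p P n N l₁ l₂ l₃ lK u₁ u₂ u₃ uK U W f fK refl refl refl refl refl refl refl refl refl refl = eq p P n N l₁ l₂ l₃ lK u₁ u₂ u₃ uK U W f fK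
      where
      eq : ∀ (p P n N l₁ l₂ l₃ lK u₁ u₂ u₃ uK U W f fK : ℤ) →
        let n₂ = l₃ ⊕ n ; n₁ = l₂ ⊕ n₂ ; n₀ = l₁ ⊕ n₁ ; k = lK ⊕ N
            v₁ = p - (n₀ ⊕ n₀) ⊕ k ; v₂ = v₁ - (n₁ ⊕ n₁) ⊕ k ; v₃ = v₂ - (n₂ ⊕ n₂) ⊕ k ; vK = P ⊕ (n₀ ⊕ (n₁ ⊕ n₂)) - (k ⊕ k)
            q = n₀ ⊛ n₀ ⊕ (n₁ ⊛ n₁ ⊕ n₂ ⊛ n₂) - (n₀ ⊕ (n₁ ⊕ n₂)) ⊛ k ⊕ k ⊛ k in
        q ⊕ ((l₁ ⊛ v₁ - u₁) ⊕ ((l₂ ⊛ v₂ - u₂) ⊕ ((l₃ ⊛ v₃ - u₃) ⊕ (lK ⊛ vK - uK)))) ⊕ (v₃ ⊛ n ⊕ vK ⊛ N - (fK - (f ⊕ q)) - (U ⊕ W))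
        ≡ p ⊛ n₀ ⊕ P ⊛ k - (fK - f) - ((u₁ ⊕ (u₂ ⊕ (u₃ ⊕ U))) ⊕ (uK ⊕ W))
      eq = ZR.solve-∀

    claim : ∀ j M → j + M ≡ K → Claim j M
    claim j zero e with last≡ j e
    ... | refl = eq (v1 (th K)) (v2 K) (F K)
      where
      eq : ∀ p P f → + 0 ≡ p ⊛ + 0 ⊕ P ⊛ + 0 - (f - f) - + 0
      eq = ZR.solve-∀
    claim j (suc M) e = step-eq (v1 (th j)) (v2 j) (+ #₁ rest) (+ #K rest) (+ length (c (suc (th j)))) (+ length (c (suc (suc (th j)))))
        (+ length (c (th (suc j)))) (+ length (d (suc j))) (+ u (suc (th j))) (+ u (suc (suc (th j)))) (+ u (th (suc j))) (+ w (suc j))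
        (+ upsum u (th (suc j)) (th M)) (+ upsum w (suc j) M) (F j) (F K)
        v₁≡ (trans (cong (λ p → dn p m₂ NK) (sym v₁≡)) v₂≡) (trans (cong (λ p → dn p m₃ NK) (sym v₂≡)) v₃≡) vK≡
        (cs-c _) (cs-c _) (cs-c _) (cs-d _)
        (trans (form-suc ν₁ ν₂ j) (cong (F j ⊕_) (sym quad≡))) (claim (suc j) M (next≡ j M e))
      where
      open At j M e
      quad≡ : quad (+ m₁) (+ m₂) (+ m₃) (+ NK) ≡ quad (+ cnt ν₁ (th j)) (+ cnt ν₁ (suc (th j))) (+ cnt ν₁ (suc (suc (th j)))) (+ cnt ν₂ j)
      quad≡ rewrite m₁≡ | m₂≡ | m₃≡ | NK≡ = refl

    energy-conf : - energy (conf c d 0 K) ≡ F K - + L ⊛ + cnt ν₂ 0 ⊕ + (upsum u 0 (th K) + upsum w 0 K)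
    energy-conf = trans (cong -_ (trans (claim 0 K refl) (cong₂ (λ x y → x - (F K - y) - S) (cong₂ _⊕_ (cong (_⊛ + #₁ (conf c d 0 K)) v1-0)
        (cong₂ _⊛_ v2-0 (cong +_ (#K-conf 0 K refl)))) F-0))) (eq (+ #₁ (conf c d 0 K)) (+ L) (+ cnt ν₂ 0) (F K) S)
      where
      S = + (upsum u 0 (th K) + upsum w 0 K)
      F-0 : F 0 ≡ + 0
      F-0 = cong₂ _⊕_ (cong₂ (λ x y → + x - + y) (pairs-0 (λ x → x) ν₁ ν₁) (pairs-0 (3 *_) ν₁ ν₂)) (cong +_ (pairs-0 (λ x → x) ν₂ ν₂))
      eq : ∀ n L k f S → - ((+ 0 ⊛ n ⊕ L ⊛ k) - (f - + 0) - S) ≡ f - L ⊛ k ⊕ S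
      eq = ZR.solve-∀


-- From rigged configurations to toColumns and back

toColumn : (ℕ → ℤ) → List ℕ → List (List ℕ) → ℕ → Column
toColumn v ν J i = enc ∣ v i ∣ (mult ν i) (Jat J i)

toColumns : ∀ K → ℕ → RCData → Conf K
toColumns K L ((ν₁ , ν₂) , (J₁ , J₂)) = conf (toColumn (vacL₁ ν₁ ν₂ L) ν₁ J₁) (toColumn (vacL₂ ν₁ ν₂ L) ν₂ J₂) 0 K

record Rigs (v : ℕ → ℤ) (ν : List ℕ) (J : List (List ℕ)) : Set where
  constructor rigs
  field
    rigAt : ∀ i → 0ℤ ≤ᶻ v (suc i) × Rig ∣ v (suc i) ∣ (Jat J (suc i)) × length (Jat J (suc i)) N.≤ mult ν (suc i)

open Rigs

∣∣-≤⁺ : ∀ {n p} → 0ℤ ≤ᶻ p → n N.≤ ∣ p ∣ → + n ≤ᶻ p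
∣∣-≤⁺ {n} q le = subst (λ z → + n ≤ᶻ z) (ZP.0≤i⇒+∣i∣≡i q) (+≤+ le)

∣∣-≤⁻ : ∀ {n p} → 0ℤ ≤ᶻ p → + n ≤ᶻ p → n N.≤ ∣ p ∣
∣∣-≤⁻ {n} q le = ZP.drop‿+≤+ (subst (λ z → + n ≤ᶻ z) (sym (ZP.0≤i⇒+∣i∣≡i q)) le)

rect : ∀ {p μ m} → 0ℤ ≤ᶻ p → InRect μ m p → Rig ∣ p ∣ μ × length μ N.≤ m
rect {p} {μ} q (ip , l , a) = rig ∣ p ∣ μ ip (All.map (∣∣-≤⁻ q) a) , l

unrect : ∀ {p μ m} → 0ℤ ≤ᶻ p → Rig ∣ p ∣ μ → length μ N.≤ m → InRect μ m p
unrect {p} q r l with rig-partition r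
... | ip , a = ip , l , All.map (∣∣-≤⁺ q) a

module _ {v : ℕ → ℤ} {ν : List ℕ} {J : List (List ℕ)} (r : Rigs v ν J) where
  col-sum : ∀ i → + sum (toColumn v ν J (suc i)) ≤ᶻ v (suc i)
  col-sum i = let (q , rg , _) = rigAt r i in ∣∣-≤⁺ q (sum-enc ∣ v (suc i) ∣ (mult ν (suc i)) rg)

  col-length : ∀ i → length (toColumn v ν J (suc i)) ≡ mult ν (suc i)
  col-length i = length-enc ∣ v (suc i) ∣ (mult ν (suc i)) (Jat J (suc i))

  col-cs : ∀ i → + sum (Jat J (suc i)) ⊕ + cs (toColumn v ν J (suc i)) ≡ + length (toColumn v ν J (suc i)) ⊛ v (suc i)
  col-cs i = let (q , rg , l) = rigAt r i in
    trans (cong +_ (cs-enc ∣ v (suc i) ∣ (mult ν (suc i)) rg l)) (trans (ZP.pos-* (mult ν (suc i)) ∣ v (suc i) ∣)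
      (cong₂ _⊛_ (cong +_ (sym (col-length i))) (ZP.0≤i⇒+∣i∣≡i q)))

Jat-ext : ∀ J J' → length J ≡ length J' → (∀ i → Jat J (suc i) ≡ Jat J' (suc i)) → J ≡ J'
Jat-ext [] [] _ _ = refl
Jat-ext (μ ∷ J) (μ' ∷ J') l e = cong₂ _∷_ (e 0) (Jat-ext J J' (NP.suc-injective l) (λ i → e (suc i)))

col-injective : ∀ {v ν J J'} → Rigs v ν J → Rigs v ν J' → length J ≡ length J' → (∀ i → toColumn v ν J (suc i) ≡ toColumn v ν J' (suc i)) → J ≡ J'
col-injective {v} {ν} {J} {J'} r r' l e = Jat-ext J J' l (λ i →
  enc-injective ∣ v (suc i) ∣ (mult ν (suc i)) (proj₁ (proj₂ (rigAt r i))) (proj₁ (proj₂ (rigAt r' i))) (proj₂ (proj₂ (rigAt r i))) (proj₂ (proj₂ (rigAt r' i))) (e i))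

mult-0 : ∀ {ν} → Pos ν → mult ν 0 ≡ 0
mult-0 [] = refl
mult-0 (s≤s _ ∷ ps) = mult-0 ps

th≥ : ∀ k → k N.≤ th k
th≥ zero = z≤n
th≥ (suc k) = s≤s (NP.≤-trans (th≥ k) (NP.≤-trans (NP.n≤1+n _) (NP.n≤1+n _)))

sum-map-id : ∀ ν → sum (map (λ x → x) ν) ≡ sum ν
sum-map-id [] = refl
sum-map-id (x ∷ ν) = cong (λ k → x + k) (sum-map-id ν)

cnt-length : ∀ {ν} → Pos ν → cnt ν 0 ≡ sum (map (λ _ → 1) ν)
cnt-length [] = refl
cnt-length (s≤s _ ∷ ps) = cong suc (cnt-length ps)

maxPart-≤ : ∀ {ν n} → All (N._≤ n) ν → maxPart ν N.≤ n
maxPart-≤ [] = z≤n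
maxPart-≤ (p ∷ ps) = NP.⊔-lub p (maxPart-≤ ps)

≤-maxPart : ∀ ν → All (N._≤ maxPart ν) ν
≤-maxPart [] = []
≤-maxPart (x ∷ ν) = NP.m≤m⊔n x (maxPart ν) ∷ All.map (λ p → NP.≤-trans p (NP.m≤n⊔m x (maxPart ν))) (≤-maxPart ν)

-- With s₁ = |ν₁| and s₂ = |ν₂|, 2 λ₁ + 3 λ₂ = 3 L − s₁ and λ₁ + 2 λ₂ = 2 L − s₂.
module _ (l₁ l₂ L s₁ s₂ : ℕ) (e₁ : + l₁ ≡ - (+ 2 ⊛ + s₁) ⊕ + 3 ⊛ + s₂) (e₂ : + l₂ ≡ + L ⊕ + s₁ - + 2 ⊛ + s₂) where
  size₁-≤ : s₁ N.≤ L + (L + L)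
  size₁-≤ = ZP.drop‿+≤+ (≤-via (+ (l₁ + l₁ + (l₂ + (l₂ + l₂)))) (+≤+ z≤n) (trans (eq (+ L) (+ s₁) (+ s₂))
      (sym (cong₂ (λ x y → (x ⊕ x) ⊕ (y ⊕ (y ⊕ y))) e₁ e₂))))
    where
    eq : ∀ L a b → (L ⊕ (L ⊕ L)) - a ≡ ((- (+ 2 ⊛ a) ⊕ + 3 ⊛ b) ⊕ (- (+ 2 ⊛ a) ⊕ + 3 ⊛ b)) ⊕ ((L ⊕ a - + 2 ⊛ b) ⊕ ((L ⊕ a - + 2 ⊛ b) ⊕ (L ⊕ a - + 2 ⊛ b)))
    eq = ZR.solve-∀

  size₂-≤ : s₂ N.≤ L + L
  size₂-≤ = ZP.drop‿+≤+ (≤-via (+ (l₁ + (l₂ + l₂))) (+≤+ z≤n) (trans (eq (+ L) (+ s₁) (+ s₂)) (sym (cong₂ (λ x y → x ⊕ (y ⊕ y)) e₁ e₂))))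
    where
    eq : ∀ L a b → (L ⊕ L) - b ≡ (- (+ 2 ⊛ a) ⊕ + 3 ⊛ b) ⊕ ((L ⊕ a - + 2 ⊛ b) ⊕ (L ⊕ a - + 2 ⊛ b))
    eq = ZR.solve-∀

module Rigged {l₁ l₂ L : ℕ} (K : ℕ) (3L≤K : L + (L + L) N.≤ K) (ν₁ ν₂ : List ℕ) (J₁ J₂ : List (List ℕ)) (rc : IsRC l₁ l₂ L ((ν₁ , ν₂) , (J₁ , J₂))) where
  part₁ : IsPartition ν₁
  part₁ = proj₁ (proj₁ rc)
  part₂ : IsPartition ν₂
  part₂ = proj₁ (proj₂ (proj₁ rc))
  open Sums ν₁ ν₂ (proj₂ part₁) (proj₂ part₂) public

  weight₁ : + l₁ ≡ - (+ 2 ⊛ + sum ν₁) ⊕ + 3 ⊛ + sum ν₂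
  weight₁ = trans (proj₁ (proj₂ (proj₂ (proj₁ rc)))) (cong₂ (λ a b → - (+ 2 ⊛ a) ⊕ + 3 ⊛ b)
    (trans (Σm₁ (λ j → j)) (cong +_ (sum-map-id ν₁))) (trans (Σm₂ (λ j → j)) (cong +_ (sum-map-id ν₂))))
  weight₂ : + l₂ ≡ + L ⊕ + sum ν₁ - + 2 ⊛ + sum ν₂
  weight₂ = trans (proj₁ (proj₂ (proj₂ (proj₂ (proj₁ rc))))) (cong₂ (λ a b → + L ⊕ a - + 2 ⊛ b)
    (trans (Σm₁ (λ j → j)) (cong +_ (sum-map-id ν₁))) (trans (Σm₂ (λ j → j)) (cong +_ (sum-map-id ν₂))))

  bd₁ : All (N._≤ th K) ν₁
  bd₁ = All.map proj₂ (parts-sum ν₁ (proj₂ part₁) (NP.≤-trans (size₁-≤ l₁ l₂ L (sum ν₁) (sum ν₂) weight₁ weight₂) (NP.≤-trans 3L≤K (th≥ K))))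
  bd₂ : All (N._≤ K) ν₂
  bd₂ = All.map proj₂ (parts-sum ν₂ (proj₂ part₂) (NP.≤-trans (size₂-≤ l₁ l₂ L (sum ν₁) (sum ν₂) weight₁ weight₂) (NP.≤-trans (NP.m≤n+m (L + L) L) 3L≤K)))

  w1 w2 : ℕ → ℤ
  w1 = vacL₁ ν₁ ν₂ L
  w2 = vacL₂ ν₁ ν₂ L

  rigs₁ : Rigs w1 ν₁ J₁
  rigs₁ = rigs (λ i → q i , rect (q i) (subst (InRect _ _) (vac₁≡ ν₁ ν₂ (proj₂ part₁) (proj₂ part₂) L (suc i)) (proj₁ (proj₂ (proj₂ (proj₂ rc))) (suc i) (s≤s z≤n))))
    where
    q : ∀ i → 0ℤ ≤ᶻ w1 (suc i)
    q i = subst (0ℤ ≤ᶻ_) (vac₁≡ ν₁ ν₂ (proj₂ part₁) (proj₂ part₂) L (suc i)) (proj₁ (proj₂ (proj₂ (proj₂ (proj₂ (proj₁ rc))))) (suc i) (s≤s z≤n))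

  rigs₂ : Rigs w2 ν₂ J₂
  rigs₂ = rigs (λ i → q i , rect (q i) (subst (InRect _ _) (vac₂≡ ν₁ ν₂ (proj₂ part₁) (proj₂ part₂) L (suc i)) (proj₂ (proj₂ (proj₂ (proj₂ rc))) (suc i) (s≤s z≤n))))
    where
    q : ∀ i → 0ℤ ≤ᶻ w2 (suc i)
    q i = subst (0ℤ ≤ᶻ_) (vac₂≡ ν₁ ν₂ (proj₂ part₁) (proj₂ part₂) L (suc i)) (proj₂ (proj₂ (proj₂ (proj₂ (proj₂ (proj₁ rc))))) (suc i) (s≤s z≤n))

  C : Conf K
  C = toColumns K L ((ν₁ , ν₂) , (J₁ , J₂))

  open Shape ν₁ ν₂ L (toColumn w1 ν₁ J₁) (toColumn w2 ν₂ J₂) (col-length rigs₁) (col-length rigs₂) K bd₁ bd₂ public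

  columns-HW : HW (+ 0) (+ L) C (+ l₁) (+ l₂)
  columns-HW = subst (λ X → X) (sym (HW-conf≡ (+ l₁) (+ l₂)))
    (fits-all (col-sum rigs₁) (col-sum rigs₂) (trans (v1-end NP.≤-refl) (sym weight₁) , trans (v2-end NP.≤-refl) (sym weight₂)) 0 K refl)

  open Charge (λ i → sum (Jat J₁ i)) (λ i → sum (Jat J₂ i)) (col-cs rigs₁) (col-cs rigs₂)

  charge-energy : cconf L (ν₁ , ν₂) ⊕ sizeJ (J₁ , J₂) ≡ - energy C
  charge-energy = trans (cong₂ _⊕_ conf≡ size≡) (sym energy-conf)
    where
    size≡ : sizeJ (J₁ , J₂) ≡ + (upsum (λ i → sum (Jat J₁ i)) 0 (th K) + upsum (λ i → sum (Jat J₂ i)) 0 K)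
    size≡ = cong +_ (sym (cong₂ _+_
      (upsum-Jat J₁ (th K) (NP.≤-trans (NP.≤-reflexive (proj₁ (proj₂ rc))) (maxPart-≤ bd₁)))
      (upsum-Jat J₂ K (NP.≤-trans (NP.≤-reflexive (proj₁ (proj₂ (proj₂ rc)))) (maxPart-≤ bd₂)))))
    conf≡ : cconf L (ν₁ , ν₂) ≡ form ν₁ ν₂ K - + L ⊛ + cnt ν₂ 0
    conf≡ = cong₂ _-_ (cong₂ _⊕_ (cong₂ _-_
        (trans (double ν₁ ν₁ parts₁ parts₁ _⊓_) (cong +_ (sym (pairs-all (λ x → x) (th K) ν₁ bd₁))))
        (trans (double ν₁ ν₂ parts₁ parts₂ (λ i j → i ⊓ (3 * j))) (cong +_ (sym (pairs-all (3 *_) (th K) ν₂ bd₁)))))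
        (trans (double ν₂ ν₂ parts₂ parts₂ _⊓_) (cong +_ (sym (pairs-all (λ x → x) K ν₂ bd₂)))))
      (cong (+ L ⊛_) (trans (Σm₂ (λ j → 1)) (cong +_ (sym (cnt-length (proj₂ part₂))))))

  col-at₁ : ∀ i → at₁ C (suc i) ≡ toColumn w1 ν₁ J₁ (suc i)
  col-at₁ i with NP.<-≤-connex i (th K)
  ... | inj₁ p = at₁-shift (toColumn w1 ν₁ J₁) (toColumn w2 ν₂ J₂) K i p
  ... | inj₂ p = trans (at₁-beyond C i p) (sym (cong (λ m → enc ∣ w1 (suc i) ∣ m (Jat J₁ (suc i))) (mult-beyond bd₁ (s≤s p))))

  col-atK : ∀ i → atK C (suc i) ≡ toColumn w2 ν₂ J₂ (suc i)
  col-atK i with NP.<-≤-connex i K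
  ... | inj₁ p = atK-shift (toColumn w1 ν₁ J₁) (toColumn w2 ν₂ J₂) K i p
  ... | inj₂ p = trans (atK-beyond C i p) (sym (cong (λ m → enc ∣ w2 (suc i) ∣ m (Jat J₂ (suc i))) (mult-beyond bd₂ (s≤s p))))

columns-injective : ∀ {l₁ l₂ L} K → L + (L + L) N.≤ K → (x y : RC l₁ l₂ L) → toColumns K L (proj₁ x) ≡ toColumns K L (proj₁ y) → proj₁ x ≡ proj₁ y
columns-injective {L = L} K le (((ν₁ , ν₂) , (J₁ , J₂)) , rc) (((ν₁' , ν₂') , (J₁' , J₂')) , rc') e = go ν₁≡ ν₂≡ rc'.rigs₁ rc'.rigs₂ col₁≡ colK≡
    (trans (proj₁ (proj₂ rc)) (trans (cong maxPart ν₁≡) (sym (proj₁ (proj₂ rc')))))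
    (trans (proj₁ (proj₂ (proj₂ rc))) (trans (cong maxPart ν₂≡) (sym (proj₁ (proj₂ (proj₂ rc'))))))
  where
  module rc = Rigged K le ν₁ ν₂ J₁ J₂ rc
  module rc' = Rigged K le ν₁' ν₂' J₁' J₂' rc'
  col₁≡ : ∀ i → toColumn (vacL₁ ν₁ ν₂ L) ν₁ J₁ (suc i) ≡ toColumn (vacL₁ ν₁' ν₂' L) ν₁' J₁' (suc i)
  col₁≡ i = trans (sym (rc.col-at₁ i)) (trans (cong (λ C → at₁ C (suc i)) e) (rc'.col-at₁ i))
  colK≡ : ∀ i → toColumn (vacL₂ ν₁ ν₂ L) ν₂ J₂ (suc i) ≡ toColumn (vacL₂ ν₁' ν₂' L) ν₂' J₂' (suc i)
  colK≡ i = trans (sym (rc.col-atK i)) (trans (cong (λ C → atK C (suc i)) e) (rc'.col-atK i))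
  ν₁≡ : ν₁ ≡ ν₁'
  ν₁≡ = mult-unique (proj₁ rc.part₁) (proj₁ rc'.part₁) λ where
    zero → trans (mult-0 (proj₂ rc.part₁)) (sym (mult-0 (proj₂ rc'.part₁)))
    (suc i) → trans (sym (col-length rc.rigs₁ i)) (trans (cong length (col₁≡ i)) (col-length rc'.rigs₁ i))
  ν₂≡ : ν₂ ≡ ν₂'
  ν₂≡ = mult-unique (proj₁ rc.part₂) (proj₁ rc'.part₂) λ where
    zero → trans (mult-0 (proj₂ rc.part₂)) (sym (mult-0 (proj₂ rc'.part₂)))
    (suc i) → trans (sym (col-length rc.rigs₂ i)) (trans (cong length (colK≡ i)) (col-length rc'.rigs₂ i))
  go : ∀ {ν₁' ν₂'} → ν₁ ≡ ν₁' → ν₂ ≡ ν₂' → Rigs (vacL₁ ν₁' ν₂' L) ν₁' J₁' → Rigs (vacL₂ ν₁' ν₂' L) ν₂' J₂' →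
    (∀ i → toColumn (vacL₁ ν₁ ν₂ L) ν₁ J₁ (suc i) ≡ toColumn (vacL₁ ν₁' ν₂' L) ν₁' J₁' (suc i)) →
    (∀ i → toColumn (vacL₂ ν₁ ν₂ L) ν₂ J₂ (suc i) ≡ toColumn (vacL₂ ν₁' ν₂' L) ν₂' J₂' (suc i)) →
    length J₁ ≡ length J₁' → length J₂ ≡ length J₂' → ((ν₁ , ν₂) , (J₁ , J₂)) ≡ ((ν₁' , ν₂') , (J₁' , J₂'))
  go refl refl r₁ r₂ f g k l = cong₂ (λ a b → (ν₁ , ν₂) , (a , b)) (col-injective rc.rigs₁ r₁ k f) (col-injective rc.rigs₂ r₂ l g)

listJ : (ℕ → List ℕ) → ℕ → List (List ℕ)
listJ f zero = []
listJ f (suc n) = f 1 ∷ listJ (λ i → f (suc i)) n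

length-listJ : ∀ f n → length (listJ f n) ≡ n
length-listJ f zero = refl
length-listJ f (suc n) = cong suc (length-listJ _ n)

Jat-listJ : ∀ f n → (∀ i → n N.≤ i → f (suc i) ≡ []) → ∀ i → Jat (listJ f n) (suc i) ≡ f (suc i)
Jat-listJ f zero z i = sym (z i z≤n)
Jat-listJ f (suc n) z zero = refl
Jat-listJ f (suc n) z (suc i) = Jat-listJ (λ i → f (suc i)) n (λ i p → z (suc i) (s≤s p)) i

columns-surjective : ∀ {l₁ l₂ L K} (C : Conf K) → HW (+ 0) (+ L) C (+ l₁) (+ l₂) → ∃ λ (x : RC l₁ l₂ L) → toColumns K L (proj₁ x) ≡ C
columns-surjective {l₁} {l₂} {L} {K} C hw = (((ν₁ , ν₂) , (J₁ , J₂)) , isRC) , trans (conf-cong back₁ back₂ 0 K) (conf-at C)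
  where
  ν₁ = mkPart (λ i → length (at₁ C i)) (th K)
  ν₂ = mkPart (λ i → length (atK C i)) K
  parts₁ = mkPart-parts (λ i → length (at₁ C i)) (th K)
  parts₂ = mkPart-parts (λ i → length (atK C i)) K
  bd₁ = All.map proj₂ parts₁
  bd₂ = All.map proj₂ parts₂
  pos₁ = All.map proj₁ parts₁
  pos₂ = All.map proj₁ parts₂
  length₁ : ∀ i → length (at₁ C (suc i)) ≡ mult ν₁ (suc i)
  length₁ i with NP.<-≤-connex i (th K)
  ... | inj₁ p = sym (mult-mkPart (λ i → length (at₁ C i)) (th K) (suc i) (s≤s z≤n) p)
  ... | inj₂ p = trans (cong length (at₁-beyond C i p)) (sym (mult-beyond bd₁ (s≤s p)))
  length₂ : ∀ i → length (atK C (suc i)) ≡ mult ν₂ (suc i)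
  length₂ i with NP.<-≤-connex i K
  ... | inj₁ p = sym (mult-mkPart (λ i → length (atK C i)) K (suc i) (s≤s z≤n) p)
  ... | inj₂ p = trans (cong length (atK-beyond C i p)) (sym (mult-beyond bd₂ (s≤s p)))
  open Shape ν₁ ν₂ L (at₁ C) (atK C) length₁ length₂ K bd₁ bd₂
  f : Fits (+ l₁) (+ l₂) 0 K
  f = subst (λ X → X) (HW-conf≡ (+ l₁) (+ l₂)) (subst (λ C' → HW (+ 0) (+ L) C' (+ l₁) (+ l₂)) (sym (conf-at C)) hw)
  ends = fits-ends 0 K refl f
  sum≤₁ : ∀ i → + sum (at₁ C (suc i)) ≤ᶻ v1 (suc i)
  sum≤₁ i with NP.<-≤-connex i (th K)
  ... | inj₁ p = subst (λ k → + sum (at₁ C k) ≤ᶻ v1 k) (skip-0 (suc i)) (fits₁ 0 K f i p)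
  -- Beyond the last block the column is empty and the vacancy number has its limit λ₁, which is
  -- nonnegative.
  ... | inj₂ p = subst₂ _≤ᶻ_ (cong (λ X → + sum X) (sym (at₁-beyond C i p)))
    (trans (sym (proj₁ ends)) (trans (v1-end NP.≤-refl) (sym (v1-end (NP.≤-trans p (NP.n≤1+n i)))))) (+≤+ z≤n)
  sum≤₂ : ∀ i → + sum (atK C (suc i)) ≤ᶻ v2 (suc i)
  sum≤₂ i with NP.<-≤-connex i K
  ... | inj₁ p = subst (λ k → + sum (atK C k) ≤ᶻ v2 k) (skip-0 (suc i)) (fitsK 0 K f i p)
  ... | inj₂ p = subst₂ _≤ᶻ_ (cong (λ X → + sum X) (sym (atK-beyond C i p)))
    (trans (sym (proj₂ ends)) (trans (v2-end NP.≤-refl) (sym (v2-end (NP.≤-trans p (NP.n≤1+n i)))))) (+≤+ z≤n)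
  0≤₁ : ∀ i → 0ℤ ≤ᶻ v1 (suc i)
  0≤₁ i = ZP.≤-trans (+≤+ z≤n) (sum≤₁ i)
  0≤₂ : ∀ i → 0ℤ ≤ᶻ v2 (suc i)
  0≤₂ i = ZP.≤-trans (+≤+ z≤n) (sum≤₂ i)
  rig₁ rig₂ : ℕ → List ℕ
  rig₁ i = dec ∣ v1 i ∣ (at₁ C i)
  rig₂ i = dec ∣ v2 i ∣ (atK C i)
  J₁ = listJ rig₁ (maxPart ν₁)
  J₂ = listJ rig₂ (maxPart ν₂)
  J₁≡ : ∀ i → Jat J₁ (suc i) ≡ rig₁ (suc i)
  J₁≡ = Jat-listJ rig₁ (maxPart ν₁) (λ i p → cong (dec ∣ v1 (suc i) ∣)
    (length-0 {at₁ C (suc i)} (trans (length₁ i) (mult-beyond (≤-maxPart ν₁) (s≤s p)))))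
  J₂≡ : ∀ i → Jat J₂ (suc i) ≡ rig₂ (suc i)
  J₂≡ = Jat-listJ rig₂ (maxPart ν₂) (λ i p → cong (dec ∣ v2 (suc i) ∣)
    (length-0 {atK C (suc i)} (trans (length₂ i) (mult-beyond (≤-maxPart ν₂) (s≤s p)))))
  back₁ : ∀ i → toColumn v1 ν₁ J₁ (suc i) ≡ at₁ C (suc i)
  back₁ i = trans (cong₂ (enc ∣ v1 (suc i) ∣) (sym (length₁ i)) (J₁≡ i))
    (enc-dec ∣ v1 (suc i) ∣ (at₁ C (suc i)) (∣∣-≤⁻ (0≤₁ i) (sum≤₁ i)))
  back₂ : ∀ i → toColumn v2 ν₂ J₂ (suc i) ≡ atK C (suc i)
  back₂ i = trans (cong₂ (enc ∣ v2 (suc i) ∣) (sym (length₂ i)) (J₂≡ i))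
    (enc-dec ∣ v2 (suc i) ∣ (atK C (suc i)) (∣∣-≤⁻ (0≤₂ i) (sum≤₂ i)))
  module S = Sums ν₁ ν₂ pos₁ pos₂
  vac1≡ : ∀ i → v1 i ≡ vac1 (ν₁ , ν₂) L i
  vac1≡ i = sym (vac₁≡ ν₁ ν₂ pos₁ pos₂ L i)
  vac2≡ : ∀ i → v2 i ≡ vac2 (ν₁ , ν₂) L i
  vac2≡ i = sym (vac₂≡ ν₁ ν₂ pos₁ pos₂ L i)
  Σid₁ = trans (S.Σm₁ (λ j → j)) (cong +_ (sum-map-id ν₁))
  Σid₂ = trans (S.Σm₂ (λ j → j)) (cong +_ (sum-map-id ν₂))
  isRC : IsRC l₁ l₂ L ((ν₁ , ν₂) , (J₁ , J₂))
  isRC = (mkPart-partition _ (th K) , mkPart-partition _ K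
      , trans (sym (proj₁ ends)) (trans (v1-end NP.≤-refl) (sym (cong₂ (λ a b → - (+ 2 ⊛ a) ⊕ + 3 ⊛ b) Σid₁ Σid₂)))
      , trans (sym (proj₂ ends)) (trans (v2-end NP.≤-refl) (sym (cong₂ (λ a b → + L ⊕ a - + 2 ⊛ b) Σid₁ Σid₂)))
      , (λ { (suc i) _ → subst (0ℤ ≤ᶻ_) (vac1≡ (suc i)) (0≤₁ i) })
      , (λ { (suc i) _ → subst (0ℤ ≤ᶻ_) (vac2≡ (suc i)) (0≤₂ i) }))
    , length-listJ rig₁ _ , length-listJ rig₂ _
    , (λ { (suc i) _ → subst (InRect _ _) (vac1≡ (suc i)) (subst (λ μ → InRect μ (mult ν₁ (suc i)) (v1 (suc i))) (sym (J₁≡ i))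
        (let (r , l) = dec-rig ∣ v1 (suc i) ∣ (at₁ C (suc i)) in unrect (0≤₁ i) r (NP.≤-trans l (NP.≤-reflexive (length₁ i))))) })
    , (λ { (suc i) _ → subst (InRect _ _) (vac2≡ (suc i)) (subst (λ μ → InRect μ (mult ν₂ (suc i)) (v2 (suc i))) (sym (J₂≡ i))
        (let (r , l) = dec-rig ∣ v2 (suc i) ∣ (atK C (suc i)) in unrect (0≤₂ i) r (NP.≤-trans l (NP.≤-reflexive (length₂ i))))) })

-- The bijection from rigged configurations to paths

theorem3p1 : (L λ₁ λ₂ : ℕ) →
    Σ (RC λ₁ λ₂ L → Path λ₁ λ₂ L) (λ Φ →
      (∀ x y → proj₁ (Φ x) ≡ proj₁ (Φ y) → proj₁ x ≡ proj₁ y)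
      × (∀ (p : Path λ₁ λ₂ L) → ∃ (λ x → proj₁ (Φ x) ≡ proj₁ p))
      × (∀ x → charge x ≡ D (proj₁ (Φ x))))
theorem3p1 L λ₁ λ₂ = Φ , injective , surjective , charge-D
  where
  -- One more than the bound 2 + 3L of `path-surjective`, which speaks of `suc M` blocks; a number
  -- of blocks depending on L alone serves all rigged configurations at once.
  K = 3 + (L + (L + L))
  3L≤K : L + (L + L) N.≤ K
  3L≤K = NP.m≤n+m (L + (L + L)) 3
  0≤ : ∀ {n : ℕ} → 0ℤ ≤ᶻ + n
  0≤ = +≤+ z≤n
  columnsHW : (x : RC λ₁ λ₂ L) → HW (+ 0) (+ L) (toColumns K L (proj₁ x)) (+ λ₁) (+ λ₂)
  columnsHW (((ν₁ , ν₂) , (J₁ , J₂)) , rc) = Rigged.columns-HW K 3L≤K ν₁ ν₂ J₁ J₂ rc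
  Φ : RC λ₁ λ₂ L → Path λ₁ λ₂ L
  Φ x = path L (toColumns K L (proj₁ x)) , path-IsPath L (toColumns K L (proj₁ x)) 0≤ 0≤ (columnsHW x)
  injective : ∀ x y → proj₁ (Φ x) ≡ proj₁ (Φ y) → proj₁ x ≡ proj₁ y
  injective x y e = columns-injective K 3L≤K x y
    (path-injective L (toColumns K L (proj₁ x)) (toColumns K L (proj₁ y)) 0≤ 0≤ (columnsHW x) (columnsHW y) e)
  surjective : ∀ (p : Path λ₁ λ₂ L) → ∃ (λ x → proj₁ (Φ x) ≡ proj₁ p)
  surjective (v , ip) = lift (path-surjective L NP.≤-refl v ip)
    where
    lift : (∃ λ (C : Conf K) → HW (+ 0) (+ L) C (+ λ₁) (+ λ₂) × path L C ≡ v) → ∃ (λ x → proj₁ (Φ x) ≡ v)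
    lift (C , hw , e) = let (x , e') = columns-surjective C hw in x , trans (cong (path L) e') e
  charge-D : ∀ x → charge x ≡ D (proj₁ (Φ x))
  charge-D x@(((ν₁ , ν₂) , (J₁ , J₂)) , rc) = trans (Rigged.charge-energy K 3L≤K ν₁ ν₂ J₁ J₂ rc)
    (proj₁ (energy-path L (toColumns K L (proj₁ x)) 0≤ 0≤ (columnsHW x)))
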